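{- Let $C(z)=\frac{1-\sqrt{1-4z}}{2z}=\sum_{n\ge 0}\operatorname{Cat}(n)z^n$ be the generating function of the Catalan numbers, and for $\xi\ge 0$ let $W_\xi(z)=\sum_{\ell\ge 0}\frac{w_{\ell-\xi+1,2\ell}}{(\ell-\xi+1)!}z^\ell$ be the generating function of tree walks of excess $\xi$. Then $W_0(z)=C(z)$, and for every $\xi\ge 1$ there are polynomials $(K_{\xi,s}(x))_{0\le s\le 2\xi-2}$ with non-negative coefficients, $K_{\xi,s}$ of degree $2\xi+s$, such that \[ W_\xi(z)=C(z)\sum_{s=0}^{2\xi-2}\frac{K_{\xi,s}\big(zC(z)^2\big)}{\big(1-zC(z)^2\big)^{s+1}}. \] Moreover $K_{\xi,2\xi-2}(x)=\operatorname{Cat}(\xi-1)x^{4\xi-2}$ for all $\xi\ge 1$, and $K_{\xi,2\xi-3}(x)=(3\xi-1)\operatorname{Cat}(\xi-1)x^{4\xi-3}$ for all $\xi\ge 2$.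
   Context: A tree walk of size $m$ and length $L$ is a sequence $W=(v_1,\dots,v_L)$ of elements of $[m]=\{1,\dots,m\}$ in which every element of $[m]$ occurs, such that the graph $T(W)$ with vertex set $[m]$ and edge set $\{\{v_j,v_{j+1}\}:1\le j<L\}\cup\{\{v_L,v_1\}\}$ is a tree; $W$ is regarded as the closed walk $v_1\to v_2\to\dots\to v_L\to v_1$ and $v_1$ is the root of $T(W)$. By convention the one-vertex walk of length $0$ is a tree walk of size $1$. Every tree walk has even length. $w_{m,2\ell}$ denotes the number of tree walks of size $m$ and length $2\ell$, with $w_{1,0}=1$, $w_{0,0}=0$, $w_{0,2\ell}=w_{1,2\ell}=0$ for $\ell\ge 1$, and $w_{m,2\ell}=0$ whenever $m<0$. Each edge of $T(W)$ is traversed $2k$ times ($k\ge1$) by the closed walk; its excess is $k-1$. The excess of $W$ is the sum of the excesses of the edges of $T(W)$, equal to $\ell-(m-1)$ for a walk of length $2\ell$ and size $m$. $\operatorname{Cat}(n)=\frac{1}{n+1}\binom{2n}{n}$. -}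

module Defs where

open import Level using (0ℓ)
open import Data.Nat as ℕ using (ℕ; zero; suc; z≤n; s≤s; _≤_; _<_; _!)
import Data.Nat.Properties as ℕ
open import Data.Nat.Combinatorics using (_C_)
open import Data.Integer as ℤ using (ℤ; +_; -[1+_]; _⊖_)
open import Data.Rational as ℚ using (ℚ; 0ℚ; 1ℚ; _/_; 1/_)
import Data.Rational.Properties as ℚ
open import Data.Fin as Fin using (Fin; zero; suc; toℕ; fromℕ<)
import Data.Fin.Properties as Fin
open import Data.List as List using (List; []; _∷_; length; filter; replicate)
import Data.List.Relation.Unary.All as ListAll
open import Data.List.Relation.Unary.Any using (here)
import Data.List.Membership.Propositional as ListMem
open import Data.List.Membership.Propositional.Properties
  using (∈-cartesianProductWith⁺; ∈-allFin)
open import Data.Vec as Vec using (Vec; []; _∷_; _∷ʳ_; zip; lookup)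
open import Data.Vec.Membership.Propositional using (_∈_)
open import Data.Vec.Relation.Unary.All as All using (All)
import Data.Vec.Relation.Unary.AllPairs as AllPairs
open import Data.Vec.Relation.Unary.Any using (here; there)
open import Data.Vec.Relation.Unary.Unique.Propositional using (Unique)
open import Data.Vec.Relation.Unary.Unique.Propositional.Properties
  using (lookup-injective)
import Data.Vec.Membership.DecPropositional as DecMem
open import Data.Product using (_×_; _,_; proj₁; uncurry)
open import Data.Product.Properties using (≡-dec)
open import Data.Sum using (_⊎_; inj₁; inj₂; swap)
open import Function using (_∘_)
open import Relation.Nullary using (¬_; Dec; yes; no)
open import Relation.Nullary.Decidable using (map′; _×-dec_; _⊎-dec_; ¬?)
open import Relation.Unary using (Decidable)
open import Relation.Binary using (Rel) renaming (Decidable to Decidable₂)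
open import Relation.Binary.Construct.Closure.ReflexiveTransitive
  using (Star; ε; _◅_; _◅◅_; reverse)
open import Relation.Binary.PropositionalEquality using (_≡_; _≢_; refl)
open import Algebra.Properties.Monoid.Sum ℚ.+-0-monoid using (sum-syntax)

------------------------------------------------------------------------
-- Graphs and trees

-- The consecutive pairs (v₁,v₂), …, (v_{L-1},v_L), (v_L,v₁).
steps : ∀ {a} {A : Set a} {L} → Vec A L → Vec (A × A) L
steps []       = []
steps (x ∷ xs) = zip (x ∷ xs) (xs ∷ʳ x)

module _ {m : ℕ} (E : Rel (Fin m) 0ℓ) where

  Connected : Set
  Connected = ∀ u v → Star E u v

  Loopless : Set
  Loopless = ∀ v → ¬ E v v

  IsCycle : ∀ {n} → Vec (Fin m) n → Set
  IsCycle c = Unique c × All (uncurry E) (steps c)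

  Acyclic : Set
  Acyclic = ∀ k (c : Vec (Fin m) (3 ℕ.+ k)) → ¬ IsCycle c

  -- E is meant to be the adjacency relation of an undirected graph,
  -- i.e. symmetric.
  IsTree : Set
  IsTree = 1 ≤ m × Loopless × Connected × Acyclic

------------------------------------------------------------------------
-- Tree walks

-- Adjacency in T(W).  A repetition v_j = v_{j+1} gives a loop at v_j, so
-- T(W) is then not a tree.
T : ∀ {m L} → Vec (Fin m) L → Rel (Fin m) 0ℓ
T W u v = (u , v) ∈ steps W ⊎ (v , u) ∈ steps W

Covers : ∀ {m L} → Vec (Fin m) L → Set
Covers W = ∀ v → v ∈ W

-- The first summand is the one-vertex walk of length 0, a tree walk of
-- size 1 by convention.
IsTreeWalk : ∀ {m L} → Vec (Fin m) L → Set
IsTreeWalk {m} {L} W = (m ≡ 1 × L ≡ 0) ⊎ (Covers W × IsTree (T W))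

allVecs : ∀ {a} {A : Set a} → List A → ∀ n → List (Vec A n)
allVecs xs zero    = [] ∷ []
allVecs xs (suc n) = List.cartesianProductWith _∷_ xs (allVecs xs n)

∈-allVecs : ∀ {m n} (v : Vec (Fin m) n) → v ListMem.∈ allVecs (List.allFin m) n
∈-allVecs []      = here refl
∈-allVecs (x ∷ v) = ∈-cartesianProductWith⁺ _∷_ (∈-allFin x) (∈-allVecs v)

allVecs? : ∀ {m n p} {P : Vec (Fin m) n → Set p} → Decidable P → Dec (∀ v → P v)
allVecs? {m} {n} P? = map′ (λ all v → ListAll.lookup all (∈-allVecs v))
                           (λ all → ListAll.tabulate (λ {v} _ → all v))
                           (ListAll.all? P? (allVecs (List.allFin m) n))

-- A cycle has at most m vertices, so acyclicity is a finite check.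
acyclic? : ∀ {m} {E : Rel (Fin m) 0ℓ} → Decidable₂ E → Dec (Acyclic E)
acyclic? {m} {E} E? =
  map′ unbound (λ ac k → ac (toℕ k))
       (Fin.all? {n = m} λ k → allVecs? λ c →
         ¬? (AllPairs.allPairs? (λ x y → ¬? (x Fin.≟ y)) c
             ×-dec All.all? (λ (u , v) → E? u v) (steps c)))
  where
  unbound : (∀ (k : Fin m) (c : Vec (Fin m) (3 ℕ.+ toℕ k)) → ¬ IsCycle E c) →
            Acyclic E
  unbound ac k c cyc@(uniq , _)
    with k<m ← ℕ.≤-trans (s≤s (ℕ.m≤n+m k 2))
                 (Fin.injective⇒≤ {f = lookup c} (lookup-injective uniq _ _))
    with fromℕ< k<m | Fin.toℕ-fromℕ< k<m
  ... | k′ | refl = ac k′ c cyc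

T? : ∀ {m L} (W : Vec (Fin m) L) → Decidable₂ (T W)
T? W u v = ((u , v) ∈? steps W) ⊎-dec ((v , u) ∈? steps W)
  where open DecMem (≡-dec Fin._≟_ Fin._≟_) using (_∈?_)

reach : ∀ {A : Set} (R : Rel A 0ℓ) {n} (x y : A) (xs : Vec A n) →
        (∀ {u v} → (u , v) ∈ zip (x ∷ xs) (xs ∷ʳ y) → R u v) →
        ∀ {v} → v ∈ x ∷ xs → Star R x v
reach R x y xs       f (here refl) = ε
reach R x y (z ∷ xs) f (there v∈)  = f (here refl) ◅ reach R z y xs (f ∘ there) v∈

covers⇒connected : ∀ {m L} (W : Vec (Fin m) L) → Covers W → Connected (T W)
covers⇒connected []       cov u v with () ← cov u
covers⇒connected (x ∷ xs) cov u v = reverse swap (from-x u) ◅◅ from-x v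
  where
  from-x : ∀ v → Star (T (x ∷ xs)) x v
  from-x v = reach (T (x ∷ xs)) x x xs inj₁ (cov v)

isTreeWalk? : ∀ {m L} → Decidable (IsTreeWalk {m} {L})
isTreeWalk? {m} {L} W = ((m ℕ.≟ 1) ×-dec (L ℕ.≟ 0)) ⊎-dec coveringTree?
  where
  open DecMem (Fin._≟_ {m}) using (_∈?_)
  coveringTree? : Dec (Covers W × IsTree (T W))
  coveringTree? with Fin.all? (_∈? W)
  ... | no ¬cov = no (¬cov ∘ proj₁)
  ... | yes cov =
    map′ (λ (1≤m , loopless , acyclic) →
            cov , 1≤m , loopless , covers⇒connected W cov , acyclic)
         (λ (_ , 1≤m , loopless , _ , acyclic) → 1≤m , loopless , acyclic)
         ((1 ℕ.≤? m) ×-dec Fin.all? (λ v → ¬? (T? W v v)) ×-dec acyclic? (T? W))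

w : ℕ → ℕ → ℕ
w m L = length (filter isTreeWalk? (allVecs (List.allFin m) L))

------------------------------------------------------------------------
-- Formal power series over ℚ

Series : Set
Series = ℕ → ℚ

infix  4 _≈ₛ_
infixl 6 _+ₛ_ _-ₛ_
infixl 7 _*ₛ_
infixr 8 _^ₛ_

_≈ₛ_ : Rel Series 0ℓ
f ≈ₛ g = ∀ n → f n ≡ g n

const : ℚ → Series
const a zero    = a
const a (suc _) = 0ℚ

1ₛ : Series
1ₛ = const 1ℚ

z : Series
z 1 = 1ℚ
z _ = 0ℚ

_+ₛ_ : Series → Series → Series
(f +ₛ g) n = f n ℚ.+ g n

_-ₛ_ : Series → Series → Series
(f -ₛ g) n = f n ℚ.- g n

_*ₛ_ : Series → Series → Series
(f *ₛ g) n = ∑[ i < suc n ] (f (toℕ i) ℚ.* g (n ℕ.∸ toℕ i))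

_^ₛ_ : Series → ℕ → Series
f ^ₛ zero  = 1ₛ
f ^ₛ suc n = f *ₛ f ^ₛ n

-- ∑ₛ n F = F 0 + F 1 + … + F n
∑ₛ : ℕ → (ℕ → Series) → Series
∑ₛ n F k = ∑[ s < suc n ] F (toℕ s) k

-- The multiplicative inverse g of f, from the recursion
--   g₀ = 1/f₀,   g_{n+1} = - (1/f₀) · ∑_{i ≤ n} f_{i+1} g_{n-i}.
-- inverseCoeffs f n lists g_n, g_{n-1}, …, g₀.
inverseCoeffs : (f : Series) .{{_ : ℚ.NonZero (f 0)}} (n : ℕ) → Vec ℚ (suc n)
inverseCoeffs f zero    = (1/ f 0) ∷ []
inverseCoeffs f (suc n) =
  ℚ.- ((1/ f 0) ℚ.* (∑[ i < suc n ] (f (suc (toℕ i)) ℚ.* lookup gs i))) ∷ gs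
  where gs = inverseCoeffs f n

inverse : (f : Series) .{{_ : ℚ.NonZero (f 0)}} → Series
inverse f n = Vec.head (inverseCoeffs f n)

-- r is the square root of f with constant term 1.
IsSqrt : Series → Series → Set
IsSqrt r f = r 0 ≡ 1ℚ × r *ₛ r ≈ₛ f

------------------------------------------------------------------------
-- Polynomials over ℚ, as coefficient lists, constant coefficient first

Poly : Set
Poly = List ℚ

coeff : Poly → ℕ → ℚ
coeff []      _       = 0ℚ
coeff (a ∷ p) zero    = a
coeff (a ∷ p) (suc n) = coeff p n

infix 4 _≈ₚ_

-- Trailing zeros are irrelevant.
_≈ₚ_ : Rel Poly 0ℓ
p ≈ₚ q = ∀ n → coeff p n ≡ coeff q n

-- monomial a d = a x^d
monomial : ℚ → ℕ → Poly
monomial a d = replicate d 0ℚ List.++ a ∷ []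

NonNegCoeffs : Poly → Set
NonNegCoeffs p = ∀ n → 0ℚ ℚ.≤ coeff p n

HasDegree : Poly → ℕ → Set
HasDegree p d = coeff p d ≢ 0ℚ × (∀ n → d < n → coeff p n ≡ 0ℚ)

eval : Poly → Series → Series
eval []      f = const 0ℚ
eval (a ∷ p) f = const a +ₛ f *ₛ eval p f

------------------------------------------------------------------------
-- The generating functions

fromℕ : ℕ → ℚ
fromℕ n = + n / 1

Cat : ℕ → ℚ
Cat n = + ((2 ℕ.* n) C n) / suc n

C : Series
C = Cat

-- w_{m,L} / m!, which is 0 for m < 0.
w/! : ℤ → ℕ → ℚ
w/! (+ m)    L = (+ w m L / m !) {{m ℕ.!≢0}}
w/! -[1+ _ ] L = 0ℚ

-- suc ℓ ⊖ ξ is the integer ℓ - ξ + 1.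
𝓦 : ℕ → Series
𝓦 ξ ℓ = w/! (suc ℓ ⊖ ξ) (2 ℕ.* ℓ)

zC² : Series
zC² = z *ₛ C ^ₛ 2

1/[1-zC²] : Series
1/[1-zC²] = inverse (1ₛ -ₛ zC²)

-- The generating function of the ways to continue a partly explored closed
-- walk on a tree depends only on how often each explored vertex is visited
-- again, and is obtained recursively over the explored tree; a walk with b
-- unvisited vertices left can be labelled in b! ways.  Let y mark the excess.
-- Summing the edges without excess gives B = 1 + zWB, and then an edge of
-- excess k - 1 contributes y^(k-1) X^k, where X = zB².  With W = C(1 + V) and
-- x = zC² we get B = C/(1 - xV), X = x/(1 - xV)² and (1 - x)V = xV² + R(y, X).
-- In terms of p = 1/(1 - x), q = xp and ν = (1 - x)V this reads
-- ν = (q + q²)ν² + R.  The coefficient of y^ξ in ν is therefore a non-negative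
-- combination of the x^a p^s with s ≤ 2ξ - 2 and a ≤ 2ξ + s, whose two top
-- values of s come from the Catalan recursion in qν² + q²ν² and from the part
-- x²y(1 + 4qν) of R.

module Submission where

-- The weights of the continuations are guessed in closed form and verified: distinguishing the next
-- step of the walk yields the same recursion for them (`Ψ-root`, `Ψ-step`) as for the numbers of
-- continuations (`#accepted-suc`), and induction on the remaining steps compares the two. This
-- works because a closed walk is a tree walk exactly when it covers all vertices and every step to
-- a visited vertex follows a discovered edge; the explored part is then always a tree with a marked
-- vertex, a zipper. Sums over the number of later departures are infinite. Modulo y^N they stop at
-- some M ≥ 2N, and the system for ν, B and the departures from a new vertex is solved modulo y^N by
-- iterating a map that contracts in y. The bounds on a and s do not give the exact degrees. As no
-- coefficient is negative, one positive term x^(2ξ+s) p^s suffices for each s. For s = 0 it comes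
-- from a summand x²yR inside R itself, for the s between 0 and the two top values from x²yqν, which
-- raises both ξ and s by one.

module PowerSeriesRings where

  open import Level using (0ℓ)
  open import Algebra.Bundles using (CommutativeRing)
  open import Data.Nat.Base as ℕ using (ℕ; zero; suc; z≤n; s≤s)
  import Data.Nat.Properties as ℕ
  open import Data.Fin.Base using (toℕ)
  open import Data.Product using (_,_)
  open import Function using (_∘_)

  -- Power series over a commutative ring, in full and modulo a power of the variable.

  module PowerSeries (R : CommutativeRing 0ℓ 0ℓ) where

    open CommutativeRing R
    open import Algebra.Properties.Monoid.Sum +-monoid using (sum-syntax)
    open import Relation.Binary.Reasoning.Setoid setoid
    open import Algebra.Solver.Ring.NaturalCoefficients.Default commutativeSemiring
      using (solve; _:+_; _:*_; _:=_; con)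

    PS : Set
    PS = ℕ → Carrier

    infixl 6 _⊕_
    infixl 7 _⊛_ _·_
    infix 4 _≋_ _≋[_]_

    _≋_ : PS → PS → Set
    f ≋ g = ∀ n → f n ≈ g n

    _≋[_]_ : PS → ℕ → PS → Set
    f ≋[ N ] g = ∀ n → n ℕ.< N → f n ≈ g n

    0ₚ : PS
    0ₚ _ = 0#

    ι : Carrier → PS
    ι a zero    = a
    ι a (suc _) = 0#

    1ₚ : PS
    1ₚ = ι 1#

    var : PS
    var 1 = 1#
    var _ = 0#

    _⊕_ : PS → PS → PS
    (f ⊕ g) n = f n + g n

    ⊖_ : PS → PS
    (⊖ f) n = - f n

    -- At `suc n` the sum computes to `f 0 * g (suc n) + (tl f ⊛ g) n`, the form on which all
    -- inductions below run. Over ℚ it is `_*ₛ_`.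
    _⊛_ : PS → PS → PS
    (f ⊛ g) n = ∑[ i < suc n ] (f (toℕ i) * g (n ℕ.∸ toℕ i))

    _·_ : Carrier → PS → PS
    (a · f) n = a * f n

    tl : PS → PS
    tl f = f ∘ suc

    -- A coefficient of a product involves only coefficients of the factors up to the same index, so
    -- the product is compatible with truncation.
    ⊛-cong< : ∀ n {f f′ g g′ : PS} → (∀ i → i ℕ.≤ n → f i ≈ f′ i) →
              (∀ i → i ℕ.≤ n → g i ≈ g′ i) → (f ⊛ g) n ≈ (f′ ⊛ g′) n
    ⊛-cong< zero    p q = +-cong (*-cong (p 0 z≤n) (q 0 z≤n)) refl
    ⊛-cong< (suc n) p q = +-cong (*-cong (p 0 z≤n) (q (suc n) ℕ.≤-refl))
      (⊛-cong< n (λ i i≤ → p (suc i) (s≤s i≤)) (λ i i≤ → q i (ℕ.m≤n⇒m≤1+n i≤)))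

    ⊛-cong : ∀ {f f′ g g′ : PS} → f ≋ f′ → g ≋ g′ → (f ⊛ g) ≋ (f′ ⊛ g′)
    ⊛-cong p q n = ⊛-cong< n (λ i _ → p i) (λ i _ → q i)

    ⊛-zeroˡ : ∀ g → (0ₚ ⊛ g) ≋ 0ₚ
    ⊛-zeroˡ g zero    = trans (+-identityʳ _) (zeroˡ _)
    ⊛-zeroˡ g (suc n) = trans (+-cong (zeroˡ _) (⊛-zeroˡ g n)) (+-identityʳ _)

    ·-⊛ : ∀ a f g → (a · f) ⊛ g ≋ a · (f ⊛ g)
    ·-⊛ a f g zero    =
      solve 3 (λ a b c → a :* b :* c :+ con 0 := a :* (b :* c :+ con 0)) refl _ _ _
    ·-⊛ a f g (suc n) = begin
      a * f 0 * g (suc n) + ((a · tl f) ⊛ g) n   ≈⟨ +-congˡ (·-⊛ a (tl f) g n) ⟩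
      a * f 0 * g (suc n) + a * (tl f ⊛ g) n
        ≈⟨ solve 4 (λ a b c d → a :* b :* c :+ a :* d := a :* (b :* c :+ d)) refl _ _ _ _ ⟩
      a * (f 0 * g (suc n) + (tl f ⊛ g) n)       ∎

    ⊛-distribʳ : ∀ h f g → (f ⊕ g) ⊛ h ≋ f ⊛ h ⊕ g ⊛ h
    ⊛-distribʳ h f g zero    =
      solve 3 (λ a b c → (a :+ b) :* c :+ con 0 := a :* c :+ con 0 :+ (b :* c :+ con 0)) refl _ _ _
    ⊛-distribʳ h f g (suc n) = begin
      (f 0 + g 0) * h (suc n) + ((tl f ⊕ tl g) ⊛ h) n   ≈⟨ +-congˡ (⊛-distribʳ h (tl f) (tl g) n) ⟩
      (f 0 + g 0) * h (suc n) + ((tl f ⊛ h) n + (tl g ⊛ h) n)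
        ≈⟨ solve 5 (λ a b c d e → (a :+ b) :* c :+ (d :+ e) := a :* c :+ d :+ (b :* c :+ e)) refl _ _ _ _ _ ⟩
      f 0 * h (suc n) + (tl f ⊛ h) n + (g 0 * h (suc n) + (tl g ⊛ h) n) ∎

    -- The mirror image of the computational unfolding: the term with `g 0` is split off instead of
    -- the one with `f 0`. Commutativity compares the two.
    ⊛-suc : ∀ f g n → (f ⊛ g) (suc n) ≈ (f ⊛ tl g) n + f (suc n) * g 0
    ⊛-suc f g zero    =
      solve 2 (λ a b → a :+ (b :+ con 0) := a :+ con 0 :+ b) refl _ _
    ⊛-suc f g (suc n) = begin
      f 0 * g (suc (suc n)) + (tl f ⊛ g) (suc n)   ≈⟨ +-congˡ (⊛-suc (tl f) g n) ⟩
      f 0 * g (suc (suc n)) + ((tl f ⊛ tl g) n + f (suc (suc n)) * g 0) ≈⟨ +-assoc _ _ _ ⟨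
      (f ⊛ tl g) (suc n) + f (suc (suc n)) * g 0   ∎

    ⊛-comm : ∀ f g → f ⊛ g ≋ g ⊛ f
    ⊛-comm f g zero    = +-congʳ (*-comm _ _)
    ⊛-comm f g (suc n) = begin
      f 0 * g (suc n) + (tl f ⊛ g) n   ≈⟨ +-cong (*-comm _ _) (⊛-comm (tl f) g n) ⟩
      g (suc n) * f 0 + (g ⊛ tl f) n   ≈⟨ +-comm _ _ ⟩
      (g ⊛ tl f) n + g (suc n) * f 0   ≈⟨ ⊛-suc g f n ⟨
      (g ⊛ f) (suc n)                  ∎

    ⊛-assoc : ∀ f g h → (f ⊛ g) ⊛ h ≋ f ⊛ (g ⊛ h)
    ⊛-assoc f g h zero    =
      solve 3 (λ a b c → (a :* b :+ con 0) :* c :+ con 0 := a :* (b :* c :+ con 0) :+ con 0) refl _ _ _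
    ⊛-assoc f g h (suc n) = begin
      (f 0 * g 0 + 0#) * h (suc n) + ((f 0 · tl g ⊕ tl f ⊛ g) ⊛ h) n
        ≈⟨ +-congˡ (⊛-distribʳ h (f 0 · tl g) (tl f ⊛ g) n) ⟩
      (f 0 * g 0 + 0#) * h (suc n) + (((f 0 · tl g) ⊛ h) n + ((tl f ⊛ g) ⊛ h) n)
        ≈⟨ +-congˡ (+-cong (·-⊛ (f 0) (tl g) h n) (⊛-assoc (tl f) g h n)) ⟩
      (f 0 * g 0 + 0#) * h (suc n) + (f 0 * (tl g ⊛ h) n + (tl f ⊛ (g ⊛ h)) n)
        ≈⟨ solve 5 (λ a b c d e → (a :* b :+ con 0) :* c :+ (a :* d :+ e) := a :* (b :* c :+ d) :+ e)
             refl _ _ _ _ _ ⟩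
      f 0 * (g 0 * h (suc n) + (tl g ⊛ h) n) + (tl f ⊛ (g ⊛ h)) n ∎

    ι-⊛ : ∀ a f → ι a ⊛ f ≋ a · f
    ι-⊛ a f zero    = +-identityʳ _
    ι-⊛ a f (suc n) = trans (+-congˡ (⊛-zeroˡ f n)) (+-identityʳ _)

    ⊛-identityˡ : ∀ f → 1ₚ ⊛ f ≋ f
    ⊛-identityˡ f n = trans (ι-⊛ 1# f n) (*-identityˡ _)

    var-⊛-0 : ∀ f → (var ⊛ f) 0 ≈ 0#
    var-⊛-0 f = trans (+-identityʳ _) (zeroˡ _)

    var-⊛-suc : ∀ f n → (var ⊛ f) (suc n) ≈ f n
    var-⊛-suc f n = begin
      0# * f (suc n) + (tl var ⊛ f) n ≈⟨ +-cong (zeroˡ _) (⊛-cong {g = f} tl-var (λ _ → refl) n) ⟩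
      0# + (1ₚ ⊛ f) n                 ≈⟨ +-identityˡ _ ⟩
      (1ₚ ⊛ f) n                      ≈⟨ ⊛-identityˡ f n ⟩
      f n                             ∎
      where
      tl-var : tl var ≋ 1ₚ
      tl-var zero    = refl
      tl-var (suc n) = refl

    -- In this ring var is nilpotent, which replaces infinite sums by finite ones.
    truncated : ℕ → CommutativeRing 0ℓ 0ℓ
    truncated N = record
      { Carrier = PS ; _≈_ = _≋[ N ]_ ; _+_ = _⊕_ ; _*_ = _⊛_ ; -_ = ⊖_ ; 0# = 0ₚ ; 1# = 1ₚ
      ; isCommutativeRing = record
        { isRing = record
          { +-isAbelianGroup = record
            { isGroup = record
              { isMonoid = record
                { isSemigroup = record
                  { isMagma = record
                    { isEquivalence = record
                      { refl  = λ _ _ → refl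
                      ; sym   = λ p n n< → sym (p n n<)
                      ; trans = λ p q n n< → trans (p n n<) (q n n<) }
                    ; ∙-cong = λ p q n n< → +-cong (p n n<) (q n n<) }
                  ; assoc = λ f g h n _ → +-assoc (f n) (g n) (h n) }
                ; identity = (λ f n _ → +-identityˡ (f n)) , (λ f n _ → +-identityʳ (f n)) }
              ; inverse = (λ f n _ → -‿inverseˡ (f n)) , (λ f n _ → -‿inverseʳ (f n))
              ; ⁻¹-cong = λ p n n< → -‿cong (p n n<) }
            ; comm = λ f g n _ → +-comm (f n) (g n) }
          ; *-cong = λ p q n n< → ⊛-cong< n (λ i i≤ → p i (ℕ.≤-<-trans i≤ n<))
                                            (λ i i≤ → q i (ℕ.≤-<-trans i≤ n<))
          ; *-assoc = λ f g h n _ → ⊛-assoc f g h n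
          ; *-identity = (λ f n _ → ⊛-identityˡ f n)
                       , (λ f n _ → trans (⊛-comm f 1ₚ n) (⊛-identityˡ f n))
          ; distrib = (λ h f g n _ → trans (⊛-comm h (f ⊕ g) n) (trans (⊛-distribʳ h f g n)
                                       (+-cong (⊛-comm f h n) (⊛-comm g h n))))
                    , (λ h f g n _ → ⊛-distribʳ h f g n) }
        ; *-comm = λ f g n _ → ⊛-comm f g n } }

    fullRing : CommutativeRing 0ℓ 0ℓ
    fullRing = record
      { Carrier = PS ; _≈_ = _≋_ ; _+_ = _⊕_ ; _*_ = _⊛_ ; -_ = ⊖_ ; 0# = 0ₚ ; 1# = 1ₚ
      ; isCommutativeRing = record
        { isRing = record
          { +-isAbelianGroup = record
            { isGroup = record
              { isMonoid = record
                { isSemigroup = record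
                  { isMagma = record
                    { isEquivalence = record
                      { refl  = λ _ → refl
                      ; sym   = λ p n → sym (p n)
                      ; trans = λ p q n → trans (p n) (q n) }
                    ; ∙-cong = λ p q n → +-cong (p n) (q n) }
                  ; assoc = λ f g h n → +-assoc (f n) (g n) (h n) }
                ; identity = (λ f n → +-identityˡ (f n)) , (λ f n → +-identityʳ (f n)) }
              ; inverse = (λ f n → -‿inverseˡ (f n)) , (λ f n → -‿inverseʳ (f n))
              ; ⁻¹-cong = λ p n → -‿cong (p n) }
            ; comm = λ f g n → +-comm (f n) (g n) }
          ; *-cong = ⊛-cong
          ; *-assoc = ⊛-assoc
          ; *-identity = ⊛-identityˡ , λ f n → trans (⊛-comm f 1ₚ n) (⊛-identityˡ f n)
          ; distrib = (λ h f g n → trans (⊛-comm h (f ⊕ g) n) (trans (⊛-distribʳ h f g n)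
                                       (+-cong (⊛-comm f h n) (⊛-comm g h n))))
                    , ⊛-distribʳ }
        ; *-comm = ⊛-comm } }

  -- Subtraction-free ring identities for the Catalan series.

  module RingIdentities (R : CommutativeRing 0ℓ 0ℓ) where

    open CommutativeRing R
    open import Relation.Binary.Reasoning.Setoid setoid
    open import Algebra.Solver.Ring.NaturalCoefficients.Default commutativeSemiring
      using (solve; _:+_; _:*_; _:=_; con)

    -- t and u stand for z c′ and z d′, where d = 1 + z c².
    derivative-identity : ∀ z c t d u → d ≈ 1# + z * (c * c) → u ≈ z * (c * c) + z * (t * c + c * t) →
      t + c ≈ 1# + z * ((t + t) + (t + t) + (c + c)) →
      (u + d) + z * ((t + t) + (t + t)) ≈ (t + c) + z * ((u + u) + (u + u))
    derivative-identity z c t d u d≈ u≈ t≈ = begin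
      (u + d) + z * ((t + t) + (t + t)) ≈⟨ +-congʳ (+-cong u≈ d≈) ⟩
      ((z * (c * c) + z * (t * c + c * t)) + (1# + z * (c * c))) + z * ((t + t) + (t + t))
        ≈⟨ solve 3 (λ z c t → ((z :* (c :* c) :+ z :* (t :* c :+ c :* t)) :+ (con 1 :+ z :* (c :* c))) :+ z :* ((t :+ t) :+ (t :+ t))
             := (z :* c :+ z :* c) :* (t :+ c) :+ (con 1 :+ z :* ((t :+ t) :+ (t :+ t)))) refl z c t ⟩
      -- Differentiating zc² produces the factor 2zc. The equation for t + c is used once multiplied
      -- by this factor and once, backwards, as it stands.
      (z * c + z * c) * (t + c) + (1# + z * ((t + t) + (t + t))) ≈⟨ +-congʳ (*-congˡ t≈) ⟩
      (z * c + z * c) * (1# + z * ((t + t) + (t + t) + (c + c))) + (1# + z * ((t + t) + (t + t)))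
        ≈⟨ solve 3 (λ z c t → (z :* c :+ z :* c) :* (con 1 :+ z :* ((t :+ t) :+ (t :+ t) :+ (c :+ c))) :+ (con 1 :+ z :* ((t :+ t) :+ (t :+ t)))
             := (con 1 :+ z :* ((t :+ t) :+ (t :+ t) :+ (c :+ c))) :+ z :* (((z :* (c :* c) :+ z :* (t :* c :+ c :* t)) :+ (z :* (c :* c) :+ z :* (t :* c :+ c :* t)))
                  :+ ((z :* (c :* c) :+ z :* (t :* c :+ c :* t)) :+ (z :* (c :* c) :+ z :* (t :* c :+ c :* t))))) refl z c t ⟩
      _ ≈⟨ +-cong t≈ (*-congˡ (+-cong (+-cong u≈ u≈) (+-cong u≈ u≈))) ⟨
      (t + c) + z * ((u + u) + (u + u)) ∎

    -- b = 1 - a satisfies b² = 1 - 4z, with a = 2zc.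
    square-identity : ∀ z c a b → c ≈ 1# + z * (c * c) → a ≈ z * (c + c) → b + a ≈ 1# →
      b * b + ((z + z) + (z + z)) + a * a ≈ 1# + a * a
    square-identity z c a b c≈ a≈ b≈ = begin
      b * b + ((z + z) + (z + z)) + a * a ≈⟨ +-congˡ (*-cong a≈ a≈) ⟩
      b * b + ((z + z) + (z + z)) + z * (c + c) * (z * (c + c))
        ≈⟨ solve 3 (λ b z c → b :* b :+ ((z :+ z) :+ (z :+ z)) :+ z :* (c :+ c) :* (z :* (c :+ c))
              := b :* b :+ ((z :+ z) :* (con 1 :+ z :* (c :* c)) :+ (z :+ z) :* (con 1 :+ z :* (c :* c)))) refl b z c ⟩
      b * b + ((z + z) * (1# + z * (c * c)) + (z + z) * (1# + z * (c * c))) ≈⟨ +-congˡ (+-cong (*-congˡ c≈) (*-congˡ c≈)) ⟨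
      b * b + ((z + z) * c + (z + z) * c)
        ≈⟨ solve 3 (λ b z c → b :* b :+ ((z :+ z) :* c :+ (z :+ z) :* c) := b :* b :+ (z :* (c :+ c) :+ z :* (c :+ c)) :* con 1) refl b z c ⟩
      b * b + (z * (c + c) + z * (c + c)) * 1# ≈⟨ +-congˡ (*-cong (+-cong a≈ a≈) b≈) ⟨
      b * b + (a + a) * (b + a) ≈⟨ solve 2 (λ a b → b :* b :+ (a :+ a) :* (b :+ a) := (b :+ a) :* (b :+ a) :+ a :* a) refl a b ⟩
      (b + a) * (b + a) + a * a ≈⟨ +-congʳ (trans (*-cong b≈ b≈) (*-identityˡ 1#)) ⟩
      1# + a * a ∎

-- Weights of the continuations of a walk on a partly explored tree.

module ForestWalks where

  open import Level using (0ℓ)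
  open import Algebra.Bundles using (CommutativeRing)
  open import Data.Nat.Base as ℕ using (ℕ; zero; suc; z≤n; s≤s)
  import Data.Nat.Properties as ℕ
  open import Data.List.Base using (List; []; _∷_; map; foldr)
  open import Data.Product using (_×_; _,_)
  open import Function using (_∘_)
  open import Relation.Binary.PropositionalEquality as ≡ using (_≡_)

  -- Everything is defined from the bare operations, so that the values do not
  -- depend on the equality the carrier is considered with.
  module Ops {A : Set} (_+_ _*_ : A → A → A) (0# 1# : A) where

    infixr 7 _⧢_
    infixr 8 _^_

    _^_ : A → ℕ → A
    a ^ zero  = 1#
    a ^ suc n = a * (a ^ n)

    -- (S ⧢ T) e = Σₖ binom(e,k) S k T (e - k)
    _⧢_ : (ℕ → A) → (ℕ → A) → ℕ → A
    (S ⧢ T) zero    = S 0 * T 0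
    (S ⧢ T) (suc e) = ((S ∘ suc) ⧢ T) e + (S ⧢ (T ∘ suc)) e

    -- γ M k S = Σ_{e < M} S e · #{(e₁,…,eₖ) : e₁ + … + eₖ = e}
    γ : ℕ → ℕ → (ℕ → A) → A
    γ zero    k       S = 0#
    γ (suc M) zero    S = S 0
    γ (suc M) (suc k) S = γ (suc M) k S + γ M (suc k) (S ∘ suc)

  module Shuffle (R : CommutativeRing 0ℓ 0ℓ) where

    open CommutativeRing R
    open Ops _+_ _*_ 0# 1# public
    open import Relation.Binary.Reasoning.Setoid setoid
    open import Algebra.Solver.Ring.NaturalCoefficients.Default commutativeSemiring
      using (solve; _:+_; _:*_; _:=_; con)

    Seq : Set
    Seq = ℕ → Carrier

    infix 4 _≗_
    infixl 6 _⊹_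
    infixr 8 _∙_

    _≗_ : Seq → Seq → Set
    S ≗ T = ∀ e → S e ≈ T e

    _⊹_ : Seq → Seq → Seq
    (S ⊹ T) e = S e + T e

    _∙_ : Carrier → Seq → Seq
    (c ∙ S) e = c * S e

    unit : Seq
    unit zero    = 1#
    unit (suc _) = 0#

    ^-cong : ∀ {a b} k → a ≈ b → a ^ k ≈ b ^ k
    ^-cong zero    p = refl
    ^-cong (suc k) p = *-cong p (^-cong k p)

    ⧢-cong : ∀ {S S′ T T′} → S ≗ S′ → T ≗ T′ → S ⧢ T ≗ S′ ⧢ T′
    ⧢-cong p q zero    = *-cong (p 0) (q 0)
    ⧢-cong p q (suc e) = +-cong (⧢-cong (p ∘ suc) q e) (⧢-cong p (q ∘ suc) e)

    ⧢-comm : ∀ S T → S ⧢ T ≗ T ⧢ S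
    ⧢-comm S T zero    = *-comm _ _
    ⧢-comm S T (suc e) = trans (+-comm _ _) (+-cong (⧢-comm S (T ∘ suc) e) (⧢-comm (S ∘ suc) T e))

    ⧢-distribʳ : ∀ V S T → (S ⊹ T) ⧢ V ≗ S ⧢ V ⊹ T ⧢ V
    ⧢-distribʳ V S T zero    = distribʳ _ _ _
    ⧢-distribʳ V S T (suc e) = begin
      ((S ∘ suc ⊹ T ∘ suc) ⧢ V) e + ((S ⊹ T) ⧢ (V ∘ suc)) e
        ≈⟨ +-cong (⧢-distribʳ V (S ∘ suc) (T ∘ suc) e) (⧢-distribʳ (V ∘ suc) S T e) ⟩
      (((S ∘ suc) ⧢ V) e + ((T ∘ suc) ⧢ V) e) + ((S ⧢ (V ∘ suc)) e + (T ⧢ (V ∘ suc)) e)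
        ≈⟨ solve 4 (λ a b c d → a :+ b :+ (c :+ d) := a :+ c :+ (b :+ d)) refl _ _ _ _ ⟩
      (S ⧢ V ⊹ T ⧢ V) (suc e) ∎

    ⧢-distribˡ : ∀ V S T → V ⧢ (S ⊹ T) ≗ V ⧢ S ⊹ V ⧢ T
    ⧢-distribˡ V S T e = trans (⧢-comm V (S ⊹ T) e)
      (trans (⧢-distribʳ V S T e) (+-cong (⧢-comm S V e) (⧢-comm T V e)))

    ∙-⧢ : ∀ c S T → (c ∙ S) ⧢ T ≗ c ∙ (S ⧢ T)
    ∙-⧢ c S T zero    = *-assoc _ _ _
    ∙-⧢ c S T (suc e) = trans (+-cong (∙-⧢ c (S ∘ suc) T e) (∙-⧢ c S (T ∘ suc) e)) (sym (distribˡ _ _ _))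

    ⧢-∙ : ∀ c S T → S ⧢ (c ∙ T) ≗ c ∙ (S ⧢ T)
    ⧢-∙ c S T e = trans (⧢-comm S (c ∙ T) e) (trans (∙-⧢ c T S e) (*-congˡ (⧢-comm T S e)))

    zero-⧢ : ∀ T → (λ _ → 0#) ⧢ T ≗ λ _ → 0#
    zero-⧢ T zero    = zeroˡ _
    zero-⧢ T (suc e) = trans (+-cong (zero-⧢ T e) (zero-⧢ (T ∘ suc) e)) (+-identityˡ _)

    unit-⧢ : ∀ T → unit ⧢ T ≗ T
    unit-⧢ T zero    = *-identityˡ _
    unit-⧢ T (suc e) = trans (+-cong (zero-⧢ T e) (unit-⧢ (T ∘ suc) e)) (+-identityˡ _)

    -- On exponential generating functions `_⧢_` is the product and the shift is the derivative; the
    -- induction is Leibniz' rule for a triple product.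
    ⧢-assoc : ∀ S T V → (S ⧢ T) ⧢ V ≗ S ⧢ (T ⧢ V)
    ⧢-assoc S T V zero    = *-assoc _ _ _
    ⧢-assoc S T V (suc e) = begin
      (((S ∘ suc) ⧢ T ⊹ S ⧢ (T ∘ suc)) ⧢ V) e + ((S ⧢ T) ⧢ (V ∘ suc)) e
        ≈⟨ +-congʳ (⧢-distribʳ V ((S ∘ suc) ⧢ T) (S ⧢ (T ∘ suc)) e) ⟩
      (((S ∘ suc) ⧢ T) ⧢ V) e + ((S ⧢ (T ∘ suc)) ⧢ V) e + ((S ⧢ T) ⧢ (V ∘ suc)) e
        ≈⟨ +-cong (+-cong (⧢-assoc (S ∘ suc) T V e) (⧢-assoc S (T ∘ suc) V e)) (⧢-assoc S T (V ∘ suc) e) ⟩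
      ((S ∘ suc) ⧢ (T ⧢ V)) e + (S ⧢ ((T ∘ suc) ⧢ V)) e + (S ⧢ (T ⧢ (V ∘ suc))) e
        ≈⟨ +-assoc _ _ _ ⟩
      ((S ∘ suc) ⧢ (T ⧢ V)) e + ((S ⧢ ((T ∘ suc) ⧢ V)) e + (S ⧢ (T ⧢ (V ∘ suc))) e)
        ≈⟨ +-congˡ (⧢-distribˡ S ((T ∘ suc) ⧢ V) (T ⧢ (V ∘ suc)) e) ⟨
      (S ⧢ (T ⧢ V)) (suc e) ∎

    ⧢-swap : ∀ S T V → S ⧢ (T ⧢ V) ≗ T ⧢ (S ⧢ V)
    ⧢-swap S T V e = begin
      (S ⧢ (T ⧢ V)) e ≈⟨ ⧢-assoc S T V e ⟨
      ((S ⧢ T) ⧢ V) e ≈⟨ ⧢-cong (⧢-comm S T) (λ _ → refl) e ⟩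
      ((T ⧢ S) ⧢ V) e ≈⟨ ⧢-assoc T S V e ⟩
      (T ⧢ (S ⧢ V)) e ∎

    γ-cong : ∀ M k {S T} → S ≗ T → γ M k S ≈ γ M k T
    γ-cong zero    k       p = refl
    γ-cong (suc M) zero    p = p 0
    γ-cong (suc M) (suc k) p = +-cong (γ-cong (suc M) k p) (γ-cong M (suc k) (p ∘ suc))

    γ-+ : ∀ M k S T → γ M k (S ⊹ T) ≈ γ M k S + γ M k T
    γ-+ zero    k       S T = sym (+-identityˡ _)
    γ-+ (suc M) zero    S T = refl
    γ-+ (suc M) (suc k) S T = begin
      γ (suc M) k (S ⊹ T) + γ M (suc k) (S ∘ suc ⊹ T ∘ suc)
        ≈⟨ +-cong (γ-+ (suc M) k S T) (γ-+ M (suc k) (S ∘ suc) (T ∘ suc)) ⟩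
      γ (suc M) k S + γ (suc M) k T + (γ M (suc k) (S ∘ suc) + γ M (suc k) (T ∘ suc))
        ≈⟨ solve 4 (λ a b c d → a :+ b :+ (c :+ d) := a :+ c :+ (b :+ d)) refl _ _ _ _ ⟩
      γ (suc M) (suc k) S + γ (suc M) (suc k) T ∎

    γ-∙ : ∀ M k c S → γ M k (c ∙ S) ≈ c * γ M k S
    γ-∙ zero    k       c S = sym (zeroʳ _)
    γ-∙ (suc M) zero    c S = refl
    γ-∙ (suc M) (suc k) c S =
      trans (+-cong (γ-∙ (suc M) k c S) (γ-∙ M (suc k) c (S ∘ suc))) (sym (distribˡ _ _ _))

    γ-zero : ∀ M k {S} → (∀ e → S e ≈ 0#) → γ M k S ≈ 0#
    γ-zero zero    k       p = refl
    γ-zero (suc M) zero    p = p 0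
    γ-zero (suc M) (suc k) p =
      trans (+-cong (γ-zero (suc M) k p) (γ-zero M (suc k) (p ∘ suc))) (+-identityˡ _)

    -- Entries from the cut-off on vanish, so the cut-off may be raised. This compensates the drop
    -- of `M` in the recursion for `γ`.
    γ-extend : ∀ M k {S} → (∀ e → M ℕ.≤ e → S e ≈ 0#) → γ (suc M) k S ≈ γ M k S
    γ-extend zero    k       p = γ-zero 1 k (λ e → p e z≤n)
    γ-extend (suc M) zero    p = refl
    γ-extend (suc M) (suc k) p =
      +-cong (γ-extend (suc M) k p) (γ-extend M (suc k) (λ e M≤e → p (suc e) (s≤s M≤e)))

    -- `F n` is to be read as the elements of order at least n. The instance in use consists of the
    -- series with coefficients in cones of monomials, but the bounds only need the rules below.
    record Filtration : Set₁ where
      field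
        F      : ℕ → Carrier → Set
        F-0    : ∀ n → F n 0#
        F-1    : F 0 1#
        F-+    : ∀ {n a b} → F n a → F n b → F n (a + b)
        F-*    : ∀ {m n a b} → F m a → F n b → F (m ℕ.+ n) (a * b)
        F-mono : ∀ {m n a} → m ℕ.≤ n → F n a → F m a
        F-resp : ∀ {n a b} → a ≈ b → F n a → F n b

    module FiltrationProperties (𝓕 : Filtration) where

      open Filtration 𝓕

      F-≡ : ∀ {m n a} → m ≡ n → F m a → F n a
      F-≡ ≡.refl p = p

      F-^ : ∀ {m a} k → F m a → F (k ℕ.* m) (a ^ k)
      F-^ zero    p = F-1
      F-^ (suc k) p = F-* p (F-^ k p)

      F-γ : ∀ {n} M k {S} → (∀ e → F n (S e)) → F n (γ M k S)
      F-γ zero    k       p = F-0 _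
      F-γ (suc M) zero    p = p 0
      F-γ (suc M) (suc k) p = F-+ (F-γ (suc M) k p) (F-γ M (suc k) (p ∘ suc))

      -- The order grows with the index, so shifting a factor raises its bound by one; hence `suc m`
      -- and `suc n` in the inductive calls.
      F-⧢ : ∀ m n {S T} → (∀ e → F (e ℕ.+ m) (S e)) → (∀ e → F (e ℕ.+ n) (T e)) →
            ∀ e → F (e ℕ.+ (m ℕ.+ n)) ((S ⧢ T) e)
      F-⧢ m n p q zero    = F-* (p 0) (q 0)
      F-⧢ m n p q (suc e) = F-+
        (F-≡ (ℕ.+-suc e (m ℕ.+ n)) (F-⧢ (suc m) n (λ i → F-≡ (≡.sym (ℕ.+-suc i m)) (p (suc i))) q e))
        (F-≡ (≡.trans (≡.cong (e ℕ.+_) (ℕ.+-suc m n)) (ℕ.+-suc e (m ℕ.+ n)))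
          (F-⧢ m (suc n) p (λ i → F-≡ (≡.sym (ℕ.+-suc i n)) (q (suc i))) e))

      F-⧢-const : ∀ {m n} {S T} → (∀ e → F m (S e)) → (∀ e → F n (T e)) → ∀ e → F (m ℕ.+ n) ((S ⧢ T) e)
      F-⧢-const p q zero    = F-* (p 0) (q 0)
      F-⧢-const p q (suc e) = F-+ (F-⧢-const (p ∘ suc) q e) (F-⧢-const p (q ∘ suc) e)

  data Tree (X : Set) : Set where
    node : X → List (Tree X) → Tree X

  -- For the vertex holding the walk all explored child subtrees are listed, for an ancestor all but
  -- the one containing the walk. A list of frames leads from the walk towards the root, as in a
  -- zipper.
  Frame : Set → Set
  Frame X = X × List (Tree X)

  selections : ∀ {A : Set} → List A → List (A × List A)
  selections []       = []
  selections (x ∷ xs) = (x , xs) ∷ map (λ (y , ys) → y , x ∷ ys) (selections xs)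

  module Walks (R : CommutativeRing 0ℓ 0ℓ) where

    open CommutativeRing R
    open Shuffle R
    open import Relation.Binary.Reasoning.Setoid setoid
    open import Algebra.Solver.Ring.NaturalCoefficients.Default commutativeSemiring
      using (solve; _:+_; _:*_; _:=_; con)

    module Future {X : Set} (M : ℕ) (B κ′ : Carrier) (h : Seq) where

      -- A vertex is described by a sequence S, where S e is the weight of the
      -- ways to distribute e later departures among its children.  D S and U S
      -- describe its contribution to its parent when the walk is respectively
      -- outside and inside its subtree.
      D Ũ U : Seq → Seq
      D S k = κ′ ^ k * γ M k S
      Ũ S k = κ′ ^ k * γ M (suc k) S
      U S   = B ∙ Ũ S

      -- Departures towards different children interleave freely, hence the shuffle. `h` accounts
      -- for the children not yet discovered that will be entered at least twice.
      P : List (Tree X) → Seq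
      P []              = h
      P (node _ cs ∷ ts) = D (P cs) ⧢ P ts

      -- The vertex holding the walk acts on its parent through `U`, while the siblings act through
      -- the factors `D` inside `P f`.
      L : List (Frame X) → Seq → Carrier
      L []             S = U S 0
      L ((_ , f) ∷ fs) S = L fs (U S ⧢ P f)

      -- The generating function of the continuations of a walk which is at the
      -- vertex with explored subtrees f, with ancestors fs.
      Ψ : Frame X → List (Frame X) → Carrier
      Ψ (_ , f) fs = L fs (P f)

      W : Carrier
      W = U h 0

      -- The contribution of a child, just discovered, to the later departures of its parent. The
      -- entry at 0 is removed because children entered only once are absorbed into `B`.
      ε : Seq
      ε zero    = 0#
      ε (suc k) = U h (suc k)

      Ũ-cong : ∀ {S T} → S ≗ T → Ũ S ≗ Ũ T
      Ũ-cong p k = *-congˡ (γ-cong M (suc k) p)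

      U-cong : ∀ {S T} → S ≗ T → U S ≗ U T
      U-cong p k = *-congˡ (Ũ-cong p k)

      U-+ : ∀ S T → U (S ⊹ T) ≗ U S ⊹ U T
      U-+ S T k = trans (*-congˡ (*-congˡ (γ-+ M (suc k) S T)))
        (solve 4 (λ b c s t → b :* (c :* (s :+ t)) := b :* (c :* s) :+ b :* (c :* t)) refl _ _ _ _)

      Ũ-∙ : ∀ c S → Ũ (c ∙ S) ≗ c ∙ Ũ S
      Ũ-∙ c S k = trans (*-congˡ (γ-∙ M (suc k) c S))
        (solve 3 (λ b c s → b :* (c :* s) := c :* (b :* s)) refl _ _ _)

      U-∙ : ∀ c S → U (c ∙ S) ≗ c ∙ U S
      U-∙ c S k = trans (*-congˡ (Ũ-∙ c S k))
        (solve 3 (λ b c s → b :* (c :* s) := c :* (b :* s)) refl _ _ _)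

      L-cong : ∀ fs {S T} → S ≗ T → L fs S ≈ L fs T
      L-cong []             p = U-cong p 0
      L-cong ((_ , f) ∷ fs) p = L-cong fs (⧢-cong (U-cong p) (λ _ → refl))

      L-+ : ∀ fs S T → L fs (S ⊹ T) ≈ L fs S + L fs T
      L-+ []             S T = U-+ S T 0
      L-+ ((_ , f) ∷ fs) S T = trans
        (L-cong fs (λ e → trans (⧢-cong (U-+ S T) (λ _ → refl) e) (⧢-distribʳ (P f) (U S) (U T) e)))
        (L-+ fs (U S ⧢ P f) (U T ⧢ P f))

      L-∙ : ∀ fs c S → L fs (c ∙ S) ≈ c * L fs S
      L-∙ []             c S = U-∙ c S 0
      L-∙ ((_ , f) ∷ fs) c S = trans
        (L-cong fs (λ e → trans (⧢-cong (U-∙ c S) (λ _ → refl) e) (∙-⧢ c (U S) (P f) e)))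
        (L-∙ fs c (U S ⧢ P f))

      step↓ : Tree X × List (Tree X) → Seq
      step↓ (node _ cs , ts) = U (P cs) ⧢ P ts

      Σ↓ : List (Tree X × List (Tree X)) → Seq
      Σ↓ = foldr (λ s S → step↓ s ⊹ S) (λ _ → 0#)

      ΣΨ : X → List (Frame X) → List (Tree X × List (Tree X)) → Carrier
      ΣΨ l fs []                    = 0#
      ΣΨ l fs ((node v cs , ts) ∷ ss) = Ψ (v , cs) ((l , ts) ∷ fs) + ΣΨ l fs ss

      L-Σ↓ : ∀ l fs ss → L fs (Σ↓ ss) ≈ ΣΨ l fs ss
      L-Σ↓ l fs []                    =
        trans (L-cong fs {T = 0# ∙ (λ _ → 0#)} (λ _ → sym (zeroˡ _))) (trans (L-∙ fs 0# _) (zeroˡ _))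
      L-Σ↓ l fs ((node v cs , ts) ∷ ss) = trans (L-+ fs _ _) (+-congˡ (L-Σ↓ l fs ss))

      -- The child that is entered differs from `node l f`, so the factor `D (P f)` of the latter
      -- can be moved past it and joins the remaining siblings.
      Σ↓-extend : ∀ l f ss → D (P f) ⧢ Σ↓ ss ≗ Σ↓ (map (λ (y , ys) → y , node l f ∷ ys) ss)
      Σ↓-extend l f []                      e = trans (⧢-comm (D (P f)) (λ _ → 0#) e) (zero-⧢ (D (P f)) e)
      Σ↓-extend l f ((node v cs , ts) ∷ ss) e = trans
        (⧢-distribˡ (D (P f)) (U (P cs) ⧢ P ts) (Σ↓ ss) e)
        (+-cong (⧢-swap (D (P f)) (U (P cs)) (P ts) e) (Σ↓-extend l f ss e))

      -- A step down has weight `z` if it discovers a vertex and `o` if it enters an explored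
      -- subtree. `B` collects the excursions to new children entered only once that fit between two
      -- consecutive other departures. A visit with e such departures has e + 1 gaps, so a departure
      -- and the visit it causes carry one `B` each, whence `κ′ = o B²`.
      module Recursion (o z : Carrier)
        (B-eq : B ≈ 1# + z * W * B)
        (κ′-eq : κ′ ≈ o * (B * B))
        (h₀ : h 0 ≈ 1#)
        (h-suc : h ∘ suc ≗ (B * z) ∙ (ε ⧢ h))
        (P-vanish : ∀ f e → M ℕ.≤ e → P f e ≈ 0#)
        (M≢0 : 1 ℕ.≤ M) where

        -- The state just after a departure, either into an explored subtree or to a new child that
        -- will be entered again.
        T : List (Tree X) → Seq
        T f = o ∙ Σ↓ (selections f) ⊹ z ∙ (ε ⧢ P f)

        -- One of the k + 1 visits becomes the current one. Of its weight `κ′ = o B²` one `B` is the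
        -- extra factor of `U`.
        D-suc : ∀ S → D S ∘ suc ≗ (B * o) ∙ U S
        D-suc S k = trans (*-congʳ (*-congʳ κ′-eq))
          (solve 4 (λ o b c s → o :* (b :* b) :* c :* s := b :* o :* (b :* (c :* s))) refl _ _ _ _)

        -- Leibniz' rule for the shuffle: the first departure goes to exactly one child, old or new.
        P-suc : ∀ f → P f ∘ suc ≗ B ∙ T f
        P-suc []               e = trans (h-suc e)
          (solve 4 (λ b z o s → b :* z :* s := b :* (o :* con 0 :+ z :* s)) refl B z o _)
        P-suc (node l cs ∷ ts) e = begin
          ((D (P cs) ∘ suc) ⧢ P ts) e + (D (P cs) ⧢ (P ts ∘ suc)) e
            ≈⟨ +-cong (⧢-cong (D-suc (P cs)) (λ _ → refl) e) (⧢-cong (λ _ → refl) (P-suc ts) e) ⟩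
          (((B * o) ∙ U (P cs)) ⧢ P ts) e + (D (P cs) ⧢ (B ∙ T ts)) e
            ≈⟨ +-cong (∙-⧢ (B * o) (U (P cs)) (P ts) e) (⧢-∙ B (D (P cs)) (T ts) e) ⟩
          B * o * (U (P cs) ⧢ P ts) e + B * (D (P cs) ⧢ T ts) e
            ≈⟨ +-congˡ (*-congˡ (begin
              (D (P cs) ⧢ T ts) e ≈⟨ ⧢-distribˡ (D (P cs)) _ _ e ⟩
              (D (P cs) ⧢ (o ∙ Σ↓ (selections ts))) e + (D (P cs) ⧢ (z ∙ (ε ⧢ P ts))) e
                ≈⟨ +-cong (⧢-∙ o (D (P cs)) _ e) (⧢-∙ z (D (P cs)) _ e) ⟩
              o * (D (P cs) ⧢ Σ↓ (selections ts)) e + z * (D (P cs) ⧢ (ε ⧢ P ts)) e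
                ≈⟨ +-cong (*-congˡ (Σ↓-extend l cs (selections ts) e)) (*-congˡ (⧢-swap (D (P cs)) ε (P ts) e)) ⟩
              _ ∎)) ⟩
          _ ≈⟨ solve 6 (λ b o u s z t → b :* o :* u :+ b :* (o :* s :+ z :* t) := b :* (o :* (u :+ s) :+ z :* t))
                 refl B o _ _ z _ ⟩
          B * T (node l cs ∷ ts) e ∎

        P-0 : ∀ f → P f 0 ≈ 1#
        P-0 []               = h₀
        P-0 (node l cs ∷ ts) = trans (*-cong (trans (*-identityˡ _) (γ₀ M M≢0)) (P-0 ts)) (*-identityˡ _)
          where
          γ₀ : ∀ M → 1 ℕ.≤ M → γ M 0 (P cs) ≈ 1#
          γ₀ (suc M) _ = P-0 cs

        -- Pascal's rule with the same cut-off on both sides, which the vanishing of `S` from `M` on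
        -- permits.
        γ-step : ∀ k S → (∀ e → M ℕ.≤ e → S e ≈ 0#) → γ M (suc k) S ≈ γ M k S + γ M (suc k) (S ∘ suc)
        γ-step k S = go M M≢0
          where
          go : ∀ M → 1 ℕ.≤ M → (∀ e → M ℕ.≤ e → S e ≈ 0#) → γ M (suc k) S ≈ γ M k S + γ M (suc k) (S ∘ suc)
          go (suc M) _ p = +-congˡ (sym (γ-extend M (suc k) (λ e M≤e → p (suc e) (s≤s M≤e))))

        -- The walk leaves the subtree for good, departs to a vertex that is
        -- visited again later, or departs to a new vertex visited only now.
        U-P : ∀ f → U (P f) ≗ D (P f) ⊹ U (T f) ⊹ (z * W) ∙ U (P f)
        U-P f k = begin
          B * Ũ (P f) k ≈⟨ *-congʳ B-eq ⟩
          (1# + z * W * B) * Ũ (P f) k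
            ≈⟨ solve 3 (λ w b u → (con 1 :+ w :* b) :* u := u :+ w :* (b :* u)) refl (z * W) B _ ⟩
          Ũ (P f) k + z * W * U (P f) k ≈⟨ +-congʳ (begin
            κ′ ^ k * γ M (suc k) (P f) ≈⟨ *-congˡ (γ-step k (P f) (P-vanish f)) ⟩
            κ′ ^ k * (γ M k (P f) + γ M (suc k) (P f ∘ suc)) ≈⟨ distribˡ _ _ _ ⟩
            D (P f) k + Ũ (P f ∘ suc) k ≈⟨ +-congˡ (Ũ-cong (P-suc f) k) ⟩
            D (P f) k + Ũ (B ∙ T f) k ≈⟨ +-congˡ (Ũ-∙ B (T f) k) ⟩
            D (P f) k + U (T f) k ∎) ⟩
          D (P f) k + U (T f) k + z * W * U (P f) k ∎

        U-h : U h ≗ ε ⊹ W ∙ unit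
        U-h zero    = solve 1 (λ w → w := con 0 :+ w :* con 1) refl _
        U-h (suc k) = solve 2 (λ w u → u := u :+ w :* con 0) refl W _

        private
          -- The new vertex visited only now contributes `z * W`, and `W` is the entry of `U h` at 0
          -- that `ε` lacks. Together they weigh all moves to a new vertex.
          departures : ∀ l f fs → L fs (T f) + z * W * L fs (P f) ≈
                       o * ΣΨ l fs (selections f) + z * L fs (U h ⧢ P f)
          departures l f fs = begin
            L fs (T f) + z * W * L fs (P f) ≈⟨ +-congʳ (L-+ fs _ _) ⟩
            L fs (o ∙ Σ↓ (selections f)) + L fs (z ∙ (ε ⧢ P f)) + z * W * L fs (P f)
              ≈⟨ +-congʳ (+-cong (trans (L-∙ fs o _) (*-congˡ (L-Σ↓ l fs (selections f)))) (L-∙ fs z _)) ⟩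
            o * ΣΨ l fs (selections f) + z * L fs (ε ⧢ P f) + z * W * L fs (P f)
              ≈⟨ solve 5 (λ a z e w p → a :+ z :* e :+ z :* w :* p := a :+ z :* (e :+ w :* p)) refl _ z _ W _ ⟩
            o * ΣΨ l fs (selections f) + z * (L fs (ε ⧢ P f) + W * L fs (P f))
              ≈⟨ +-congˡ (*-congˡ (begin
                L fs (ε ⧢ P f) + W * L fs (P f)
                  ≈⟨ +-congˡ (L-∙ fs W (P f)) ⟨
                L fs (ε ⧢ P f) + L fs (W ∙ P f)
                  ≈⟨ L-+ fs _ _ ⟨
                L fs (ε ⧢ P f ⊹ W ∙ P f)
                  ≈⟨ L-cong fs (λ e → begin
                    (ε ⧢ P f) e + W * P f e
                      ≈⟨ +-congˡ (trans (∙-⧢ W unit (P f) e) (*-congˡ (unit-⧢ (P f) e))) ⟨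
                    (ε ⧢ P f) e + ((W ∙ unit) ⧢ P f) e ≈⟨ ⧢-distribʳ (P f) ε (W ∙ unit) e ⟨
                    ((ε ⊹ W ∙ unit) ⧢ P f) e ≈⟨ ⧢-cong U-h (λ _ → refl) e ⟨
                    (U h ⧢ P f) e ∎) ⟩
                L fs (U h ⧢ P f) ∎)) ⟩
            o * ΣΨ l fs (selections f) + z * L fs (U h ⧢ P f) ∎

        -- At the root the walk may end, which gives the 1. The label v is arbitrary because the
        -- weights ignore labels.
        Ψ-root : ∀ l f v → Ψ (l , f) [] ≈
                 1# + (o * ΣΨ l [] (selections f) + z * Ψ (v , []) ((l , f) ∷ []))
        Ψ-root l f v = begin
          U (P f) 0 ≈⟨ U-P f 0 ⟩
          D (P f) 0 + U (T f) 0 + z * W * U (P f) 0 ≈⟨ +-assoc _ _ _ ⟩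
          D (P f) 0 + (L [] (T f) + z * W * L [] (P f))
            ≈⟨ +-cong (trans (*-identityˡ _) (γ₀ M M≢0)) (departures l f []) ⟩
          1# + (o * ΣΨ l [] (selections f) + z * Ψ (v , []) ((l , f) ∷ [])) ∎
          where
          γ₀ : ∀ M → 1 ℕ.≤ M → γ M 0 (P f) ≈ 1#
          γ₀ (suc M) _ = P-0 f

        Ψ-step : ∀ l f l₁ f₁ fs v → Ψ (l , f) ((l₁ , f₁) ∷ fs) ≈
                 Ψ (l₁ , node l f ∷ f₁) fs
                 + (o * ΣΨ l ((l₁ , f₁) ∷ fs) (selections f) + z * Ψ (v , []) ((l , f) ∷ (l₁ , f₁) ∷ fs))
        Ψ-step l f l₁ f₁ fs v = begin
          L fs (U (P f) ⧢ P f₁)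
            ≈⟨ L-cong fs (λ e → begin
                 (U (P f) ⧢ P f₁) e ≈⟨ ⧢-cong (U-P f) (λ _ → refl) e ⟩
                 ((D (P f) ⊹ U (T f) ⊹ (z * W) ∙ U (P f)) ⧢ P f₁) e ≈⟨ ⧢-distribʳ (P f₁) _ _ e ⟩
                 ((D (P f) ⊹ U (T f)) ⧢ P f₁) e + (((z * W) ∙ U (P f)) ⧢ P f₁) e
                   ≈⟨ +-cong (⧢-distribʳ (P f₁) _ _ e) (∙-⧢ (z * W) (U (P f)) (P f₁) e) ⟩
                 (D (P f) ⧢ P f₁ ⊹ U (T f) ⧢ P f₁ ⊹ (z * W) ∙ (U (P f) ⧢ P f₁)) e ∎) ⟩
          L fs (D (P f) ⧢ P f₁ ⊹ U (T f) ⧢ P f₁ ⊹ (z * W) ∙ (U (P f) ⧢ P f₁))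
            ≈⟨ trans (L-+ fs _ _) (+-cong (L-+ fs _ _) (L-∙ fs (z * W) _)) ⟩
          L fs (D (P f) ⧢ P f₁) + L ((l₁ , f₁) ∷ fs) (T f) + z * W * L ((l₁ , f₁) ∷ fs) (P f)
            ≈⟨ trans (+-assoc _ _ _) (+-congˡ (departures l f ((l₁ , f₁) ∷ fs))) ⟩
          _ ∎

-- The contracting system for the excess series and its degree bounds.

module ExcessSystem where

  open ForestWalks
  open import Level using (0ℓ)
  open import Algebra.Bundles using (CommutativeRing)
  open import Data.Nat.Base as ℕ using (ℕ; zero; suc; z≤n; s≤s)
  import Data.Nat.Properties as ℕ
  open import Data.Product using (_×_; _,_; proj₁; proj₂; Σ-syntax)
  open import Function using (_∘_)
  open import Relation.Binary.PropositionalEquality as ≡ using (_≡_)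

  module System {A : Set} (_+_ _*_ : A → A → A) (0# 1# : A) (y x q : A) (M′ : ℕ) where

    open Ops _+_ _*_ 0# 1#

    M : ℕ
    M = suc M′

    -- In the notation of the header ν = y μ and G = B/C = 1/(1 - q ν), while h e
    -- weighs the arrangements of e departures from a new vertex along edges of
    -- positive excess.  These three satisfy a system which is contracting in y.
    record Approx : Set where
      constructor approx
      field
        μ G : A
        h   : ℕ → A

    κ : A → A
    κ G = x * (G * G)

    -- This is `B z ε` with one factor y taken out, so that `next-h` is visibly divisible by y. The
    -- power starts at κ² since an edge of positive excess is entered at least twice.
    ε̂ : A → (ℕ → A) → ℕ → A
    ε̂ G h zero    = 0#
    ε̂ G h (suc j) = (κ G * κ G) * (((y * κ G) ^ j) * γ M (suc (suc j)) h)

    T : A → (ℕ → A) → ℕ → A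
    T G h = ε̂ G h ⧢ h

    next-G : A → A → A
    next-G μ G = 1# + (y * ((q * μ) * G))

    next-h : A → (ℕ → A) → ℕ → A
    next-h G h zero    = 1#
    next-h G h (suc e) = y * T G h e

    next-μ : A → A → (ℕ → A) → A
    next-μ μ G h = ((q + (q * q)) * (y * (μ * μ))) + γ M′ 1 (T G h)

    -- The component `μ` receives the updated `G` and `h`: the summand `γ M′ 1 (T G h)` has no
    -- factor y, so it contracts only because its arguments already did.
    next : Approx → Approx
    next (approx μ G h) = approx (next-μ μ (next-G μ G) (next-h G h)) (next-G μ G) (next-h G h)

    iterate : ℕ → Approx
    iterate zero    = approx 0# 0# (λ _ → 0#)
    iterate (suc n) = next (iterate n)

  module SystemProperties (R : CommutativeRing 0ℓ 0ℓ) (y x q : CommutativeRing.Carrier R) (M′ : ℕ) where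

    open CommutativeRing R
    open Shuffle R
    open System _+_ _*_ 0# 1# y x q M′ public
    open import Relation.Binary.Reasoning.Setoid setoid
    open import Algebra.Solver.Ring.NaturalCoefficients.Default commutativeSemiring
      using (solve; _:+_; _:*_; _:=_; con)

    κ-cong : ∀ {G G′} → G ≈ G′ → κ G ≈ κ G′
    κ-cong p = *-congˡ (*-cong p p)

    T-cong : ∀ {G G′ h h′} → G ≈ G′ → h ≗ h′ → T G h ≗ T G′ h′
    T-cong {G} {G′} {h} {h′} p r = ⧢-cong ε̂-cong r
      where
      ε̂-cong : ε̂ G h ≗ ε̂ G′ h′
      ε̂-cong zero    = refl
      ε̂-cong (suc j) = *-cong (*-cong (κ-cong p) (κ-cong p))
                              (*-cong (^-cong j (*-congˡ (κ-cong p))) (γ-cong M (suc (suc j)) r))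

    -- A factor q costs one unit of order, while a factor y earns two and pays for up to two factors
    -- x.
    module Bounds (𝓕 : Filtration)
      (F-q   : ∀ {n a} → Filtration.F 𝓕 (suc n) a → Filtration.F 𝓕 n (q * a))
      (F-yx  : ∀ {n a} → Filtration.F 𝓕 n a → Filtration.F 𝓕 (suc (suc n)) (y * (x * a)))
      (F-yxx : ∀ {n a} → Filtration.F 𝓕 n a → Filtration.F 𝓕 (suc (suc n)) (y * (x * (x * a)))) where

      open Filtration 𝓕
      open FiltrationProperties 𝓕

      record Bounded (s : Approx) : Set where
        open Approx s
        field
          F-ν : F 2 (y * μ)
          F-G : F 0 G
          F-h : ∀ e → F e (h e)

      module _ {G : Carrier} {h : Seq} (F-G : F 0 G) (F-h : ∀ e → F e (h e)) where

        F-yκ : F 2 (y * κ G)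
        F-yκ = F-yx (F-* F-G F-G)

        F-yκ^ : ∀ j → F j ((y * κ G) ^ j)
        F-yκ^ j = F-mono (ℕ.m≤m*n j 2) (F-^ j F-yκ)

        -- The single y pays for both factors x of κ², and each further yκ earns two.
        F-yε̂ : ∀ j → F (suc (suc (j ℕ.* 2))) (y * ε̂ G h (suc j))
        F-yε̂ j = F-resp (solve 6 (λ y x g a b c → y :* (x :* (x :* (g :* g :* (g :* g) :* (b :* c))))
                            := y :* (x :* (g :* g) :* (x :* (g :* g)) :* (b :* c))) refl y x G G _ _)
          (F-yxx (F-mono (ℕ.≤-reflexive (≡.sym (ℕ.+-identityʳ (j ℕ.* 2))))
            (F-* (F-* (F-* F-G F-G) (F-* F-G F-G)) (F-* (F-^ j F-yκ) (F-γ M (suc (suc j)) (λ e → F-mono z≤n (F-h e)))))))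

        -- For k ≥ 1 the order 2k is at least k + 1, and the entry at 0 vanishes.
        F-yε̂′ : ∀ k → F (k ℕ.+ 1) (y * ε̂ G h k)
        F-yε̂′ zero    = F-resp (sym (zeroʳ y)) (F-0 1)
        F-yε̂′ (suc j) = F-mono (s≤s (ℕ.≤-trans (ℕ.≤-reflexive (ℕ.+-comm j 1)) (s≤s (ℕ.m≤m*n j 2)))) (F-yε̂ j)

        F-yε̂² : ∀ k → F 2 (y * ε̂ G h k)
        F-yε̂² zero    = F-resp (sym (zeroʳ y)) (F-0 2)
        F-yε̂² (suc j) = F-mono (s≤s (s≤s z≤n)) (F-yε̂ j)

        F-yT : ∀ e → F (e ℕ.+ 1) (y * T G h e)
        F-yT e = F-resp (∙-⧢ y (ε̂ G h) h e)
          (F-⧢ 1 0 F-yε̂′ (λ i → F-≡ (≡.sym (ℕ.+-identityʳ i)) (F-h i)) e)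

        -- A bound uniform in e, needed at e = 0, where the growing one gives only order 1.
        F-yT² : ∀ e → F 2 (y * T G h e)
        F-yT² e = F-resp (∙-⧢ y (ε̂ G h) h e) (F-⧢-const F-yε̂² (λ i → F-mono z≤n (F-h i)) e)

      bounded-next : ∀ {s} → Bounded s → Bounded (next s)
      bounded-next {approx μ G h} b = record { F-ν = F-ν⁺ ; F-G = F-G⁺ ; F-h = F-h⁺ }
        where
        open Bounded b
        F-G⁺ : F 0 (next-G μ G)
        F-G⁺ = F-+ F-1 (F-resp (solve 4 (λ y q m g → q :* (y :* m) :* g := y :* (q :* m :* g)) refl y q μ G)
                               (F-* (F-q (F-mono (s≤s z≤n) F-ν)) F-G))
        F-h⁺ : ∀ e → F e (next-h G h e)
        F-h⁺ zero    = F-1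
        F-h⁺ (suc e) = F-≡ (ℕ.+-comm e 1) (F-yT F-G F-h e)
        F-ν⁺ : F 2 (y * next-μ μ (next-G μ G) (next-h G h))
        F-ν⁺ = F-resp
          (begin
            q * (y * μ * (y * μ)) + q * (q * (y * μ * (y * μ))) + γ M′ 1 (y ∙ T (next-G μ G) (next-h G h))
              ≈⟨ +-congˡ (γ-∙ M′ 1 y _) ⟩
            _ ≈⟨ solve 4 (λ q y m t → q :* (y :* m :* (y :* m)) :+ q :* (q :* (y :* m :* (y :* m))) :+ y :* t
                            := y :* ((q :+ q :* q) :* (y :* (m :* m)) :+ t)) refl q y μ _ ⟩
            _ ∎)
          -- Since ν² has order 4, the term q²ν² meets the bound exactly and qν² has one unit to
          -- spare.
          (F-+ (F-+ (F-q (F-mono (ℕ.n≤1+n 3) (F-* F-ν F-ν))) (F-q (F-q (F-* F-ν F-ν))))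
               (F-γ M′ 1 (F-yT² F-G⁺ F-h⁺)))

      bounded-iterate : ∀ n → Bounded (iterate n)
      bounded-iterate zero    = record { F-ν = F-resp (sym (zeroʳ y)) (F-0 2) ; F-G = F-0 0 ; F-h = F-0 }
      bounded-iterate (suc n) = bounded-next (bounded-iterate n)

      -- This justifies the cut-off: elements of order at least 2N vanish modulo y^N, so the entries
      -- of `P f` from `M` on are zero.
      F-P : ∀ {X} {B : Carrier} {s} → Bounded s → ∀ f e →
            F e (Walks.Future.P R {X} M B (y * κ (Approx.G s)) (Approx.h s) f e)
      F-P {X} {B} {approx μ G h} b = go
        where
        open Bounded b
        open Walks.Future R {X} M B (y * κ G) h using (P)
        open import Data.List.Base using ([]; _∷_)
        go : ∀ f e → F e (P f e)
        go []               e = F-h e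
        go (node _ cs ∷ ts) e = F-≡ (ℕ.+-identityʳ e)
          (F-⧢ 0 0 (λ k → F-* (F-yκ^ F-G F-h k) (F-γ M k (λ e → F-mono z≤n (go cs e))))
                   (λ k → F-≡ (≡.sym (ℕ.+-identityʳ k)) (go ts k)) e)

    module Solution (μ G : Carrier) (h : Seq)
      (μ-eq : μ ≈ next-μ μ G h)
      (G-eq : G ≈ next-G μ G)
      (h-eq : h ≗ next-h G h) where

      ν v R₀ : Carrier
      ν  = y * μ
      v  = q * ν
      R₀ = γ M′ 1 (h ∘ suc)

      G-eq′ : G ≈ 1# + v * G
      G-eq′ = trans G-eq (+-congˡ (solve 4 (λ y q m g → y :* (q :* m :* g) := q :* (y :* m) :* g) refl y q μ G))

      R₀-eq : R₀ ≈ y * γ M′ 1 (T G h)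
      R₀-eq = trans (γ-cong M′ 1 (h-eq ∘ suc)) (γ-∙ M′ 1 y (T G h))

      ν-eq : ν ≈ (q + q * q) * (ν * ν) + R₀
      ν-eq = begin
        y * μ ≈⟨ *-congˡ μ-eq ⟩
        y * ((q + q * q) * (y * (μ * μ)) + γ M′ 1 (T G h))
          ≈⟨ solve 4 (λ q y m t → y :* ((q :+ q :* q) :* (y :* (m :* m)) :+ t)
                         := (q :+ q :* q) :* (y :* m :* (y :* m)) :+ y :* t) refl q y μ _ ⟩
        (q + q * q) * (ν * ν) + y * γ M′ 1 (T G h) ≈⟨ +-congˡ R₀-eq ⟨
        (q + q * q) * (ν * ν) + R₀ ∎

      γ₁-eq : γ M 1 h ≈ 1# + R₀
      γ₁-eq = +-congʳ (h-eq 0)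

      module WalkParameters (z C p : Carrier)
        (C-eq : C ≈ 1# + x)
        (x-eq : x ≈ z * (C * C))
        (p-eq : p ≈ 1# + x * p)
        (q-eq : q ≈ x * p) where

        V B o : Carrier
        V = p * ν
        B = C * G
        o = y * z

        v-V : v ≈ x * V
        v-V = trans (*-congʳ q-eq) (*-assoc _ _ _)

        -- The equation (1 - x)V = xV² + R without subtraction, ready to be compared with G = 1 +
        -- vG.
        V-eq : 1# + V ≈ 1# + R₀ + v * (1# + V)
        V-eq = begin
          1# + p * ν ≈⟨ +-congˡ (*-congʳ p-eq) ⟩
          1# + (1# + x * p) * ν ≈⟨ solve 3 (λ x p n → con 1 :+ (con 1 :+ x :* p) :* n := con 1 :+ n :+ x :* (p :* n)) refl x p ν ⟩
          1# + ν + x * V ≈⟨ +-congʳ (+-congˡ ν-eq) ⟩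
          1# + ((q + q * q) * (ν * ν) + R₀) + x * V
            ≈⟨ +-congʳ (+-congˡ (+-congʳ (*-congʳ (begin
                 q + q * q ≈⟨ solve 1 (λ q → q :+ q :* q := q :* (con 1 :+ q)) refl q ⟩
                 q * (1# + q) ≈⟨ *-cong q-eq (+-congˡ q-eq) ⟩
                 x * p * (1# + x * p) ≈⟨ *-congˡ p-eq ⟨
                 x * p * p ∎)))) ⟩
          1# + (x * p * p * (ν * ν) + R₀) + x * V
            ≈⟨ solve 4 (λ x p n r → con 1 :+ (x :* p :* p :* (n :* n) :+ r) :+ x :* (p :* n)
                          := con 1 :+ r :+ x :* (p :* n) :* (con 1 :+ p :* n)) refl x p ν R₀ ⟩
          1# + R₀ + x * V * (1# + V) ≈⟨ +-congˡ (*-congʳ v-V) ⟨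
          1# + R₀ + v * (1# + V) ∎

        private
          cancelʳ : ∀ {a b} c → a + c ≈ b + c → a ≈ b
          cancelʳ {a} {b} c eq = begin
            a             ≈⟨ +-identityʳ a ⟨
            a + 0#        ≈⟨ +-congˡ (-‿inverseʳ c) ⟨
            a + (c + - c) ≈⟨ +-assoc a c (- c) ⟨
            a + c + - c   ≈⟨ +-congʳ eq ⟩
            b + c + - c   ≈⟨ +-assoc b c (- c) ⟩
            b + (c + - c) ≈⟨ +-congˡ (-‿inverseʳ c) ⟩
            b + 0#        ≈⟨ +-identityʳ b ⟩
            b             ∎

        -- `G` is the inverse of 1 - v, and `V-eq` says that (1 - v)(1 + V) = 1 + R₀. Instead of
        -- subtracting, `v * G * (1# + V)` is added to both sides and cancelled.
        V-G : 1# + V ≈ G * (1# + R₀)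
        V-G = cancelʳ (v * G * (1# + V)) (begin
          1# + V + v * G * (1# + V) ≈⟨ solve 2 (λ a g → a :+ g :* a := (con 1 :+ g) :* a) refl (1# + V) (v * G) ⟩
          (1# + v * G) * (1# + V) ≈⟨ *-congʳ G-eq′ ⟨
          G * (1# + V) ≈⟨ *-congˡ V-eq ⟩
          G * (1# + R₀ + v * (1# + V))
            ≈⟨ solve 4 (λ g r v a → g :* (r :+ v :* a) := g :* r :+ v :* g :* a) refl G (1# + R₀) v (1# + V) ⟩
          G * (1# + R₀) + v * G * (1# + V) ∎)

        W-eq : B * (1# * γ M 1 h) ≈ C * (1# + V)
        W-eq = begin
          C * G * (1# * γ M 1 h) ≈⟨ *-congˡ (*-congˡ γ₁-eq) ⟩
          C * G * (1# * (1# + R₀)) ≈⟨ solve 3 (λ c g r → c :* g :* (con 1 :* r) := c :* (g :* r)) refl C G (1# + R₀) ⟩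
          C * (G * (1# + R₀)) ≈⟨ *-congˡ V-G ⟨
          C * (1# + V) ∎

        B-eq : B ≈ 1# + z * (B * (1# * γ M 1 h)) * B
        B-eq = begin
          C * G ≈⟨ *-congʳ C-eq ⟩
          (1# + x) * G ≈⟨ solve 2 (λ x g → (con 1 :+ x) :* g := g :+ x :* g) refl x G ⟩
          G + x * G ≈⟨ +-congʳ G-eq′ ⟩
          1# + v * G + x * G ≈⟨ +-congʳ (+-congˡ (*-congʳ v-V)) ⟩
          1# + x * V * G + x * G ≈⟨ solve 3 (λ x V g → con 1 :+ x :* V :* g :+ x :* g := con 1 :+ x :* ((con 1 :+ V) :* g)) refl x V G ⟩
          1# + x * ((1# + V) * G) ≈⟨ +-congˡ (*-congʳ x-eq) ⟩
          1# + z * (C * C) * ((1# + V) * G)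
            ≈⟨ solve 4 (λ z c V g → con 1 :+ z :* (c :* c) :* (V :* g) := con 1 :+ z :* (c :* V) :* (c :* g)) refl z C (1# + V) G ⟩
          1# + z * (C * (1# + V)) * (C * G) ≈⟨ +-congˡ (*-congʳ (*-congˡ W-eq)) ⟨
          1# + z * (B * (1# * γ M 1 h)) * B ∎

        κ-B : κ G ≈ z * (B * B)
        κ-B = trans (*-congʳ x-eq)
          (solve 3 (λ z c g → z :* (c :* c) :* (g :* g) := z :* (c :* g :* (c :* g))) refl z C G)

        yκ-eq : y * κ G ≈ o * (B * B)
        yκ-eq = trans (*-congˡ κ-B) (sym (*-assoc _ _ _))

        module _ {X : Set} where

          open Walks.Future R {X} M B (y * κ G) h

          h-suc : h ∘ suc ≗ (B * z) ∙ (ε ⧢ h)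
          h-suc e = begin
            h (suc e) ≈⟨ h-eq (suc e) ⟩
            y * T G h e ≈⟨ ∙-⧢ y (ε̂ G h) h e ⟨
            ((y ∙ ε̂ G h) ⧢ h) e ≈⟨ ⧢-cong ε-eq (λ _ → refl) e ⟩
            (((B * z) ∙ ε) ⧢ h) e ≈⟨ ∙-⧢ (B * z) ε h e ⟩
            B * z * (ε ⧢ h) e ∎
            where
            ε-eq : y ∙ ε̂ G h ≗ (B * z) ∙ ε
            ε-eq zero    = trans (zeroʳ _) (sym (zeroʳ _))
            ε-eq (suc j) = begin
              y * (κ G * κ G * ((y * κ G) ^ j * γ M (suc (suc j)) h))
                ≈⟨ *-congˡ (*-congʳ (*-congʳ κ-B)) ⟩
              y * (z * (B * B) * κ G * ((y * κ G) ^ j * γ M (suc (suc j)) h))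
                ≈⟨ solve 6 (λ y z b k l g → y :* (z :* (b :* b) :* k :* (l :* g))
                       := b :* z :* (b :* (y :* k :* l :* g))) refl y z B (κ G) _ _ ⟩
              B * z * (B * (y * κ G * (y * κ G) ^ j * γ M (suc (suc j)) h)) ∎

    module Leading (𝓕 : Filtration)
      (F-q   : ∀ {n a} → Filtration.F 𝓕 (suc n) a → Filtration.F 𝓕 n (q * a))
      (F-yx  : ∀ {n a} → Filtration.F 𝓕 n a → Filtration.F 𝓕 (suc (suc n)) (y * (x * a)))
      (F-yxx : ∀ {n a} → Filtration.F 𝓕 n a → Filtration.F 𝓕 (suc (suc n)) (y * (x * (x * a))))
      (μ G : Carrier) (h : Seq)
      (μ-eq : μ ≈ next-μ μ G h)
      (G-eq : G ≈ next-G μ G)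
      (h-eq : h ≗ next-h G h)
      (F-ν : Filtration.F 𝓕 2 (y * μ))
      (F-G : Filtration.F 𝓕 0 G)
      (F-h : ∀ e → Filtration.F 𝓕 e (h e))
      (3≤M′ : 3 ℕ.≤ M′) where

      open Filtration 𝓕
      open FiltrationProperties 𝓕
      open Bounds 𝓕 F-q F-yx F-yxx
      open Solution μ G h μ-eq G-eq h-eq

      F-R₀ : F 2 R₀
      F-R₀ = F-γ M′ 1 (λ e → F-resp (sym (h-eq (suc e))) (F-yT² F-G F-h e))

      private
        F-v : F 1 v
        F-v = F-q F-ν

        -- A first-order expansion: `c` will have order 1, and the error `w` has order 2.
        Expands : Carrier → Carrier → Set
        Expands c a = Σ[ w ∈ Carrier ] F 2 w × a ≈ 1# + c + w

        expands-* : ∀ {c d a b} → F 1 c → F 1 d → Expands c a → Expands d b → Expands (c + d) (a * b)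
        expands-* {c} {d} F-c F-d (w , F-w , a≈) (w′ , F-w′ , b≈) =
          c * d + w + w′ + c * w′ + w * d + w * w′ ,
          F-+ (F-+ (F-+ (F-+ (F-+ (F-* F-c F-d) F-w) F-w′) (F-mono (ℕ.n≤1+n 2) (F-* F-c F-w′)))
            (F-mono (ℕ.n≤1+n 2) (F-* F-w F-d))) (F-mono (ℕ.m≤n+m 2 2) (F-* F-w F-w′)) ,
          trans (*-cong a≈ b≈) (solve 4 (λ c d w w′ → (con 1 :+ c :+ w) :* (con 1 :+ d :+ w′)
            := con 1 :+ (c :+ d) :+ (c :* d :+ w :+ w′ :+ c :* w′ :+ w :* d :+ w :* w′)) refl c d w w′)

        expands-G : Expands v G
        expands-G = v * v * G , F-* (F-* F-v F-v) F-G ,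
          trans G-eq′ (trans (+-congˡ (*-congˡ G-eq′))
            (solve 2 (λ v g → con 1 :+ v :* (con 1 :+ v :* g) := con 1 :+ v :+ v :* v :* g) refl v G))

        expands-G² : Expands (v + v) (G * G)
        expands-G² = expands-* F-v F-v expands-G expands-G

        expands-γ : Expands R₀ (γ M 2 h)
        expands-γ = γ M′ 2 (h ∘ suc) ,
          F-γ M′ 2 (λ e → F-resp (sym (h-eq (suc e))) (F-yT² F-G F-h e)) , +-congʳ γ₁-eq

        expands : Expands (v + v + (v + v) + R₀) (G * G * (G * G) * γ M 2 h)
        expands = expands-* (F-+ (F-+ F-v F-v) (F-+ F-v F-v)) (F-mono (s≤s z≤n) F-R₀)
          (expands-* (F-+ F-v F-v) (F-+ F-v F-v) expands-G² expands-G²) expands-γ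

        -- An edge of positive excess cannot account for a single departure.
        h₁ : h 1 ≈ 0#
        h₁ = trans (h-eq 1) (trans (*-congˡ (zeroˡ _)) (zeroʳ y))

        h₂ : h 2 ≈ y * ε̂ G h 1
        h₂ = trans (h-eq 2) (*-congˡ (trans (+-cong (trans (*-congˡ (h-eq 0)) (*-identityʳ _)) (zeroˡ _)) (+-identityʳ _)))

        h₃ : h 3 ≈ y * ε̂ G h 2
        h₃ = trans (h-eq 3) (*-congˡ (begin
          ε̂ G h 2 * h 0 + ε̂ G h 1 * h 1 + (ε̂ G h 1 * h 1 + 0# * h 2)
            ≈⟨ +-cong (+-cong (*-congˡ (h-eq 0)) (*-congˡ h₁)) (+-congʳ (*-congˡ h₁)) ⟩
          ε̂ G h 2 * 1# + ε̂ G h 1 * 0# + (ε̂ G h 1 * 0# + 0# * h 2)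
            ≈⟨ solve 3 (λ a b c → a :* con 1 :+ b :* con 0 :+ (b :* con 0 :+ con 0 :* c) := a) refl _ _ _ ⟩
          ε̂ G h 2 ∎))

        F-tail : ∀ M → F 4 (γ M 1 (λ e → h (4 ℕ.+ e)))
        F-tail M = F-γ M 1 (λ e → F-mono (ℕ.m≤m+n 4 e) (F-h (4 ℕ.+ e)))

        γ-unfold : ∀ M → 3 ℕ.≤ M → ∀ S →
          γ M 1 S ≈ S 0 + (S 1 + (S 2 + γ (M ℕ.∸ 3) 1 (λ e → S (3 ℕ.+ e))))
        γ-unfold (suc (suc (suc M))) _ S = refl
        γ-unfold (suc (suc zero)) (s≤s (s≤s ()))
        γ-unfold (suc zero)       (s≤s ())

      -- Below order 4 only `h 2` counts, that is, one edge of excess 1. Its factor `G⁴ γ M 2 h` is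
      -- expanded to first order as 1 + 4v + R₀. Although `R₀` itself has order 2, it is kept apart
      -- from the error because it produces the term x^(2ξ) of each coefficient.
      R₀-leading : Σ[ ω ∈ Carrier ] F 4 ω ×
                   R₀ ≈ y * (x * (x * (1# + (v + v + (v + v) + R₀)))) + ω
      R₀-leading =
        y * (x * (x * w)) + (h 3 + tail) ,
        F-+ (F-yxx (proj₁ (proj₂ expands))) (F-+ (F-resp (sym h₃) (F-yε̂ F-G F-h 1)) (F-tail (M′ ℕ.∸ 3))) ,
        (begin
          R₀ ≈⟨ γ-unfold M′ 3≤M′ (h ∘ suc) ⟩
          h 1 + (h 2 + (h 3 + tail)) ≈⟨ trans (+-congʳ h₁) (trans (+-identityˡ _) (+-congʳ h₂)) ⟩
          y * ε̂ G h 1 + (h 3 + tail)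
            ≈⟨ +-congʳ (solve 4 (λ y x g c → y :* (x :* (g :* g) :* (x :* (g :* g)) :* (con 1 :* c))
                  := y :* (x :* (x :* (g :* g :* (g :* g) :* c)))) refl y x G (γ M 2 h)) ⟩
          y * (x * (x * (G * G * (G * G) * γ M 2 h))) + (h 3 + tail)
            ≈⟨ +-congʳ (*-congˡ (*-congˡ (*-congˡ (proj₂ (proj₂ expands))))) ⟩
          y * (x * (x * (1# + (v + v + (v + v) + R₀) + w))) + (h 3 + tail)
            ≈⟨ solve 5 (λ y x a w t → y :* (x :* (x :* (a :+ w))) :+ t
                  := y :* (x :* (x :* a)) :+ (y :* (x :* (x :* w)) :+ t)) refl y x _ w _ ⟩
          y * (x * (x * (1# + (v + v + (v + v) + R₀)))) + (y * (x * (x * w)) + (h 3 + tail)) ∎)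
        where
        w tail : Carrier
        w = proj₁ expands
        tail = γ (M′ ℕ.∸ 3) 1 (λ e → h (4 ℕ.+ e))

-- Catalan numbers, their generating function and the inverse of 1 - zC².

module CatalanSeries where

  open PowerSeriesRings
  open import Defs
  open import Algebra.Bundles using (CommutativeRing)
  open import Data.Nat.Base as ℕ using (ℕ; zero; suc; _!)
  import Data.Nat.Properties as ℕ
  import Data.Nat.DivMod as ℕ
  import Data.Nat.Divisibility as ℕ
  import Data.Nat.Combinatorics as ℕ
  open import Data.Nat.Combinatorics.Specification using (nCk≡n!/k![n-k]!)
  import Data.Nat.Solver as ℕSolver
  open import Data.Integer.Base as ℤ using (+_)
  import Data.Integer.Properties as ℤ
  open import Data.Rational.Base as ℚ using (ℚ; 0ℚ; 1ℚ; 1/_; _/_; toℚᵘ; fromℚᵘ)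
  import Data.Rational.Properties as ℚ
  import Data.Rational.Solver as ℚSolver
  open import Data.Rational.Unnormalised.Base as ℚᵘ using (mkℚᵘ; *≡*)
  import Data.Rational.Unnormalised.Properties as ℚᵘ
  open import Data.Fin.Base using (zero; suc; toℕ)
  open import Data.Vec.Base using (lookup)
  open import Data.Product using (_×_; _,_; ∃-syntax)
  open import Function using (_∘_)
  open import Relation.Binary.PropositionalEquality using (_≡_; refl; sym; trans; cong; cong₂; module ≡-Reasoning)
  open import Algebra.Properties.Monoid.Sum ℚ.+-0-monoid using (sum-syntax; sum-cong-≗)

  module Rationals where

    fromℕ-+ : ∀ m n → fromℕ (m ℕ.+ n) ≡ fromℕ m ℚ.+ fromℕ n
    fromℕ-+ m n = ℚ.toℚᵘ-injective (begin
      toℚᵘ (fromℚᵘ (mkℚᵘ (+ (m ℕ.+ n)) 0)) ≈⟨ ℚ.toℚᵘ-fromℚᵘ _ ⟩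
      mkℚᵘ (+ (m ℕ.+ n)) 0
        ≈⟨ *≡* (cong (ℤ._* + 1) (cong₂ ℤ._+_ (sym (ℤ.*-identityʳ (+ m))) (sym (ℤ.*-identityʳ (+ n))))) ⟩
      mkℚᵘ (+ m) 0 ℚᵘ.+ mkℚᵘ (+ n) 0
        ≈⟨ ℚᵘ.+-cong (ℚ.toℚᵘ-fromℚᵘ (mkℚᵘ (+ m) 0)) (ℚ.toℚᵘ-fromℚᵘ (mkℚᵘ (+ n) 0)) ⟨
      toℚᵘ (fromℕ m) ℚᵘ.+ toℚᵘ (fromℕ n) ≈⟨ ℚ.toℚᵘ-homo-+ (fromℕ m) (fromℕ n) ⟨
      toℚᵘ (fromℕ m ℚ.+ fromℕ n) ∎)
      where open ℚᵘ.≃-Reasoning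

    fromℕ-* : ∀ m n → fromℕ (m ℕ.* n) ≡ fromℕ m ℚ.* fromℕ n
    fromℕ-* zero    n = sym (ℚ.*-zeroˡ (fromℕ n))
    fromℕ-* (suc m) n = begin
      fromℕ (n ℕ.+ m ℕ.* n)             ≡⟨ fromℕ-+ n (m ℕ.* n) ⟩
      fromℕ n ℚ.+ fromℕ (m ℕ.* n)       ≡⟨ cong₂ ℚ._+_ (sym (ℚ.*-identityˡ (fromℕ n))) (fromℕ-* m n) ⟩
      1ℚ ℚ.* fromℕ n ℚ.+ fromℕ m ℚ.* fromℕ n ≡⟨ ℚ.*-distribʳ-+ (fromℕ n) 1ℚ (fromℕ m) ⟨
      (1ℚ ℚ.+ fromℕ m) ℚ.* fromℕ n      ≡⟨ cong (ℚ._* fromℕ n) (fromℕ-+ 1 m) ⟨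
      fromℕ (suc m) ℚ.* fromℕ n         ∎
      where open ≡-Reasoning

    fromℕ-suc : ∀ n → fromℕ (suc n) ≡ 1ℚ ℚ.+ fromℕ n
    fromℕ-suc = fromℕ-+ 1

    fromℕ-*-/ : ∀ a b → fromℕ (suc b) ℚ.* (+ a / suc b) ≡ fromℕ a
    fromℕ-*-/ a b = ℚ.toℚᵘ-injective (begin
      toℚᵘ (fromℕ (suc b) ℚ.* (+ a / suc b)) ≈⟨ ℚ.toℚᵘ-homo-* (fromℕ (suc b)) (+ a / suc b) ⟩
      toℚᵘ (fromℕ (suc b)) ℚᵘ.* toℚᵘ (+ a / suc b)
        ≈⟨ ℚᵘ.*-cong (ℚ.toℚᵘ-fromℚᵘ (mkℚᵘ (+ suc b) 0)) (ℚ.toℚᵘ-fromℚᵘ (mkℚᵘ (+ a) b)) ⟩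
      mkℚᵘ (+ suc b) 0 ℚᵘ.* mkℚᵘ (+ a) b
        ≈⟨ *≡* (trans (ℤ.*-identityʳ (+ suc b ℤ.* + a)) (trans (ℤ.*-comm (+ suc b) (+ a))
             (cong (λ n → + a ℤ.* + suc n) (sym (ℕ.+-identityʳ b))))) ⟩
      mkℚᵘ (+ a) 0 ≈⟨ ℚ.toℚᵘ-fromℚᵘ (mkℚᵘ (+ a) 0) ⟨
      toℚᵘ (fromℕ a) ∎)
      where open ℚᵘ.≃-Reasoning

    fromℕ-pos : ∀ n → ℚ.Positive (fromℕ (suc n))
    fromℕ-pos n = ℚ.normalize-pos (suc n) 1

    *-cancelˡ-pos : ∀ {p q} r .{{_ : ℚ.Positive r}} → r ℚ.* p ≡ r ℚ.* q → p ≡ q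
    *-cancelˡ-pos r eq = ℚ.≤-antisym (ℚ.*-cancelˡ-≤-pos r (ℚ.≤-reflexive eq))
                                     (ℚ.*-cancelˡ-≤-pos r (ℚ.≤-reflexive (sym eq)))

    fromℕ-cancelˡ : ∀ n {p q} → fromℕ (suc n) ℚ.* p ≡ fromℕ (suc n) ℚ.* q → p ≡ q
    fromℕ-cancelˡ n = *-cancelˡ-pos (fromℕ (suc n)) {{fromℕ-pos n}}

  module Catalan where

    open Rationals

    private
      central : ℕ → ℕ
      central n = (2 ℕ.* n) ℕ.C n

      central-! : ∀ n → central n ℕ.* (n ! ℕ.* n !) ≡ (2 ℕ.* n) !
      central-! n = begin
        central n ℕ.* (n ! ℕ.* n !) ≡⟨ cong (λ k → central n ℕ.* (n ! ℕ.* k !)) 2n∸n ⟨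
        central n ℕ.* (n ! ℕ.* (2 ℕ.* n ℕ.∸ n) !) ≡⟨ cong (ℕ._* (n ! ℕ.* (2 ℕ.* n ℕ.∸ n) !)) (nCk≡n!/k![n-k]! n≤2n) ⟩
        _ ≡⟨ ℕ.m/n*n≡m (ℕ.k![n∸k]!∣n! n≤2n) ⟩
        (2 ℕ.* n) ! ∎
        where
        open ≡-Reasoning
        instance _ = n ℕ.!* (2 ℕ.* n ℕ.∸ n) !≢0
        n≤2n : n ℕ.≤ 2 ℕ.* n
        n≤2n = ℕ.m≤m+n n (n ℕ.+ 0)
        2n∸n : 2 ℕ.* n ℕ.∸ n ≡ n
        2n∸n = trans (ℕ.m+n∸m≡n n (n ℕ.+ 0)) (ℕ.+-identityʳ n)

      -- Multiplied by (n + 1) n!², both sides become (2n + 2)!.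
      central-suc : ∀ n → suc n ℕ.* central (suc n) ≡ (2 ℕ.+ 4 ℕ.* n) ℕ.* central n
      central-suc n = ℕ.*-cancelʳ-≡ _ _ (suc n ℕ.* (n ! ℕ.* n !)) (begin
        suc n ℕ.* central (suc n) ℕ.* (suc n ℕ.* (n ! ℕ.* n !))
          ≡⟨ solve 3 (λ m c f → m :* c :* (m :* (f :* f)) := c :* (m :* f :* (m :* f))) refl (suc n) (central (suc n)) (n !) ⟩
        central (suc n) ℕ.* ((suc n) ! ℕ.* (suc n) !) ≡⟨ central-! (suc n) ⟩
        (2 ℕ.* suc n) ! ≡⟨ cong _! (ℕ.*-suc 2 n) ⟩
        (2 ℕ.+ 2 ℕ.* n) ℕ.* ((1 ℕ.+ 2 ℕ.* n) ℕ.* (2 ℕ.* n) !) ≡⟨ cong (λ k → (2 ℕ.+ 2 ℕ.* n) ℕ.* ((1 ℕ.+ 2 ℕ.* n) ℕ.* k)) (central-! n) ⟨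
        (2 ℕ.+ 2 ℕ.* n) ℕ.* ((1 ℕ.+ 2 ℕ.* n) ℕ.* (central n ℕ.* (n ! ℕ.* n !)))
          ≡⟨ solve 3 (λ n c f → (con 2 :+ con 2 :* n) :* ((con 1 :+ con 2 :* n) :* (c :* f))
                := (con 2 :+ con 4 :* n) :* c :* ((con 1 :+ n) :* f)) refl n (central n) (n ! ℕ.* n !) ⟩
        (2 ℕ.+ 4 ℕ.* n) ℕ.* central n ℕ.* (suc n ℕ.* (n ! ℕ.* n !)) ∎)
        where
        open ≡-Reasoning
        open ℕSolver.+-*-Solver
        instance _ = ℕ.m*n≢0 (suc n) (n ! ℕ.* n !) {{_}} {{n ℕ.!* n !≢0}}

    Cat-suc : ∀ n → fromℕ (2 ℕ.+ n) ℚ.* Cat (suc n) ≡ fromℕ (2 ℕ.+ 4 ℕ.* n) ℚ.* Cat n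
    Cat-suc n = fromℕ-cancelˡ n (begin
      fromℕ (suc n) ℚ.* (fromℕ (2 ℕ.+ n) ℚ.* Cat (suc n)) ≡⟨ cong (fromℕ (suc n) ℚ.*_) (fromℕ-*-/ (central (suc n)) (suc n)) ⟩
      fromℕ (suc n) ℚ.* fromℕ (central (suc n)) ≡⟨ fromℕ-* (suc n) (central (suc n)) ⟨
      fromℕ (suc n ℕ.* central (suc n)) ≡⟨ cong fromℕ (central-suc n) ⟩
      fromℕ ((2 ℕ.+ 4 ℕ.* n) ℕ.* central n) ≡⟨ fromℕ-* (2 ℕ.+ 4 ℕ.* n) (central n) ⟩
      fromℕ (2 ℕ.+ 4 ℕ.* n) ℚ.* fromℕ (central n) ≡⟨ cong (fromℕ (2 ℕ.+ 4 ℕ.* n) ℚ.*_) (fromℕ-*-/ (central n) n) ⟨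
      fromℕ (2 ℕ.+ 4 ℕ.* n) ℚ.* (fromℕ (suc n) ℚ.* Cat n)
        ≡⟨ solve 3 (λ a b c → a :* (b :* c) := b :* (a :* c)) refl (fromℕ (2 ℕ.+ 4 ℕ.* n)) (fromℕ (suc n)) (Cat n) ⟩
      fromℕ (suc n) ℚ.* (fromℕ (2 ℕ.+ 4 ℕ.* n) ℚ.* Cat n) ∎)
      where
      open ≡-Reasoning
      open ℚSolver.+-*-Solver

    Cat-pos : ∀ n → ℚ.Positive (Cat n)
    Cat-pos n = ℚ.normalize-pos (central n) (suc n) {{_}} {{central≢0}}
      where
      central≢0 : ℕ.NonZero (central n)
      central≢0 = ℕ.m*n≢0⇒m≢0 (central n)
        {{ℕ.≢-nonZero (λ eq → ℕ.≢-nonZero⁻¹ ((2 ℕ.* n) !) {{(2 ℕ.* n) ℕ.!≢0}} (trans (sym (central-! n)) eq))}}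

  module SeriesRing where

    open PowerSeries ℚ.+-*-commutativeRing public
      using (var; ι; _≋_; ⊛-cong; var-⊛-0; var-⊛-suc; ι-⊛; ⊛-cong<; ⊛-identityˡ)
      renaming (fullRing to 𝕊)

    open CommutativeRing 𝕊 using (_≈_; +-cong; +-congˡ; *-cong; *-congˡ; *-congʳ)
      renaming (refl to ≈-refl; sym to ≈-sym; trans to ≈-trans; 1# to 1ᵣ; 0# to 0ᵣ)
    open import Algebra.Solver.Ring.NaturalCoefficients.Default (CommutativeRing.commutativeSemiring 𝕊)
      using (solve; _:+_; _:*_; _:=_; con)

    const≈ι : ∀ a → const a ≈ ι a
    const≈ι a zero    = refl
    const≈ι a (suc n) = refl

    z≈var : z ≈ var
    z≈var zero          = refl
    z≈var (suc zero)    = refl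
    z≈var (suc (suc n)) = refl

    z*-0 : ∀ f → (z *ₛ f) 0 ≡ 0ℚ
    z*-0 f = trans (*-congʳ {x = f} z≈var 0) (var-⊛-0 f)

    z*-suc : ∀ f n → (z *ₛ f) (suc n) ≡ f n
    z*-suc f n = trans (*-congʳ {x = f} z≈var (suc n)) (var-⊛-suc f n)

    const-* : ∀ a f n → (const a *ₛ f) n ≡ a ℚ.* f n
    const-* a f n = trans (*-congʳ {x = f} (const≈ι a) n) (ι-⊛ a f n)

    private
      -- The Euler operator z d/dz; `θ-*` is its Leibniz rule.
      θ : Series → Series
      θ f n = fromℕ n ℚ.* f n

      θ-* : ∀ f g → θ (f *ₛ g) ≈ θ f *ₛ g +ₛ f *ₛ θ g
      θ-* f g n = trans (cong (λ k → fromℕ k ℚ.* (f *ₛ g) n) (sym (ℕ.+-identityʳ n)))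
        (trans (go n 0 f g) (cong (ℚ._+ (f *ₛ θ g) n)
          (⊛-cong {g = g} (λ k → cong (λ j → fromℕ j ℚ.* f k) (ℕ.+-identityʳ k)) (λ _ → refl) n)))
        where
        open ℚSolver.+-*-Solver renaming (solve to solveℚ; _:+_ to _:+ℚ_; _:*_ to _:*ℚ_; _:=_ to _:=ℚ_; con to conℚ)
        open ≡-Reasoning
        -- f is the i-th shift of the series it comes from.
        go : ∀ n i f g → fromℕ (n ℕ.+ i) ℚ.* (f *ₛ g) n ≡
             ((λ k → fromℕ (k ℕ.+ i) ℚ.* f k) *ₛ g) n ℚ.+ (f *ₛ θ g) n
        go zero    i f g = solveℚ 3 (λ k a b → k :*ℚ (a :*ℚ b :+ℚ conℚ 0ℚ) :=ℚ (k :*ℚ a :*ℚ b :+ℚ conℚ 0ℚ) :+ℚ (a :*ℚ (conℚ 0ℚ :*ℚ b) :+ℚ conℚ 0ℚ))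
          refl (fromℕ i) (f 0) (g 0)
        go (suc n) i f g = begin
          fromℕ (suc n ℕ.+ i) ℚ.* (f 0 ℚ.* g (suc n) ℚ.+ (f′ *ₛ g) n)
            ≡⟨ solveℚ 3 (λ k a b → k :*ℚ (a :+ℚ b) :=ℚ k :*ℚ a :+ℚ k :*ℚ b) refl (fromℕ (suc n ℕ.+ i)) _ _ ⟩
          fromℕ (suc n ℕ.+ i) ℚ.* (f 0 ℚ.* g (suc n)) ℚ.+ fromℕ (suc n ℕ.+ i) ℚ.* (f′ *ₛ g) n
            ≡⟨ cong₂ ℚ._+_ (cong (ℚ._* (f 0 ℚ.* g (suc n))) (fromℕ-+ (suc n) i))
                 (trans (cong (λ k → fromℕ k ℚ.* (f′ *ₛ g) n) (sym (ℕ.+-suc n i))) (go n (suc i) f′ g)) ⟩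
          (fromℕ (suc n) ℚ.+ fromℕ i) ℚ.* (f 0 ℚ.* g (suc n))
            ℚ.+ (((λ k → fromℕ (k ℕ.+ suc i) ℚ.* f′ k) *ₛ g) n ℚ.+ (f′ *ₛ θ g) n)
            ≡⟨ cong (λ a → (fromℕ (suc n) ℚ.+ fromℕ i) ℚ.* (f 0 ℚ.* g (suc n)) ℚ.+ (a ℚ.+ (f′ *ₛ θ g) n))
                 (⊛-cong {g = g} (λ k → cong (λ j → fromℕ j ℚ.* f′ k) (ℕ.+-suc k i)) (λ _ → refl) n) ⟩
          (fromℕ (suc n) ℚ.+ fromℕ i) ℚ.* (f 0 ℚ.* g (suc n))
            ℚ.+ (((λ k → fromℕ (suc k ℕ.+ i) ℚ.* f′ k) *ₛ g) n ℚ.+ (f′ *ₛ θ g) n)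
            ≡⟨ solveℚ 6 (λ k i a b u v → (k :+ℚ i) :*ℚ (a :*ℚ b) :+ℚ (u :+ℚ v)
                   :=ℚ i :*ℚ a :*ℚ b :+ℚ u :+ℚ (a :*ℚ (k :*ℚ b) :+ℚ v)) refl (fromℕ (suc n)) (fromℕ i) (f 0) (g (suc n)) _ _ ⟩
          _ ∎
          where
          open Rationals
          f′ : Series
          f′ = f ∘ suc

      θz : θ z ≈ z
      θz zero          = refl
      θz (suc zero)    = refl
      θz (suc (suc n)) = ℚ.*-zeroʳ (fromℕ (suc (suc n)))

    -- The recurrence of the Catalan numbers as a differential equation.
    private
      θC : θ C +ₛ C ≈ 1ᵣ +ₛ z *ₛ ((θ C +ₛ θ C) +ₛ (θ C +ₛ θ C) +ₛ (C +ₛ C))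
      θC zero    = trans refl (sym (cong (1ℚ ℚ.+_) (z*-0 ((θ C +ₛ θ C) +ₛ (θ C +ₛ θ C) +ₛ (C +ₛ C)))))
      θC (suc n) = begin
        fromℕ (suc n) ℚ.* Cat (suc n) ℚ.+ Cat (suc n)
          ≡⟨ solveℚ 2 (λ k c → k :*ℚ c :+ℚ c :=ℚ (conℚ 1ℚ :+ℚ k) :*ℚ c) refl (fromℕ (suc n)) (Cat (suc n)) ⟩
        (1ℚ ℚ.+ fromℕ (suc n)) ℚ.* Cat (suc n) ≡⟨ cong (ℚ._* Cat (suc n)) (fromℕ-suc (suc n)) ⟨
        fromℕ (2 ℕ.+ n) ℚ.* Cat (suc n) ≡⟨ Catalan.Cat-suc n ⟩
        fromℕ (2 ℕ.+ 4 ℕ.* n) ℚ.* Cat n ≡⟨ cong (ℚ._* Cat n) (trans (fromℕ-+ 2 (4 ℕ.* n)) (cong (fromℕ 2 ℚ.+_) (fromℕ-* 4 n))) ⟩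
        (fromℕ 2 ℚ.+ fromℕ 4 ℚ.* fromℕ n) ℚ.* Cat n
          ≡⟨ solveℚ 2 (λ k c → (conℚ (fromℕ 2) :+ℚ conℚ (fromℕ 4) :*ℚ k) :*ℚ c
                :=ℚ (k :*ℚ c :+ℚ k :*ℚ c) :+ℚ (k :*ℚ c :+ℚ k :*ℚ c) :+ℚ (c :+ℚ c)) refl (fromℕ n) (Cat n) ⟩
        (θ C n ℚ.+ θ C n) ℚ.+ (θ C n ℚ.+ θ C n) ℚ.+ (C n ℚ.+ C n) ≡⟨ z*-suc ((θ C +ₛ θ C) +ₛ (θ C +ₛ θ C) +ₛ (C +ₛ C)) n ⟨
        (z *ₛ ((θ C +ₛ θ C) +ₛ (θ C +ₛ θ C) +ₛ (C +ₛ C))) (suc n) ≡⟨ ℚ.+-identityˡ _ ⟨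
        _ ∎
        where
        open Rationals
        open ≡-Reasoning
        open ℚSolver.+-*-Solver renaming (solve to solveℚ; _:+_ to _:+ℚ_; _:*_ to _:*ℚ_; _:=_ to _:=ℚ_; con to conℚ)

      D : Series
      D = 1ᵣ +ₛ z *ₛ (C *ₛ C)

      θD : θ D ≈ z *ₛ (C *ₛ C) +ₛ z *ₛ (θ C *ₛ C +ₛ C *ₛ θ C)
      θD n = begin
        fromℕ n ℚ.* (1ᵣ n ℚ.+ (z *ₛ (C *ₛ C)) n) ≡⟨ ℚ.*-distribˡ-+ (fromℕ n) _ _ ⟩
        θ 1ᵣ n ℚ.+ θ (z *ₛ (C *ₛ C)) n ≡⟨ cong₂ ℚ._+_ (θ1 n) (θ-* z (C *ₛ C) n) ⟩
        0ℚ ℚ.+ ((θ z *ₛ (C *ₛ C)) n ℚ.+ (z *ₛ θ (C *ₛ C)) n) ≡⟨ ℚ.+-identityˡ _ ⟩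
        (θ z *ₛ (C *ₛ C)) n ℚ.+ (z *ₛ θ (C *ₛ C)) n
          ≡⟨ cong₂ ℚ._+_ (⊛-cong {g = C *ₛ C} θz (λ _ → refl) n) (⊛-cong {f = z} (λ _ → refl) (θ-* C C) n) ⟩
        _ ∎
        where
        open ≡-Reasoning
        θ1 : θ 1ᵣ ≈ 0ᵣ
        θ1 zero    = refl
        θ1 (suc n) = ℚ.*-zeroʳ (fromℕ (suc n))

      θD-θC : (θ D +ₛ D) +ₛ z *ₛ ((θ C +ₛ θ C) +ₛ (θ C +ₛ θ C)) ≈ (θ C +ₛ C) +ₛ z *ₛ ((θ D +ₛ θ D) +ₛ (θ D +ₛ θ D))
      θD-θC = RingIdentities.derivative-identity 𝕊 z C (θ C) D (θ D) ≈-refl θD θC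

      -- Coefficient n + 1 of `θD-θC` reads (n + 2)(Dₙ₊₁ - Cₙ₊₁) = 4n(Dₙ - Cₙ), so all differences
      -- vanish by induction.
      D≈C : D ≈ C
      D≈C zero    = cong (1ℚ ℚ.+_) (z*-0 (C *ₛ C))
      D≈C (suc n) = fromℕ-cancelˡ (suc n) (begin
        fromℕ (2 ℕ.+ n) ℚ.* D (suc n) ≡⟨ lhs (D (suc n)) ⟩
        θ D (suc n) ℚ.+ D (suc n) ≡⟨ ℚ.+-identityʳ _ ⟨
        θ D (suc n) ℚ.+ D (suc n) ℚ.+ 0ℚ ≡⟨ cong (θ D (suc n) ℚ.+ D (suc n) ℚ.+_) (ℚ.+-inverseʳ a) ⟨
        θ D (suc n) ℚ.+ D (suc n) ℚ.+ (a ℚ.- a) ≡⟨ ℚ.+-assoc (θ D (suc n) ℚ.+ D (suc n)) a (ℚ.- a) ⟨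
        θ D (suc n) ℚ.+ D (suc n) ℚ.+ a ℚ.- a ≡⟨ cong (ℚ._- a) (trans (cong (θ D (suc n) ℚ.+ D (suc n) ℚ.+_) (sym (z*-suc ((θ C +ₛ θ C) +ₛ (θ C +ₛ θ C)) n))) (trans (θD-θC (suc n)) (cong (θ C (suc n) ℚ.+ C (suc n) ℚ.+_) b-a))) ⟩
        θ C (suc n) ℚ.+ C (suc n) ℚ.+ a ℚ.- a ≡⟨ ℚ.+-assoc (θ C (suc n) ℚ.+ C (suc n)) a (ℚ.- a) ⟩
        θ C (suc n) ℚ.+ C (suc n) ℚ.+ (a ℚ.- a) ≡⟨ cong (θ C (suc n) ℚ.+ C (suc n) ℚ.+_) (ℚ.+-inverseʳ a) ⟩
        θ C (suc n) ℚ.+ C (suc n) ℚ.+ 0ℚ ≡⟨ ℚ.+-identityʳ _ ⟩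
        θ C (suc n) ℚ.+ C (suc n) ≡⟨ lhs (C (suc n)) ⟨
        fromℕ (2 ℕ.+ n) ℚ.* C (suc n) ∎)
        where
        open Rationals
        open ≡-Reasoning
        open ℚSolver.+-*-Solver renaming (solve to solveℚ; _:+_ to _:+ℚ_; _:*_ to _:*ℚ_; _:=_ to _:=ℚ_; con to conℚ)
        a : ℚ
        a = (θ C n ℚ.+ θ C n) ℚ.+ (θ C n ℚ.+ θ C n)
        b-a : (z *ₛ ((θ D +ₛ θ D) +ₛ (θ D +ₛ θ D))) (suc n) ≡ a
        b-a = trans (z*-suc ((θ D +ₛ θ D) +ₛ (θ D +ₛ θ D)) n) (cong (λ c → (fromℕ n ℚ.* c ℚ.+ fromℕ n ℚ.* c) ℚ.+ (fromℕ n ℚ.* c ℚ.+ fromℕ n ℚ.* c)) (D≈C n))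
        lhs : ∀ c → fromℕ (2 ℕ.+ n) ℚ.* c ≡ fromℕ (suc n) ℚ.* c ℚ.+ c
        lhs c = trans (cong (ℚ._* c) (fromℕ-suc (suc n)))
          (solveℚ 2 (λ k c → (conℚ 1ℚ :+ℚ k) :*ℚ c :=ℚ k :*ℚ c :+ℚ c) refl (fromℕ (suc n)) c)

    C-eq : C ≈ 1ᵣ +ₛ z *ₛ (C *ₛ C)
    C-eq = ≈-sym D≈C

    zC²-eq : zC² ≈ z *ₛ (C *ₛ C)
    zC²-eq = ⊛-cong {f = z} (λ _ → refl) (⊛-cong {f = C} (λ _ → refl) C*1)
      where
      C*1 : C *ₛ 1ₛ ≈ C
      C*1 = ≈-trans (*-congˡ {x = C} (const≈ι 1ℚ)) (CommutativeRing.*-identityʳ 𝕊 C)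

    C-x : C ≈ 1ᵣ +ₛ zC²
    C-x = ≈-trans C-eq (+-congˡ {x = 1ᵣ} (≈-sym zC²-eq))

    -- The root is taken to be 1 - 2zC, and its square is computed from C = 1 + zC².
    sqrt-1-4z : ∃[ r ] IsSqrt r (1ₛ -ₛ const (fromℕ 4) *ₛ z)
              × const (fromℕ 2) *ₛ z *ₛ C ≈ₛ 1ₛ -ₛ r
    sqrt-1-4z = b , (b₀ , b²) , a≡
      where
      open ℚSolver.+-*-Solver renaming (solve to solveℚ; _:+_ to _:+ℚ_; _:*_ to _:*ℚ_; _:=_ to _:=ℚ_; con to conℚ)
      a b : Series
      a = const (fromℕ 2) *ₛ z *ₛ C
      b = 1ₛ -ₛ a
      a-eq : a ≈ z *ₛ (C +ₛ C)
      a-eq n = trans (trans (CommutativeRing.*-assoc 𝕊 (const (fromℕ 2)) z C n) (const-* (fromℕ 2) (z *ₛ C) n))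
        (trans (solveℚ 1 (λ c → conℚ (fromℕ 2) :*ℚ c :=ℚ c :+ℚ c) refl ((z *ₛ C) n))
          (sym (CommutativeRing.distribˡ 𝕊 z C C n)))
      a+b : b +ₛ a ≈ 1ᵣ
      a+b n = trans (solveℚ 2 (λ o c → o :+ℚ (:-ℚ c) :+ℚ c :=ℚ o) refl (1ₛ n) (a n)) (const≈ι 1ℚ n)
        where open ℚSolver.+-*-Solver using () renaming (:-_ to :-ℚ_)
      b₀ : b 0 ≡ 1ℚ
      b₀ = cong (λ c → 1ℚ ℚ.- c) (trans (a-eq 0) (z*-0 (C +ₛ C)))
      4z : Series
      4z = (z +ₛ z) +ₛ (z +ₛ z)
      b²-eq : b *ₛ b +ₛ 4z +ₛ a *ₛ a ≈ 1ᵣ +ₛ a *ₛ a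
      b²-eq = RingIdentities.square-identity 𝕊 z C a b C-eq a-eq a+b
      b² : b *ₛ b ≈ₛ 1ₛ -ₛ const (fromℕ 4) *ₛ z
      b² n = begin
        s ≡⟨ solveℚ 3 (λ s f c → s :=ℚ (s :+ℚ f :+ℚ c) :+ℚ (:-ℚ (f :+ℚ c))) refl s (4z n) ((a *ₛ a) n) ⟩
        (s ℚ.+ 4z n ℚ.+ (a *ₛ a) n) ℚ.- (4z n ℚ.+ (a *ₛ a) n) ≡⟨ cong (ℚ._- (4z n ℚ.+ (a *ₛ a) n)) (b²-eq n) ⟩
        (1ᵣ n ℚ.+ (a *ₛ a) n) ℚ.- (4z n ℚ.+ (a *ₛ a) n)
          ≡⟨ solveℚ 3 (λ o z c → (o :+ℚ c) :+ℚ (:-ℚ (((z :+ℚ z) :+ℚ (z :+ℚ z)) :+ℚ c)) :=ℚ o :+ℚ (:-ℚ (conℚ (fromℕ 4) :*ℚ z))) refl (1ᵣ n) (z n) ((a *ₛ a) n) ⟩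
        1ᵣ n ℚ.- fromℕ 4 ℚ.* z n ≡⟨ cong₂ ℚ._-_ (const≈ι 1ℚ n) (const-* (fromℕ 4) z n) ⟨
        1ₛ n ℚ.- (const (fromℕ 4) *ₛ z) n ∎
        where
        open ≡-Reasoning
        open ℚSolver.+-*-Solver using () renaming (:-_ to :-ℚ_)
        s : ℚ
        s = (b *ₛ b) n
      a≡ : a ≈ₛ 1ₛ -ₛ b
      a≡ n = solveℚ 2 (λ o c → c :=ℚ o :+ℚ (:-ℚ (o :+ℚ (:-ℚ c)))) refl (1ₛ n) (a n)
        where open ℚSolver.+-*-Solver using () renaming (:-_ to :-ℚ_)

    private
      -- The coefficients are listed downwards, so entry i is the coefficient n - i. This turns the
      -- sum defining the inverse into a Cauchy product.
      lookup-inverse : ∀ f .{{_ : ℚ.NonZero (f 0)}} n i → lookup (inverseCoeffs f n) i ≡ inverse f (n ℕ.∸ toℕ i)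
      lookup-inverse f zero    zero    = refl
      lookup-inverse f (suc n) zero    = refl
      lookup-inverse f (suc n) (suc i) = lookup-inverse f n i

    *-inverse : ∀ f .{{_ : ℚ.NonZero (f 0)}} → f *ₛ inverse f ≈ 1ᵣ
    *-inverse f zero    = trans (ℚ.+-identityʳ _) (ℚ.*-inverseʳ (f 0))
    *-inverse f (suc n) = begin
      f 0 ℚ.* (ℚ.- (1/ f 0 ℚ.* S)) ℚ.+ ((f ∘ suc) *ₛ inverse f) n
        ≡⟨ cong (f 0 ℚ.* (ℚ.- (1/ f 0 ℚ.* S)) ℚ.+_)
             (sum-cong-≗ {suc n} (λ i → cong (f (suc (toℕ i)) ℚ.*_) (sym (lookup-inverse f n i)))) ⟩
      f 0 ℚ.* (ℚ.- (1/ f 0 ℚ.* S)) ℚ.+ S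
        ≡⟨ solveℚ 3 (λ a b s → a :*ℚ (:-ℚ (b :*ℚ s)) :+ℚ s :=ℚ (:-ℚ (a :*ℚ b :*ℚ s)) :+ℚ s) refl (f 0) (1/ f 0) S ⟩
      ℚ.- (f 0 ℚ.* 1/ f 0 ℚ.* S) ℚ.+ S ≡⟨ cong (λ a → ℚ.- (a ℚ.* S) ℚ.+ S) (ℚ.*-inverseʳ (f 0)) ⟩
      ℚ.- (1ℚ ℚ.* S) ℚ.+ S ≡⟨ solveℚ 1 (λ s → (:-ℚ (conℚ 1ℚ :*ℚ s)) :+ℚ s :=ℚ conℚ 0ℚ) refl S ⟩
      0ℚ ∎
      where
      open ≡-Reasoning
      open ℚSolver.+-*-Solver renaming (solve to solveℚ; _:+_ to _:+ℚ_; _:*_ to _:*ℚ_; _:=_ to _:=ℚ_; con to conℚ; :-_ to :-ℚ_)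
      S : ℚ
      S = ∑[ i < suc n ] (f (suc (toℕ i)) ℚ.* lookup (inverseCoeffs f n) i)

    p-eq : 1/[1-zC²] ≈ 1ᵣ +ₛ zC² *ₛ 1/[1-zC²]
    p-eq n = begin
      p n ≡⟨ CommutativeRing.*-identityˡ 𝕊 p n ⟨
      (1ᵣ *ₛ p) n ≡⟨ *-congʳ {x = p} 1-x n ⟨
      (((1ₛ -ₛ zC²) +ₛ zC²) *ₛ p) n ≡⟨ CommutativeRing.distribʳ 𝕊 p (1ₛ -ₛ zC²) zC² n ⟩
      ((1ₛ -ₛ zC²) *ₛ p) n ℚ.+ (zC² *ₛ p) n ≡⟨ cong (ℚ._+ (zC² *ₛ p) n) (*-inverse (1ₛ -ₛ zC²) n) ⟩
      1ᵣ n ℚ.+ (zC² *ₛ p) n ∎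
      where
      open ≡-Reasoning
      open ℚSolver.+-*-Solver renaming (solve to solveℚ; _:+_ to _:+ℚ_; _:*_ to _:*ℚ_; _:=_ to _:=ℚ_; con to conℚ; :-_ to :-ℚ_)
      p : Series
      p = 1/[1-zC²]
      1-x : (1ₛ -ₛ zC²) +ₛ zC² ≈ 1ᵣ
      1-x n = trans (solveℚ 2 (λ o c → o :+ℚ (:-ℚ c) :+ℚ c :=ℚ o) refl (1ₛ n) (zC² n)) (const≈ι 1ℚ n)

    -- In C² both indices play the same part, so weighting by one of them gives half of weighting by
    -- their sum.
    θ-symmetric : ∀ n → ((λ k → fromℕ k ℚ.* C k) *ₛ C) n ℚ.+ ((λ k → fromℕ k ℚ.* C k) *ₛ C) n ≡ fromℕ n ℚ.* (C *ₛ C) n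
    θ-symmetric n = trans (cong (((θ C) *ₛ C) n ℚ.+_) (CommutativeRing.*-comm 𝕊 (θ C) C n)) (sym (θ-* C C n))

    Cat-convolution : ∀ n → Cat (suc n) ≡ (C *ₛ C) n
    Cat-convolution n = trans (C-eq (suc n)) (trans (ℚ.+-identityˡ _) (z*-suc (C *ₛ C) n))

-- Polynomials collected from terms x^a p^s.

module PolynomialTerms where

  open import Defs using (Poly; coeff; monomial; _≈ₚ_; NonNegCoeffs)
  open import Data.Nat.Base as ℕ using (ℕ; zero; suc)
  import Data.Nat.Properties as ℕ
  open import Data.Rational.Base as ℚ using (ℚ; 0ℚ)
  import Data.Rational.Properties as ℚ
  open import Data.List.Base using (List; []; _∷_)
  open import Data.List.Relation.Unary.All as All using (All; []; _∷_)
  open import Data.List.Relation.Unary.Any using (Any; here; there)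
  open import Data.Product using (_×_; _,_)
  open import Data.Empty using (⊥-elim)
  open import Function using (_∘_)
  open import Relation.Nullary using (yes; no)
  open import Relation.Binary.PropositionalEquality using (_≡_; _≢_; refl; sym; trans; cong; cong₂; subst)

  module Polynomials where

    infixl 6 _+ₚ_

    _+ₚ_ : Poly → Poly → Poly
    []      +ₚ g       = g
    (a ∷ f) +ₚ []      = a ∷ f
    (a ∷ f) +ₚ (b ∷ g) = a ℚ.+ b ∷ f +ₚ g

    coeff-+ : ∀ f g n → coeff (f +ₚ g) n ≡ coeff f n ℚ.+ coeff g n
    coeff-+ []      g       n       = sym (ℚ.+-identityˡ _)
    coeff-+ (a ∷ f) []      n       = sym (ℚ.+-identityʳ _)
    coeff-+ (a ∷ f) (b ∷ g) zero    = refl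
    coeff-+ (a ∷ f) (b ∷ g) (suc n) = coeff-+ f g n

    coeff-monomial-≡ : ∀ c d → coeff (monomial c d) d ≡ c
    coeff-monomial-≡ c zero    = refl
    coeff-monomial-≡ c (suc d) = coeff-monomial-≡ c d

    coeff-monomial-≢ : ∀ c d n → n ≢ d → coeff (monomial c d) n ≡ 0ℚ
    coeff-monomial-≢ c zero    zero    n≢d = ⊥-elim (n≢d refl)
    coeff-monomial-≢ c zero    (suc n) n≢d = refl
    coeff-monomial-≢ c (suc d) zero    n≢d = refl
    coeff-monomial-≢ c (suc d) (suc n) n≢d = coeff-monomial-≢ c d n (n≢d ∘ cong suc)

    coeff-monomial≥0 : ∀ {c} → 0ℚ ℚ.≤ c → ∀ d n → 0ℚ ℚ.≤ coeff (monomial c d) n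
    coeff-monomial≥0 c≥0 zero    zero    = c≥0
    coeff-monomial≥0 c≥0 zero    (suc n) = ℚ.≤-refl
    coeff-monomial≥0 c≥0 (suc d) zero    = ℚ.≤-refl
    coeff-monomial≥0 c≥0 (suc d) (suc n) = coeff-monomial≥0 c≥0 d n

    -- (c , a , s) stands for c x^a p^s.
    Term : Set
    Term = ℚ × ℕ × ℕ

    -- The coefficient of p^s, as a polynomial in x.
    coefficient : List Term → ℕ → Poly
    coefficient []                 s = []
    coefficient ((c , a , t) ∷ ts) s with t ℕ.≟ s
    ... | yes _ = monomial c a +ₚ coefficient ts s
    ... | no  _ = coefficient ts s

    -- The bounds of the theorem: a is at most the degree claimed for K at s, and s is at most 2ξ -
    -- 2.
    Admissible : ℕ → Term → Set
    Admissible ξ (c , a , s) = 0ℚ ℚ.≤ c × a ℕ.≤ 2 ℕ.* ξ ℕ.+ s × s ℕ.+ 2 ℕ.≤ 2 ℕ.* ξ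

    Leads : ℕ → ℕ → Term → Set
    Leads ξ s (c , a , t) = t ≡ s × a ≡ 2 ℕ.* ξ ℕ.+ s × 0ℚ ℚ.< c

    coefficient≥0 : ∀ ξ {ts} → All (Admissible ξ) ts → ∀ s → NonNegCoeffs (coefficient ts s)
    coefficient≥0 ξ []                                s n = ℚ.≤-refl
    coefficient≥0 ξ {ts = (c , a , t) ∷ ts} ((c≥0 , _) ∷ adm) s n with t ℕ.≟ s
    ... | no  _ = coefficient≥0 ξ adm s n
    ... | yes _ = subst (0ℚ ℚ.≤_) (sym (coeff-+ (monomial c a) (coefficient ts s) n))
      (ℚ.≤-trans (ℚ.≤-reflexive (sym (ℚ.+-identityˡ 0ℚ))) (ℚ.+-mono-≤ (coeff-monomial≥0 c≥0 a n) (coefficient≥0 ξ adm s n)))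

    coefficient-degree : ∀ ξ {ts} → All (Admissible ξ) ts → ∀ s n → 2 ℕ.* ξ ℕ.+ s ℕ.< n → coeff (coefficient ts s) n ≡ 0ℚ
    coefficient-degree ξ []                                 s n lt = refl
    coefficient-degree ξ {ts = (c , a , t) ∷ ts} ((_ , a≤ , _) ∷ adm) s n lt with t ℕ.≟ s
    ... | no  _    = coefficient-degree ξ adm s n lt
    ... | yes refl = trans (coeff-+ (monomial c a) (coefficient ts s) n)
      (cong₂ ℚ._+_ (coeff-monomial-≢ c a n (λ { refl → ℕ.<⇒≱ lt a≤ })) (coefficient-degree ξ adm s n lt))

    -- Non-negativity excludes cancellation, so one positive term of top degree is enough.
    coefficient-lead : ∀ ξ {ts s} → All (Admissible ξ) ts → Any (Leads ξ s) ts → 0ℚ ℚ.< coeff (coefficient ts s) (2 ℕ.* ξ ℕ.+ s)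
    coefficient-lead ξ {(c , a , t) ∷ ts} {s} (_ ∷ adm) (here (t≡s , refl , 0<c)) with t ℕ.≟ s
    ... | no  t≢s = ⊥-elim (t≢s t≡s)
    ... | yes _   = subst (0ℚ ℚ.<_) (sym (coeff-+ (monomial c a) (coefficient ts s) (2 ℕ.* ξ ℕ.+ s)))
      (ℚ.≤-<-trans (ℚ.≤-reflexive (sym (ℚ.+-identityˡ 0ℚ)))
        (ℚ.+-mono-<-≤ (subst (0ℚ ℚ.<_) (sym (coeff-monomial-≡ c (2 ℕ.* ξ ℕ.+ s))) 0<c) (coefficient≥0 ξ adm s (2 ℕ.* ξ ℕ.+ s))))
    coefficient-lead ξ {(c , a , t) ∷ ts} {s} ((c≥0 , _) ∷ adm) (there l) with t ℕ.≟ s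
    ... | no  _ = coefficient-lead ξ adm l
    ... | yes _ = subst (0ℚ ℚ.<_) (sym (coeff-+ (monomial c a) (coefficient ts s) (2 ℕ.* ξ ℕ.+ s)))
      (ℚ.≤-<-trans (ℚ.≤-reflexive (sym (ℚ.+-identityˡ 0ℚ)))
        (ℚ.+-mono-≤-< (coeff-monomial≥0 c≥0 a (2 ℕ.* ξ ℕ.+ s)) (coefficient-lead ξ adm l)))

    coefficient-skip : ∀ {c a t s} ts → t ≢ s → coefficient ((c , a , t) ∷ ts) s ≡ coefficient ts s
    coefficient-skip {t = t} {s} ts t≢s with t ℕ.≟ s
    ... | yes t≡s = ⊥-elim (t≢s t≡s)
    ... | no  _   = refl

    coefficient-only : ∀ {c a s} ts → All (λ (_ , _ , t) → t ≢ s) ts → coefficient ((c , a , s) ∷ ts) s ≈ₚ monomial c a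
    coefficient-only {c} {a} {s} ts ts≢ n with s ℕ.≟ s
    ... | no  s≢s = ⊥-elim (s≢s refl)
    ... | yes _   = trans (coeff-+ (monomial c a) (coefficient ts s) n)
      (trans (cong (λ f → coeff (monomial c a) n ℚ.+ coeff f n) (none ts ts≢)) (ℚ.+-identityʳ _))
      where
      none : ∀ ts → All (λ (_ , _ , t) → t ≢ s) ts → coefficient ts s ≡ []
      none []       []        = refl
      none (_ ∷ ts) (t≢ ∷ p) = trans (coefficient-skip ts t≢) (none ts p)

    module _ {c₁ c₂ : ℚ} {a₁ a₂ s₁ s₂ : ℕ} (ts : List Term) (s₂<s₁ : s₂ ℕ.< s₁)
             (ts< : All (λ (_ , _ , t) → t ℕ.< s₂) ts) where

      coefficient-first : coefficient ((c₁ , a₁ , s₁) ∷ (c₂ , a₂ , s₂) ∷ ts) s₁ ≈ₚ monomial c₁ a₁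
      coefficient-first = coefficient-only ((c₂ , a₂ , s₂) ∷ ts)
        (ℕ.<⇒≢ s₂<s₁ ∷ All.map (λ t< → ℕ.<⇒≢ (ℕ.<-trans t< s₂<s₁)) ts<)

      coefficient-second : coefficient ((c₁ , a₁ , s₁) ∷ (c₂ , a₂ , s₂) ∷ ts) s₂ ≈ₚ monomial c₂ a₂
      coefficient-second = subst (_≈ₚ monomial c₂ a₂)
        (sym (coefficient-skip ((c₂ , a₂ , s₂) ∷ ts) (ℕ.<⇒≢ s₂<s₁ ∘ sym)))
        (coefficient-only ts (All.map ℕ.<⇒≢ ts<))

    leads-∷∷ : ∀ ξ {c₁ c₂ s₁ s₂} (ts : List Term) → 0ℚ ℚ.< c₁ → 0ℚ ℚ.< c₂ → s₁ ≡ suc s₂ →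
               (∀ s → s ℕ.< s₂ → Any (Leads ξ s) ts) → ∀ s → s ℕ.≤ s₁ →
               Any (Leads ξ s) ((c₁ , 2 ℕ.* ξ ℕ.+ s₁ , s₁) ∷ (c₂ , 2 ℕ.* ξ ℕ.+ s₂ , s₂) ∷ ts)
    leads-∷∷ ξ {s₂ = s₂} ts c₁>0 c₂>0 refl leads s s≤ with s ℕ.≟ suc s₂ | s ℕ.≟ s₂
    ... | yes refl | _        = here (refl , refl , c₁>0)
    ... | no _     | yes refl = there (here (refl , refl , c₂>0))
    ... | no s≢    | no s≢′   = there (there (leads s (ℕ.≤∧≢⇒< (ℕ.≤-pred (ℕ.≤∧≢⇒< s≤ s≢)) s≢′)))

-- Cones of monomials and the leading terms of ν.

module LeadingCones where

  open PowerSeriesRings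
  open CatalanSeries using (module Rationals; module Catalan; module SeriesRing)
  open import Defs using (Cat; fromℕ; _*ₛ_)
  open import Level using (0ℓ)
  open import Algebra.Bundles using (CommutativeRing)
  open import Data.Nat.Base as ℕ using (ℕ; zero; suc; z≤n; s≤s)
  import Data.Nat.Properties as ℕ
  import Data.Nat.Solver as ℕSolver
  import Data.Nat.Induction as ℕ
  open import Data.Rational.Base as ℚ using (ℚ; 0ℚ; 1ℚ)
  import Data.Rational.Properties as ℚ
  import Data.Rational.Solver as ℚSolver
  open import Data.List.Base using (List; []; _∷_; _++_; map)
  open import Data.List.Relation.Unary.Any as Any using (Any; here; there)
  import Data.List.Relation.Unary.Any.Properties as Any
  open import Data.Product using (_×_; _,_; proj₁; proj₂; Σ-syntax; ∃-syntax)
  open import Data.Sum using (_⊎_; inj₁; inj₂)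
  open import Data.Empty using (⊥-elim)
  open import Function using (_∘_)
  open import Relation.Nullary using (¬_; yes; no)
  open import Relation.Binary.PropositionalEquality as ≡ using (_≡_; cong; subst; subst₂)

  *-nonNeg : ∀ {c d} → 0ℚ ℚ.≤ c → 0ℚ ℚ.≤ d → 0ℚ ℚ.≤ c ℚ.* d
  *-nonNeg {c} {d} c≥0 d≥0 = ℚ.nonNegative⁻¹ (c ℚ.* d)
    {{ℚ.nonNeg*nonNeg⇒nonNeg c {{ℚ.nonNegative c≥0}} d {{ℚ.nonNegative d≥0}}}}

  module SecondCoefficient where

    -- At n = 0 the term in question does not exist, hence D 0 = 0.
    D : ℕ → ℚ
    D zero    = 0ℚ
    D (suc m) = fromℕ (2 ℕ.+ 3 ℕ.* suc m) ℚ.* Cat (suc m)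

    -- The recursion that ν imposes on its second coefficients: `Cat (suc m)` comes from qν², the
    -- doubled convolution from q²ν², and the four `Cat m` from 4x²yqν. The latter complete both
    -- convolutions from D to D + 2, which is 3θC + 2C, and `θ-symmetric` evaluates the result.
    D-suc : ∀ m → (Cat (suc m) ℚ.+ ((Cat *ₛ D) m ℚ.+ (Cat *ₛ D) m)) ℚ.+ ((Cat m ℚ.+ Cat m) ℚ.+ (Cat m ℚ.+ Cat m)) ≡ D (suc m)
    D-suc m = begin
      (K ℚ.+ (S ℚ.+ S)) ℚ.+ ((u ℚ.+ u) ℚ.+ (u ℚ.+ u))
        ≡⟨ ℚsolve 3 (λ k s u → (k :+ℚ (s :+ℚ s)) :+ℚ ((u :+ℚ u) :+ℚ (u :+ℚ u)) :=ℚ k :+ℚ ((s :+ℚ (u :+ℚ u)) :+ℚ (s :+ℚ (u :+ℚ u)))) ≡.refl K S u ⟩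
      K ℚ.+ ((S ℚ.+ (u ℚ.+ u)) ℚ.+ (S ℚ.+ (u ℚ.+ u)))
        ≡⟨ cong (λ t → K ℚ.+ (t ℚ.+ t)) convolution ⟩
      K ℚ.+ (((X ℚ.+ X ℚ.+ X) ℚ.+ ((Cat *ₛ Cat) m ℚ.+ (Cat *ₛ Cat) m)) ℚ.+ ((X ℚ.+ X ℚ.+ X) ℚ.+ ((Cat *ₛ Cat) m ℚ.+ (Cat *ₛ Cat) m)))
        ≡⟨ cong (λ t → K ℚ.+ (((X ℚ.+ X ℚ.+ X) ℚ.+ (t ℚ.+ t)) ℚ.+ ((X ℚ.+ X ℚ.+ X) ℚ.+ (t ℚ.+ t)))) (SeriesRing.Cat-convolution m) ⟨
      K ℚ.+ (((X ℚ.+ X ℚ.+ X) ℚ.+ (K ℚ.+ K)) ℚ.+ ((X ℚ.+ X ℚ.+ X) ℚ.+ (K ℚ.+ K)))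
        ≡⟨ ℚsolve 2 (λ k x → k :+ℚ (((x :+ℚ x :+ℚ x) :+ℚ (k :+ℚ k)) :+ℚ ((x :+ℚ x :+ℚ x) :+ℚ (k :+ℚ k)))
              :=ℚ ℚconst 5 :*ℚ k :+ℚ ℚconst 3 :*ℚ (x :+ℚ x)) ≡.refl K X ⟩
      fromℕ 5 ℚ.* K ℚ.+ fromℕ 3 ℚ.* (X ℚ.+ X)
        ≡⟨ cong (λ t → fromℕ 5 ℚ.* K ℚ.+ fromℕ 3 ℚ.* t) (≡.trans (SeriesRing.θ-symmetric m) (cong (fromℕ m ℚ.*_) (≡.sym (SeriesRing.Cat-convolution m)))) ⟩
      fromℕ 5 ℚ.* K ℚ.+ fromℕ 3 ℚ.* (fromℕ m ℚ.* K)
        ≡⟨ ℚsolve 2 (λ k m → ℚconst 5 :*ℚ k :+ℚ ℚconst 3 :*ℚ (m :*ℚ k) :=ℚ (ℚconst 5 :+ℚ ℚconst 3 :*ℚ m) :*ℚ k) ≡.refl K (fromℕ m) ⟩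
      (fromℕ 5 ℚ.+ fromℕ 3 ℚ.* fromℕ m) ℚ.* K
        ≡⟨ cong (ℚ._* K) (≡.trans (cong (fromℕ 5 ℚ.+_) (≡.sym (Rationals.fromℕ-* 3 m))) (≡.sym (Rationals.fromℕ-+ 5 (3 ℕ.* m)))) ⟩
      fromℕ (5 ℕ.+ 3 ℕ.* m) ℚ.* K ≡⟨ cong (λ k → fromℕ (2 ℕ.+ k) ℚ.* K) (ℕ.*-suc 3 m) ⟨
      D (suc m) ∎
      where
      open ≡.≡-Reasoning
      open ℚSolver.+-*-Solver renaming (solve to ℚsolve; _:+_ to _:+ℚ_; _:*_ to _:*ℚ_; _:=_ to _:=ℚ_; con to ℚcon)
      ℚconst : ∀ {n} → ℕ → ℚSolver.+-*-Solver.Polynomial n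
      ℚconst n = ℚcon (fromℕ n)
      θC : ℕ → ℚ
      θC k = fromℕ k ℚ.* Cat k
      K S u X : ℚ
      K = Cat (suc m)
      S = (Cat *ₛ D) m
      u = Cat m
      X = (θC *ₛ Cat) m
      open CommutativeRing SeriesRing.𝕊 using (*-congˡ) renaming (_+_ to _+ᵣ_; 1# to 1ᵣ; _≈_ to _≈ᵣ_)
      open import Algebra.Solver.Ring.NaturalCoefficients.Default (CommutativeRing.commutativeSemiring SeriesRing.𝕊)
      -- The constant 2 on the left makes up for `D 0 = 0`, where the closed formula would give 2.
      D-θ : D +ᵣ (1ᵣ +ᵣ 1ᵣ) ≈ᵣ (θC +ᵣ θC +ᵣ θC) +ᵣ (Cat +ᵣ Cat)
      D-θ zero    = ≡.refl
      D-θ (suc j) = ≡.trans (ℚ.+-identityʳ (D (suc j))) (≡.trans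
        (cong (ℚ._* Cat (suc j)) (≡.trans (Rationals.fromℕ-+ 2 (3 ℕ.* suc j)) (cong (fromℕ 2 ℚ.+_) (Rationals.fromℕ-* 3 (suc j)))))
        (ℚsolve 2 (λ k c → (ℚconst 2 :+ℚ ℚconst 3 :*ℚ k) :*ℚ c :=ℚ (k :*ℚ c :+ℚ k :*ℚ c :+ℚ k :*ℚ c) :+ℚ (c :+ℚ c)) ≡.refl (fromℕ (suc j)) (Cat (suc j))))
      convolution : S ℚ.+ (u ℚ.+ u) ≡ (X ℚ.+ X ℚ.+ X) ℚ.+ ((Cat *ₛ Cat) m ℚ.+ (Cat *ₛ Cat) m)
      convolution = ≡.trans
        (solve 2 (λ c d → c :* d :+ (c :+ c) := c :* (d :+ (con 1 :+ con 1))) (λ _ → ≡.refl) Cat D m)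
        (≡.trans (*-congˡ {x = Cat} D-θ m)
          (solve 2 (λ c t → c :* ((t :+ t :+ t) :+ (c :+ c)) := (t :* c :+ t :* c :+ t :* c) :+ (c :* c :+ c :* c)) (λ _ → ≡.refl) Cat θC m))

    D-pos : ∀ m → 0ℚ ℚ.< D (suc m)
    D-pos m = ℚ.positive⁻¹ (D (suc m)) {{ℚ.pos*pos⇒pos (fromℕ (2 ℕ.+ 3 ℕ.* suc m)) {{Rationals.fromℕ-pos (1 ℕ.+ 3 ℕ.* suc m)}} (Cat (suc m)) {{Catalan.Cat-pos (suc m)}}}}

    D-nonNeg : ∀ m → 0ℚ ℚ.≤ D m
    D-nonNeg zero    = ℚ.≤-refl
    D-nonNeg (suc m) = ℚ.<⇒≤ (D-pos m)

    Cat>0 : ∀ n → 0ℚ ℚ.< Cat n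
    Cat>0 n = ℚ.positive⁻¹ (Cat n) {{Catalan.Cat-pos n}}

  -- Combinations of the x^a p^s with non-negative coefficients, with
  -- s + k ≤ 2ξ and a ≤ 2ξ + s.  The bounds are homogeneous, so that products
  -- correspond to adding (k , ξ).
  module Cones (R : CommutativeRing 0ℓ 0ℓ)
    (x p : CommutativeRing.Carrier R) (κ : ℚ → CommutativeRing.Carrier R)
    (κ-+ : ∀ c d → CommutativeRing._≈_ R (κ (c ℚ.+ d)) (CommutativeRing._+_ R (κ c) (κ d)))
    (κ-* : ∀ c d → CommutativeRing._≈_ R (κ (c ℚ.* d)) (CommutativeRing._*_ R (κ c) (κ d)))
    (κ-0 : CommutativeRing._≈_ R (κ 0ℚ) (CommutativeRing.0# R))
    (κ-1 : CommutativeRing._≈_ R (κ 1ℚ) (CommutativeRing.1# R)) where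

    open CommutativeRing R
    open import Algebra.Properties.Semiring.Exp semiring public using (_^_; ^-homo-*; ^-congʳ)
    open import Relation.Binary.Reasoning.Setoid setoid
    open import Algebra.Solver.Ring.NaturalCoefficients.Default commutativeSemiring
      using (solve; _:+_; _:*_; _:=_; con)

    q : Carrier
    q = x * p

    record Monomial (k ξ : ℕ) : Set where
      constructor mono
      field
        coef   : ℚ
        xdeg   : ℕ
        pdeg   : ℕ
        coef≥0 : 0ℚ ℚ.≤ coef
        pdeg≤  : pdeg ℕ.+ k ℕ.≤ 2 ℕ.* ξ
        xdeg≤  : xdeg ℕ.≤ 2 ℕ.* ξ ℕ.+ pdeg

    open Monomial public

    term : ℚ → ℕ → ℕ → Carrier
    term c a s = κ c * (x ^ a * p ^ s)

    ⟦_⟧₁ : ∀ {k ξ} → Monomial k ξ → Carrier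
    ⟦ m ⟧₁ = term (coef m) (xdeg m) (pdeg m)

    ⟦_⟧ : ∀ {k ξ} → List (Monomial k ξ) → Carrier
    ⟦ [] ⟧     = 0#
    ⟦ m ∷ ms ⟧ = ⟦ m ⟧₁ + ⟦ ms ⟧

    value : List (ℚ × ℕ × ℕ) → Carrier
    value []                 = 0#
    value ((c , a , s) ∷ ts) = term c a s + value ts

    terms : ∀ {k ξ} → List (Monomial k ξ) → List (ℚ × ℕ × ℕ)
    terms = map (λ m → coef m , xdeg m , pdeg m)

    value-terms : ∀ {k ξ} (ms : List (Monomial k ξ)) → value (terms ms) ≡ ⟦ ms ⟧
    value-terms []       = ≡.refl
    value-terms (m ∷ ms) = cong (⟦ m ⟧₁ +_) (value-terms ms)

    Cone : ℕ → ℕ → Carrier → Set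
    Cone k ξ f = Σ[ ms ∈ List (Monomial k ξ) ] f ≈ ⟦ ms ⟧

    ⟦++⟧ : ∀ {k ξ} (ms ns : List (Monomial k ξ)) → ⟦ ms ++ ns ⟧ ≈ ⟦ ms ⟧ + ⟦ ns ⟧
    ⟦++⟧ []       ns = sym (+-identityˡ _)
    ⟦++⟧ (m ∷ ms) ns = trans (+-congˡ (⟦++⟧ ms ns)) (sym (+-assoc _ _ _))

    term-* : ∀ c d a b s t → term (c ℚ.* d) (a ℕ.+ b) (s ℕ.+ t) ≈ term c a s * term d b t
    term-* c d a b s t = trans (*-cong (κ-* c d) (*-cong (^-homo-* x a b) (^-homo-* p s t)))
      (solve 6 (λ c d a b s t → c :* d :* (a :* b :* (s :* t)) := c :* (a :* s) :* (d :* (b :* t))) refl _ _ _ _ _ _)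

    term-+ : ∀ c d a s → term (c ℚ.+ d) a s ≈ term c a s + term d a s
    term-+ c d a s = trans (*-congʳ (κ-+ c d)) (distribʳ _ _ _)

    term-0 : ∀ a s → term 0ℚ a s ≈ 0#
    term-0 a s = trans (*-congʳ κ-0) (zeroˡ _)

    private
      linear : ∀ {k ξ l ζ} (g : Monomial k ξ → Monomial l ζ) (e : Carrier) → (∀ m → ⟦ g m ⟧₁ ≈ e * ⟦ m ⟧₁) →
               ∀ ms → ⟦ map g ms ⟧ ≈ e * ⟦ ms ⟧
      linear g e h []       = sym (zeroʳ e)
      linear g e h (m ∷ ms) = trans (+-cong (h m) (linear g e h ms)) (sym (distribˡ _ _ _))

      times : ∀ {k ξ l ζ} → Monomial k ξ → Monomial l ζ → Monomial (k ℕ.+ l) (ξ ℕ.+ ζ)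
      times {k} {ξ} {l} {ζ} (mono c a s c≥0 s≤ a≤) (mono d b t d≥0 t≤ b≤) = mono (c ℚ.* d) (a ℕ.+ b) (s ℕ.+ t)
        (*-nonNeg c≥0 d≥0)
        (subst₂ ℕ._≤_ (ℕsolve 4 (λ s k t l → (s :+ℕ k) :+ℕ (t :+ℕ l) :=ℕ (s :+ℕ t) :+ℕ (k :+ℕ l)) ≡.refl s k t l)
          (≡.sym (ℕ.*-distribˡ-+ 2 ξ ζ)) (ℕ.+-mono-≤ s≤ t≤))
        (subst (a ℕ.+ b ℕ.≤_) (ℕsolve 4 (λ x z s t → (conℕ 2 :*ℕ x :+ℕ s) :+ℕ (conℕ 2 :*ℕ z :+ℕ t) :=ℕ conℕ 2 :*ℕ (x :+ℕ z) :+ℕ (s :+ℕ t))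
          ≡.refl ξ ζ s t) (ℕ.+-mono-≤ a≤ b≤))
        where open ℕSolver.+-*-Solver renaming (solve to ℕsolve; _:+_ to _:+ℕ_; _:*_ to _:*ℕ_; _:=_ to _:=ℕ_; con to conℕ)

      products : ∀ {k ξ l ζ} → List (Monomial k ξ) → List (Monomial l ζ) → List (Monomial (k ℕ.+ l) (ξ ℕ.+ ζ))
      products []       ns = []
      products (m ∷ ms) ns = map (times m) ns ++ products ms ns

      ⟦products⟧ : ∀ {k ξ l ζ} (ms : List (Monomial k ξ)) (ns : List (Monomial l ζ)) → ⟦ products ms ns ⟧ ≈ ⟦ ms ⟧ * ⟦ ns ⟧
      ⟦products⟧ []       ns = sym (zeroˡ _)
      ⟦products⟧ (m ∷ ms) ns = begin
        ⟦ map (times m) ns ++ products ms ns ⟧ ≈⟨ ⟦++⟧ (map (times m) ns) _ ⟩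
        ⟦ map (times m) ns ⟧ + ⟦ products ms ns ⟧
          ≈⟨ +-cong (linear (times m) ⟦ m ⟧₁ (λ n → term-* (coef m) (coef n) (xdeg m) (xdeg n) (pdeg m) (pdeg n)) ns) (⟦products⟧ ms ns) ⟩
        ⟦ m ⟧₁ * ⟦ ns ⟧ + ⟦ ms ⟧ * ⟦ ns ⟧ ≈⟨ distribʳ _ _ _ ⟨
        ⟦ m ∷ ms ⟧ * ⟦ ns ⟧ ∎

      weaken : ∀ {k l ξ} → k ℕ.≤ l → Monomial l ξ → Monomial k ξ
      weaken k≤l (mono c a s c≥0 s≤ a≤) = mono c a s c≥0 (ℕ.≤-trans (ℕ.+-monoʳ-≤ s k≤l) s≤) a≤

      -- Since q = xp raises a and s together, the bound on a is kept and only the slack k drops.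
      q-shift : ∀ {k ξ} → Monomial (suc k) ξ → Monomial k ξ
      q-shift {k} {ξ} (mono c a s c≥0 s≤ a≤) = mono c (suc a) (suc s) c≥0
        (subst (ℕ._≤ 2 ℕ.* ξ) (ℕ.+-suc s k) s≤) (subst (suc a ℕ.≤_) (≡.sym (ℕ.+-suc (2 ℕ.* ξ) s)) (s≤s a≤))

      -- multiplication by xʲ with j ≤ 2, raising ξ by one
      x-shift : ∀ j → j ℕ.≤ 2 → ∀ {k ξ} → Monomial k ξ → Monomial (2 ℕ.+ k) (suc ξ)
      x-shift j j≤2 {k} {ξ} (mono c a s c≥0 s≤ a≤) = mono c (j ℕ.+ a) s c≥0
        (subst₂ ℕ._≤_ (ℕsolve 2 (λ s k → conℕ 2 :+ℕ (s :+ℕ k) :=ℕ s :+ℕ (conℕ 2 :+ℕ k)) ≡.refl s k) (≡.sym (ℕ.*-suc 2 ξ)) (ℕ.+-monoʳ-≤ 2 s≤))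
        (subst (j ℕ.+ a ℕ.≤_) (cong (ℕ._+ s) (≡.sym (ℕ.*-suc 2 ξ))) (ℕ.+-mono-≤ j≤2 a≤))
        where open ℕSolver.+-*-Solver renaming (solve to ℕsolve; _:+_ to _:+ℕ_; _:*_ to _:*ℕ_; _:=_ to _:=ℕ_; con to conℕ)

      term-x : ∀ c a s → term c (suc a) s ≈ x * term c a s
      term-x c a s = solve 4 (λ c x a p → c :* ((x :* a) :* p) := x :* (c :* (a :* p))) refl _ _ _ _

      term-q : ∀ c a s → term c (suc a) (suc s) ≈ q * term c a s
      term-q c a s = solve 5 (λ c x a p s → c :* ((x :* a) :* (p :* s)) := x :* p :* (c :* (a :* s))) refl _ _ _ _ _

    cone-resp : ∀ {k ξ f g} → f ≈ g → Cone k ξ f → Cone k ξ g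
    cone-resp e (ms , eq) = ms , trans (sym e) eq

    cone-0 : ∀ {k ξ} → Cone k ξ 0#
    cone-0 = [] , refl

    cone-+ : ∀ {k ξ f g} → Cone k ξ f → Cone k ξ g → Cone k ξ (f + g)
    cone-+ (ms , e) (ns , e′) = ms ++ ns , trans (+-cong e e′) (sym (⟦++⟧ ms ns))

    cone-* : ∀ {k ξ l ζ f g} → Cone k ξ f → Cone l ζ g → Cone (k ℕ.+ l) (ξ ℕ.+ ζ) (f * g)
    cone-* (ms , e) (ns , e′) = products ms ns , trans (*-cong e e′) (sym (⟦products⟧ ms ns))

    cone-weaken : ∀ {k l ξ f} → k ℕ.≤ l → Cone l ξ f → Cone k ξ f
    cone-weaken k≤l (ms , e) = map (weaken k≤l) ms ,
      trans e (trans (sym (*-identityˡ _)) (sym (linear (weaken k≤l) 1# (λ m → sym (*-identityˡ _)) ms)))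

    cone-q : ∀ {k ξ f} → Cone (suc k) ξ f → Cone k ξ (q * f)
    cone-q (ms , e) = map q-shift ms , trans (*-congˡ e) (sym (linear q-shift q (λ m → term-q (coef m) (xdeg m) (pdeg m)) ms))

    cone-x : ∀ {k ξ f} → Cone k ξ f → Cone (2 ℕ.+ k) (suc ξ) (x * f)
    cone-x (ms , e) = map (x-shift 1 (s≤s z≤n)) ms ,
      trans (*-congˡ e) (sym (linear (x-shift 1 (s≤s z≤n)) x (λ m → term-x (coef m) (xdeg m) (pdeg m)) ms))

    private
      term-xx : ∀ c a s → term c (2 ℕ.+ a) s ≈ x * x * term c a s
      term-xx c a s = trans (term-x c (suc a) s) (trans (*-congˡ (term-x c a s)) (sym (*-assoc _ _ _)))

    cone-xx : ∀ {k ξ f} → Cone k ξ f → Cone (2 ℕ.+ k) (suc ξ) (x * (x * f))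
    cone-xx (ms , e) = map (x-shift 2 ℕ.≤-refl) ms ,
      trans (*-congˡ (*-congˡ e)) (trans (sym (*-assoc _ _ _))
        (sym (linear (x-shift 2 ℕ.≤-refl) (x * x) (λ m → term-xx (coef m) (xdeg m) (pdeg m)) ms)))

    cone-1 : Cone 0 0 1#
    cone-1 = mono 1ℚ 0 0 (ℚ.nonNegative⁻¹ 1ℚ) z≤n z≤n ∷ [] ,
      trans (sym κ-1) (solve 1 (λ c → c := c :* (con 1 :* con 1) :+ con 0) refl (κ 1ℚ))

    -- No exponent s satisfies s + k ≤ 2ξ, so the combination is empty.
    cone-vanish : ∀ {k ξ f} → 2 ℕ.* ξ ℕ.< k → Cone k ξ f → f ≈ 0#
    cone-vanish _ ([] , e) = e
    cone-vanish {k} lt (m ∷ _ , e) with () ← ℕ.<⇒≱ lt (ℕ.≤-trans (ℕ.m≤n+m k (pdeg m)) (pdeg≤ m))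

    HasLead : ∀ {k ξ} → ℕ → List (Monomial k ξ) → Set
    HasLead {k} {ξ} t = Any (λ m → pdeg m ≡ t × xdeg m ≡ 2 ℕ.* ξ ℕ.+ t × 0ℚ ℚ.< coef m)

    -- The term of the highest degree in x among those with exponent s of p.
    lead : ℚ → ℕ → ℕ → Carrier
    lead c ξ s = term c (2 ℕ.* ξ ℕ.+ s) s

    lead-cong : ∀ {c c′ ξ ξ′ s s′} → c ≡ c′ → ξ ≡ ξ′ → s ≡ s′ → lead c ξ s ≈ lead c′ ξ′ s′
    lead-cong ≡.refl ≡.refl ≡.refl = refl

    lead-* : ∀ c d ξ ζ s t → lead c ξ s * lead d ζ t ≈ lead (c ℚ.* d) (ξ ℕ.+ ζ) (s ℕ.+ t)
    lead-* c d ξ ζ s t = trans (sym (term-* c d (2 ℕ.* ξ ℕ.+ s) (2 ℕ.* ζ ℕ.+ t) s t))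
      (reflexive (cong (λ a → term (c ℚ.* d) a (s ℕ.+ t))
        (ℕsolve 4 (λ x z s t → (conℕ 2 :*ℕ x :+ℕ s) :+ℕ (conℕ 2 :*ℕ z :+ℕ t) :=ℕ conℕ 2 :*ℕ (x :+ℕ z) :+ℕ (s :+ℕ t)) ≡.refl ξ ζ s t)))
      where open ℕSolver.+-*-Solver renaming (solve to ℕsolve; _:+_ to _:+ℕ_; _:*_ to _:*ℕ_; _:=_ to _:=ℕ_; con to conℕ)

    lead-q : ∀ c ξ s → q * lead c ξ s ≈ lead c ξ (suc s)
    lead-q c ξ s = trans (sym (term-q c (2 ℕ.* ξ ℕ.+ s) s)) (reflexive (cong (λ a → term c a (suc s)) (≡.sym (ℕ.+-suc (2 ℕ.* ξ) s))))

    lead-xx : ∀ c ξ s → x * (x * lead c ξ s) ≈ lead c (suc ξ) s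
    lead-xx c ξ s = trans (trans (sym (*-assoc _ _ _)) (sym (term-xx c (2 ℕ.* ξ ℕ.+ s) s)))
      (reflexive (cong (λ a → term c (a ℕ.+ s) s) (≡.sym (ℕ.*-suc 2 ξ))))

    lead-+ : ∀ c d ξ s → lead (c ℚ.+ d) ξ s ≈ lead c ξ s + lead d ξ s
    lead-+ c d ξ s = term-+ c d (2 ℕ.* ξ ℕ.+ s) s

    leadMonomial : ∀ {k} c ξ s → 0ℚ ℚ.≤ c → s ℕ.+ k ℕ.≤ 2 ℕ.* ξ → Monomial k ξ
    leadMonomial c ξ s c≥0 s≤ = mono c (2 ℕ.* ξ ℕ.+ s) s c≥0 s≤ ℕ.≤-refl

    cone-lead : ∀ {k} c ξ s → 0ℚ ℚ.≤ c → s ℕ.+ k ℕ.≤ 2 ℕ.* ξ → Cone k ξ (lead c ξ s)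
    cone-lead c ξ s c≥0 s≤ = leadMonomial c ξ s c≥0 s≤ ∷ [] , sym (+-identityʳ _)

    -- For each exponent in S the combination contains a positive term of top degree in x. This is a
    -- property of the list and not of its value, because the powers of x and p need not be
    -- independent.
    LeadCone : ℕ → ℕ → (ℕ → Set) → Carrier → Set
    LeadCone k ξ S f = Σ[ ms ∈ List (Monomial k ξ) ] (f ≈ ⟦ ms ⟧) × (∀ t → S t → HasLead t ms)

    leadCone-+ : ∀ {k ξ S f g} → LeadCone k ξ S f → Cone k ξ g → LeadCone k ξ S (f + g)
    leadCone-+ (ms , e , h) (ns , e′) =
      ms ++ ns , trans (+-cong e e′) (sym (⟦++⟧ ms ns)) , λ t St → Any.++⁺ˡ (h t St)

    -- The added monomial serves the exponent s, so `f` has to serve only the others.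
    leadCone-lead : ∀ {k ξ S} c s → 0ℚ ℚ.< c → s ℕ.+ k ℕ.≤ 2 ℕ.* ξ → ∀ {f} → LeadCone k ξ (λ t → S t × ¬ t ≡ s) f →
                    LeadCone k ξ S (lead c ξ s + f)
    leadCone-lead {k} {ξ} {S} c s 0<c s≤ (ms , e , h) = m₀ ∷ ms , +-congˡ e , choose
      where
      m₀ : Monomial k ξ
      m₀ = leadMonomial c ξ s (ℚ.<⇒≤ 0<c) s≤
      choose : ∀ t → S t → HasLead t (m₀ ∷ ms)
      choose t St with t ℕ.≟ s
      ... | yes ≡.refl = here (≡.refl , ≡.refl , 0<c)
      ... | no t≢s     = there (h t (St , t≢s))

    leadCone-q : ∀ {k ξ S f} → LeadCone (suc k) ξ S f → LeadCone k ξ (λ t → ∃[ r ] t ≡ suc r × S r) (q * f)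
    leadCone-q {ξ = ξ} (ms , e , h) = map q-shift ms ,
      trans (*-congˡ e) (sym (linear q-shift q (λ m → term-q (coef m) (xdeg m) (pdeg m)) ms)) ,
      λ { _ (r , ≡.refl , Sr) → Any.map⁺ (Any.map (λ (s≡ , a≡ , 0<c) →
        cong suc s≡ , ≡.trans (cong suc a≡) (≡.sym (ℕ.+-suc (2 ℕ.* ξ) r)) , 0<c) (h r Sr)) }

    leadCone-xx : ∀ {k ξ S f} → LeadCone k ξ S f → LeadCone (2 ℕ.+ k) (suc ξ) S (x * (x * f))
    leadCone-xx {ξ = ξ} (ms , e , h) = map (x-shift 2 ℕ.≤-refl) ms ,
      trans (*-congˡ (*-congˡ e)) (trans (sym (*-assoc _ _ _))
        (sym (linear (x-shift 2 ℕ.≤-refl) (x * x) (λ m → term-xx (coef m) (xdeg m) (pdeg m)) ms))) ,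
      λ t St → Any.map⁺ (Any.map (λ (s≡ , a≡ , 0<c) →
        s≡ , ≡.trans (cong (2 ℕ.+_) a≡) (cong (ℕ._+ t) (≡.sym (ℕ.*-suc 2 ξ))) , 0<c) (h t St))

    leadCone-weaken : ∀ {k l ξ S f} → k ℕ.≤ l → LeadCone l ξ S f → LeadCone k ξ S f
    leadCone-weaken k≤l (ms , e , h) = map (weaken k≤l) ms ,
      trans e (trans (sym (*-identityˡ _)) (sym (linear (weaken k≤l) 1# (λ m → sym (*-identityˡ _)) ms))) ,
      λ t St → Any.map⁺ (h t St)

    leadCone-resp : ∀ {k ξ S f g} → f ≈ g → LeadCone k ξ S f → LeadCone k ξ S g
    leadCone-resp e (ms , eq , h) = ms , trans (sym e) eq , h

    leadCone-⊆ : ∀ {k ξ S S′ f} → (∀ t → S′ t → S t) → LeadCone k ξ S f → LeadCone k ξ S′ f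
    leadCone-⊆ S′⊆ (ms , e , h) = ms , e , λ t S′t → h t (S′⊆ t S′t)

    leadCone⇒cone : ∀ {k ξ S f} → LeadCone k ξ S f → Cone k ξ f
    leadCone⇒cone (ms , e , _) = ms , e

    open PowerSeries R using (PS; _⊛_; ⊛-cong)

    -- The offset `a` lets the induction pass to the tail of `f`; `b` makes the statement symmetric.
    cone-⊛ : ∀ k l a b n {f g : PS} → (∀ i → i ℕ.≤ n → Cone k (i ℕ.+ a) (f i)) → (∀ i → i ℕ.≤ n → Cone l (i ℕ.+ b) (g i)) →
             Cone (k ℕ.+ l) (n ℕ.+ (a ℕ.+ b)) ((f ⊛ g) n)
    cone-⊛ k l a b zero    cf cg = cone-resp (sym (+-identityʳ _)) (cone-* (cf 0 z≤n) (cg 0 z≤n))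
    cone-⊛ k l a b (suc n) {f} {g} cf cg = cone-+
      (subst (λ ξ → Cone (k ℕ.+ l) ξ (f 0 * g (suc n)))
        (ℕsolve 3 (λ n a b → a :+ℕ (conℕ 1 :+ℕ n :+ℕ b) :=ℕ conℕ 1 :+ℕ n :+ℕ (a :+ℕ b)) ≡.refl n a b)
        (cone-* (cf 0 z≤n) (cg (suc n) ℕ.≤-refl)))
      (subst (λ ξ → Cone (k ℕ.+ l) ξ ((f ∘ suc ⊛ g) n))
        (ℕsolve 3 (λ n a b → n :+ℕ (conℕ 1 :+ℕ a :+ℕ b) :=ℕ conℕ 1 :+ℕ n :+ℕ (a :+ℕ b)) ≡.refl n a b)
        (cone-⊛ k l (suc a) b n
          (λ i i≤ → subst (λ ξ → Cone k ξ (f (suc i))) (≡.sym (ℕ.+-suc i a)) (cf (suc i) (s≤s i≤)))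
          (λ i i≤ → cg i (ℕ.m≤n⇒m≤1+n i≤))))
      where open ℕSolver.+-*-Solver renaming (solve to ℕsolve; _:+_ to _:+ℕ_; _:*_ to _:*ℕ_; _:=_ to _:=ℕ_; con to conℕ)

    -- All exponents are affine in the index, so every product lands on the same monomial and only
    -- the coefficients are convolved.
    lead-⊛ : ∀ (α β : ℕ → ℚ) n → ((λ i → lead (α i) (suc i) (2 ℕ.* i)) ⊛ (λ i → lead (β i) (suc i) (2 ℕ.* i))) n
             ≈ lead ((α *ₛ β) n) (2 ℕ.+ n) (2 ℕ.* n)
    lead-⊛ α β n = trans
      (⊛-cong {f′ = A 1 0 α} {g = B} (λ i → lead-cong {α i} ≡.refl (ℕ.+-comm 1 i) (≡.sym (ℕ.+-identityʳ (2 ℕ.* i)))) (λ _ → refl) n)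
      (trans (go n 1 0 α) (lead-cong {(α *ₛ β) n} ≡.refl (ℕ.+-comm n 2) (ℕ.+-identityʳ (2 ℕ.* n))))
      where
      open ℕSolver.+-*-Solver renaming (solve to ℕsolve; _:+_ to _:+ℕ_; _:*_ to _:*ℕ_; _:=_ to _:=ℕ_; con to conℕ)
      A : ℕ → ℕ → (ℕ → ℚ) → PS
      A u v α i = lead (α i) (i ℕ.+ u) (2 ℕ.* i ℕ.+ v)
      B : PS
      B i = lead (β i) (suc i) (2 ℕ.* i)
      go : ∀ n u v α → (A u v α ⊛ B) n ≈ lead ((α *ₛ β) n) (n ℕ.+ suc u) (2 ℕ.* n ℕ.+ v)
      go zero    u v α = trans (+-identityʳ _) (trans (lead-* (α 0) (β 0) u 1 v 0)
        (lead-cong {α 0 ℚ.* β 0} (≡.sym (ℚ.+-identityʳ _)) (ℕ.+-comm u 1) (ℕ.+-identityʳ v)))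
      go (suc n) u v α = begin
        A u v α 0 * B (suc n) + (A u v α ∘ suc ⊛ B) n
          ≈⟨ +-cong (lead-* (α 0) (β (suc n)) u (2 ℕ.+ n) v (2 ℕ.* suc n))
               (⊛-cong {g = B} (λ i → lead-cong {α (suc i)} ≡.refl (≡.sym (ℕ.+-suc i u))
                   (ℕsolve 2 (λ i v → conℕ 2 :*ℕ (conℕ 1 :+ℕ i) :+ℕ v :=ℕ conℕ 2 :*ℕ i :+ℕ (conℕ 2 :+ℕ v)) ≡.refl i v)) (λ _ → refl) n) ⟩
        lead (α 0 ℚ.* β (suc n)) (u ℕ.+ (2 ℕ.+ n)) (v ℕ.+ 2 ℕ.* suc n) + (A (suc u) (2 ℕ.+ v) (α ∘ suc) ⊛ B) n
          ≈⟨ +-cong (lead-cong {α 0 ℚ.* β (suc n)} ≡.refl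
                       (ℕsolve 2 (λ u n → u :+ℕ (conℕ 2 :+ℕ n) :=ℕ conℕ 1 :+ℕ n :+ℕ (conℕ 1 :+ℕ u)) ≡.refl u n) (ℕ.+-comm v (2 ℕ.* suc n)))
               (trans (go n (suc u) (2 ℕ.+ v) (α ∘ suc)) (lead-cong {((α ∘ suc) *ₛ β) n} ≡.refl (ℕ.+-suc n (suc u))
                 (ℕsolve 2 (λ i v → conℕ 2 :*ℕ i :+ℕ (conℕ 2 :+ℕ v) :=ℕ conℕ 2 :*ℕ (conℕ 1 :+ℕ i) :+ℕ v) ≡.refl n v))) ⟩
        lead (α 0 ℚ.* β (suc n)) (suc n ℕ.+ suc u) (2 ℕ.* suc n ℕ.+ v) + lead (((α ∘ suc) *ₛ β) n) (suc n ℕ.+ suc u) (2 ℕ.* suc n ℕ.+ v)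
          ≈⟨ lead-+ (α 0 ℚ.* β (suc n)) (((α ∘ suc) *ₛ β) n) (suc n ℕ.+ suc u) (2 ℕ.* suc n ℕ.+ v) ⟨
        lead ((α *ₛ β) (suc n)) (suc n ℕ.+ suc u) (2 ℕ.* suc n ℕ.+ v) ∎

    module LeadingTerms (N : ℕ) (ν R₀ ω : PS)
      (ν-cone : ∀ ξ → ξ ℕ.< N → Cone 2 ξ (ν ξ))
      (R-cone : ∀ ξ → ξ ℕ.< N → Cone 2 ξ (R₀ ξ))
      (ω-cone : ∀ ξ → ξ ℕ.< N → Cone 4 ξ (ω ξ))
      (ν-eq   : ∀ ξ → ξ ℕ.< N → ν ξ ≈ (q + q * q) * (ν ⊛ ν) ξ + R₀ ξ)
      (R-eq   : ∀ ξ → suc ξ ℕ.< N → R₀ (suc ξ) ≈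
                x * (x * (PowerSeries.1ₚ R ξ + (q * ν ξ + q * ν ξ + (q * ν ξ + q * ν ξ) + R₀ ξ))) + ω (suc ξ)) where

      open SecondCoefficient
      open PowerSeries R using (fullRing; _⊕_; _·_; ⊛-suc; ·-⊛; ⊛-comm)

      -- ν (n + 1) is a n + τ n + r n, where a n and τ n have the two highest
      -- exponents of p and r n is a remainder.
      a τ d r ψ φ σ : PS
      a n       = lead (Cat n) (suc n) (2 ℕ.* n)
      τ zero    = 0#
      τ (suc m) = lead (D (suc m)) (2 ℕ.+ m) (suc (2 ℕ.* m))
      d n       = lead (D n) (suc n) (2 ℕ.* n)
      r n       = ν (suc n) + - (a n + τ n)
      ψ n       = τ n + r n
      φ n       = q * ψ n
      σ n       = q * r n

      ν-split : ∀ n → ν (suc n) ≈ a n + ψ n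
      ν-split n = begin
        ν (suc n)                                 ≈⟨ +-identityʳ _ ⟨
        ν (suc n) + 0#                            ≈⟨ +-congˡ (-‿inverseʳ (a n + τ n)) ⟨
        ν (suc n) + (a n + τ n + - (a n + τ n))
          ≈⟨ solve 4 (λ v a t m → v :+ (a :+ t :+ m) := a :+ (t :+ (v :+ m))) refl (ν (suc n)) (a n) (τ n) (- (a n + τ n)) ⟩
        a n + ψ n                                 ∎

      private
        2n+2 : ∀ n → 2 ℕ.* n ℕ.+ 2 ℕ.≤ 2 ℕ.* suc n
        2n+2 n = ℕ.≤-reflexive (≡.trans (ℕ.+-comm (2 ℕ.* n) 2) (≡.sym (ℕ.*-suc 2 n)))

        a-cone : ∀ n → Cone 2 (suc n) (a n)
        a-cone n = cone-lead (Cat n) (suc n) (2 ℕ.* n) (ℚ.<⇒≤ (Cat>0 n)) (2n+2 n)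

        d-cone : ∀ n → Cone 2 (suc n) (d n)
        d-cone n = cone-lead (D n) (suc n) (2 ℕ.* n) (D-nonNeg n) (2n+2 n)

        τ-cone : ∀ n → Cone 3 (suc n) (τ n)
        τ-cone zero    = cone-0
        τ-cone (suc m) = cone-lead (D (suc m)) (2 ℕ.+ m) (suc (2 ℕ.* m)) (D-nonNeg (suc m))
          (ℕ.≤-reflexive (ℕsolve 1 (λ m → conℕ 1 :+ℕ conℕ 2 :*ℕ m :+ℕ conℕ 3 :=ℕ conℕ 2 :*ℕ (conℕ 2 :+ℕ m)) ≡.refl m))
          where open ℕSolver.+-*-Solver renaming (solve to ℕsolve; _:+_ to _:+ℕ_; _:*_ to _:*ℕ_; _:=_ to _:=ℕ_; con to conℕ)

        q-τ : ∀ n → q * τ n ≈ d n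
        q-τ zero    = trans (zeroʳ q) (sym (term-0 2 0))
        q-τ (suc m) = trans (lead-q (D (suc m)) (2 ℕ.+ m) (suc (2 ℕ.* m)))
          (lead-cong {D (suc m)} {ξ = 2 ℕ.+ m} ≡.refl ≡.refl (≡.sym (ℕ.*-suc 2 m)))

        φ-split : ∀ n → φ n ≈ d n + σ n
        φ-split n = trans (distribˡ _ _ _) (+-congʳ (q-τ n))

      -- The exponents 2n and 2n - 1 belong to `a` and `τ`; the remainder must stay below them and
      -- provide a leading term at each lower exponent.
      Shape : ℕ → Set
      Shape n = LeadCone 4 (suc n) (λ s → 2 ℕ.+ s ℕ.≤ 2 ℕ.* n) (r n)

      private
        zero-sq : ∀ {b} → b ≈ 0# → ∀ {c} → c * b ≈ 0#
        zero-sq e = trans (*-congˡ e) (zeroʳ _)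

        ν₀ : 0 ℕ.< N → ν 0 ≈ 0#
        ν₀ lt = cone-vanish (s≤s z≤n) (ν-cone 0 lt)

        R₁ : 1 ℕ.< N → R₀ 1 ≈ lead 1ℚ 1 0
        R₁ lt = begin
          R₀ 1 ≈⟨ R-eq 0 lt ⟩
          x * (x * (1# + (q * ν 0 + q * ν 0 + (q * ν 0 + q * ν 0) + R₀ 0))) + ω 1
            ≈⟨ +-cong (*-congˡ (*-congˡ (+-congˡ (+-cong (+-cong (+-cong e e) (+-cong e e)) (cone-vanish (s≤s z≤n) (R-cone 0 0<N))))))
                      (cone-vanish (s≤s (s≤s (s≤s z≤n))) (ω-cone 1 lt)) ⟩
          x * (x * (1# + (0# + 0# + (0# + 0#) + 0#))) + 0#
            ≈⟨ solve 1 (λ x → x :* (x :* (con 1 :+ (con 0 :+ con 0 :+ (con 0 :+ con 0) :+ con 0))) :+ con 0 := con 1 :* ((x :* (x :* con 1)) :* con 1)) refl x ⟩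
          1# * ((x * (x * 1#)) * 1#) ≈⟨ *-congʳ κ-1 ⟨
          lead 1ℚ 1 0 ∎
          where
          0<N : 0 ℕ.< N
          0<N = ℕ.<-trans (s≤s z≤n) lt
          e : q * ν 0 ≈ 0#
          e = zero-sq (ν₀ 0<N)

        -- The recursion for `R₀` contains x²R₀, which multiplies the monomial x^(2ξ) by x² when ξ
        -- grows by one. This yields the exact degree of K at s = 0.
        R-lead : ∀ ξ → suc ξ ℕ.< N → Σ[ R° ∈ Carrier ] Cone 2 (suc ξ) R° × R₀ (suc ξ) ≈ lead 1ℚ (suc ξ) 0 + R°
        R-lead zero    lt = 0# , cone-0 , trans (R₁ lt) (sym (+-identityʳ _))
        R-lead (suc ξ) lt with R° , R°-cone , eq ← R-lead ξ (ℕ.<⇒≤ lt) =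
          x * (x * (4v + R°)) + ω (2 ℕ.+ ξ) ,
          cone-+ (cone-weaken (ℕ.m≤n+m 2 1) (cone-xx (cone-+ (cone-+ (cone-+ cv cv) (cone-+ cv cv)) (cone-weaken (ℕ.n≤1+n 1) R°-cone))))
            (cone-weaken (ℕ.m≤n+m 2 2) (ω-cone (2 ℕ.+ ξ) lt)) ,
          (begin
            R₀ (2 ℕ.+ ξ) ≈⟨ R-eq (suc ξ) lt ⟩
            x * (x * (0# + (4v + R₀ (suc ξ)))) + ω (2 ℕ.+ ξ) ≈⟨ +-congʳ (*-congˡ (*-congˡ (+-congˡ (+-congˡ eq)))) ⟩
            x * (x * (0# + (4v + (lead 1ℚ (suc ξ) 0 + R°)))) + ω (2 ℕ.+ ξ)
              ≈⟨ solve 5 (λ x v l r o → x :* (x :* (con 0 :+ (v :+ (l :+ r)))) :+ o := x :* (x :* l) :+ (x :* (x :* (v :+ r)) :+ o)) refl x 4v _ R° _ ⟩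
            x * (x * lead 1ℚ (suc ξ) 0) + (x * (x * (4v + R°)) + ω (2 ℕ.+ ξ)) ≈⟨ +-congʳ (lead-xx 1ℚ (suc ξ) 0) ⟩
            lead 1ℚ (2 ℕ.+ ξ) 0 + (x * (x * (4v + R°)) + ω (2 ℕ.+ ξ)) ∎)
          where
          v 4v : Carrier
          v  = q * ν (suc ξ)
          4v = v + v + (v + v)
          cv : Cone 1 (suc ξ) v
          cv = cone-q (ν-cone (suc ξ) (ℕ.<⇒≤ lt))

        shape-0 : 1 ℕ.< N → Shape 0
        shape-0 lt = [] , eq , λ { t () }
          where
          eq : ν 1 + - (a 0 + 0#) ≈ 0#
          eq = begin
            ν 1 + - (a 0 + 0#) ≈⟨ +-congʳ (ν-eq 1 lt) ⟩
            (q + q * q) * (ν 0 * ν 1 + (ν 1 * ν 0 + 0#)) + R₀ 1 + - (a 0 + 0#)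
              ≈⟨ +-cong (+-cong (*-congˡ (+-cong (trans (*-congʳ (ν₀ 0<N)) (zeroˡ _)) (+-congʳ (zero-sq (ν₀ 0<N))))) (R₁ lt)) (-‿cong (+-identityʳ (a 0))) ⟩
            (q + q * q) * (0# + (0# + 0#)) + lead 1ℚ 1 0 + - a 0
              ≈⟨ +-congʳ (solve 2 (λ q l → q :* (con 0 :+ (con 0 :+ con 0)) :+ l := l) refl (q + q * q) _) ⟩
            a 0 + - a 0 ≈⟨ -‿inverseʳ (a 0) ⟩
            0# ∎
            where
            0<N : 0 ℕ.< N
            0<N = ℕ.<-trans (s≤s z≤n) lt

        conv-q : ∀ f g n → q * (f ⊛ g) n ≈ (f ⊛ (q · g)) n
        conv-q f g n = trans (*-congˡ (⊛-comm f g n)) (trans (sym (·-⊛ q g f n)) (⊛-comm (q · g) f n))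

        -- The terms with s ≥ 2m + 1 are gathered into exactly `a (suc m) + τ (suc m)`, so
        -- `r (suc m)` is a sum without subtraction. There the monomial of `R-lead` leads at s = 0
        -- and one of the four copies of x²φ at 1 ≤ s ≤ 2m. All else goes into `Z`, which only has
        -- to lie in the cone.
        shape-suc : ∀ m → 2 ℕ.+ m ℕ.< N → (∀ i → i ℕ.≤ m → Shape i) → Shape (suc m)
        shape-suc m lt shapes = leadCone-resp (sym r-eq)
          (leadCone-lead 1ℚ 0 (ℚ.positive⁻¹ 1ℚ) (4≤ m) (leadCone-+ (leadCone-xx (φ-leads m (shapes m ℕ.≤-refl))) Z-cone))
          where
          4≤ : ∀ m → 4 ℕ.≤ 2 ℕ.* (2 ℕ.+ m)
          4≤ m = ℕ.*-monoʳ-≤ 2 (s≤s (s≤s (z≤n {m})))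
          r-cone : ∀ i → i ℕ.≤ m → Cone 4 (suc i) (r i)
          r-cone i i≤ = leadCone⇒cone (shapes i i≤)
          ψ-cone : ∀ i → i ℕ.≤ m → Cone 3 (suc i) (ψ i)
          ψ-cone i i≤ = cone-+ (τ-cone i) (cone-weaken (ℕ.n≤1+n 3) (r-cone i i≤))
          φ-cone : ∀ i → i ℕ.≤ m → Cone 2 (suc i) (φ i)
          φ-cone i i≤ = cone-q (ψ-cone i i≤)
          σ-cone : ∀ i → i ℕ.≤ m → Cone 3 (suc i) (σ i)
          σ-cone i i≤ = cone-q (r-cone i i≤)
          at : ∀ {k l f g} → (∀ i → i ℕ.≤ m → Cone k (suc i) (f i)) → (∀ i → i ℕ.≤ m → Cone l (suc i) (g i)) → Cone (k ℕ.+ l) (2 ℕ.+ m) ((f ⊛ g) m)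
          at {k} {l} {f} {g} cf cg = subst (λ ξ → Cone (k ℕ.+ l) ξ ((f ⊛ g) m)) (ℕ.+-comm m 2)
            (cone-⊛ k l 1 1 m (λ i i≤ → subst (λ ξ → Cone k ξ (f i)) (ℕ.+-comm 1 i) (cf i i≤))
                              (λ i i≤ → subst (λ ξ → Cone l ξ (g i)) (ℕ.+-comm 1 i) (cg i i≤)))
          ca : ∀ i → i ℕ.≤ m → Cone 2 (suc i) (a i)
          ca i _ = a-cone i

          R° A : Carrier
          A  = x * (x * (q * a m))
          R° = proj₁ (R-lead m (ℕ.<⇒≤ lt))

          aa aφ ad aσ ψφ φφ xxφ Z : Carrier
          aa  = (a ⊛ a) m
          aφ  = (a ⊛ φ) m
          ad  = (a ⊛ d) m
          aσ  = (a ⊛ σ) m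
          ψφ  = (ψ ⊛ φ) m
          φφ  = (φ ⊛ φ) m
          xxφ = x * (x * φ m)
          Z   = (aφ + aφ) + (q * aσ + q * aσ) + (ψφ + φφ) + (xxφ + xxφ + xxφ + x * (x * R°) + ω (2 ℕ.+ m))

          xxφ-cone : Cone 4 (2 ℕ.+ m) xxφ
          xxφ-cone = cone-xx (φ-cone m ℕ.≤-refl)
          Z-cone : Cone 4 (2 ℕ.+ m) Z
          Z-cone = cone-+ (cone-+ (cone-+ (cone-+ caφ caφ) (cone-+ cqaσ cqaσ))
              (cone-+ (cone-weaken (ℕ.n≤1+n 4) (at ψ-cone φ-cone)) (at φ-cone φ-cone)))
            (cone-+ (cone-+ (cone-+ (cone-+ xxφ-cone xxφ-cone) xxφ-cone)
              (cone-xx (proj₁ (proj₂ (R-lead m (ℕ.<⇒≤ lt)))))) (ω-cone (2 ℕ.+ m) lt))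
            where
            caφ  = at ca φ-cone
            cqaσ = cone-q (at ca σ-cone)

          -- For positive m, `d m` leads at 2m and q moves the leading exponents of `r m` up by one.
          -- For m = 0 no exponent is asked for.
          φ-leads : ∀ m → Shape m → LeadCone 2 (suc m) (λ t → 2 ℕ.+ t ℕ.≤ 2 ℕ.* suc m × ¬ t ≡ 0) (φ m)
          φ-leads zero    sh = cone⇒leadCone (cone-resp (sym (φ-split 0)) (cone-+ (d-cone 0) (cone-weaken (ℕ.n≤1+n 2) (cone-q (leadCone⇒cone sh)))))
            where
            cone⇒leadCone : ∀ {f} → Cone 2 1 f → LeadCone 2 1 (λ t → 2 ℕ.+ t ℕ.≤ 2 × ¬ t ≡ 0) f
            cone⇒leadCone (ms , e) = ms , e , λ { zero (_ , t≢0) → ⊥-elim (t≢0 ≡.refl) ; (suc t) (s≤s (s≤s ()) , _) }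
          φ-leads (suc m) sh = leadCone-resp (sym (φ-split (suc m)))
            (leadCone-lead (D (suc m)) (2 ℕ.* suc m) (D-pos m) (2n+2 (suc m))
              (leadCone-⊆ below (leadCone-weaken (ℕ.n≤1+n 2) (leadCone-q sh))))
            where
            below : ∀ t → (2 ℕ.+ t ℕ.≤ 2 ℕ.* suc (suc m) × ¬ t ≡ 0) × ¬ t ≡ 2 ℕ.* suc m →
                    ∃[ s ] t ≡ suc s × 2 ℕ.+ s ℕ.≤ 2 ℕ.* suc m
            below zero    ((_ , t≢0) , _) = ⊥-elim (t≢0 ≡.refl)
            below (suc s) ((le , _) , t≢) = s , ≡.refl ,
              ℕ.≤∧≢⇒< (ℕ.≤-pred (ℕ.≤-pred (subst (3 ℕ.+ s ℕ.≤_) (ℕ.*-suc 2 (suc m)) le))) t≢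

          -- As ν vanishes at excess 0, both end terms of the convolution drop out and the index
          -- falls by two.
          square : (ν ⊛ ν) (2 ℕ.+ m) ≈ aa + ((a ⊛ ψ) m + (a ⊛ ψ) m) + (ψ ⊛ ψ) m
          square = begin
            ν 0 * ν (2 ℕ.+ m) + (ν ∘ suc ⊛ ν) (suc m)
              ≈⟨ +-cong (trans (*-congʳ (ν₀ 0<N)) (zeroˡ _)) (⊛-suc (ν ∘ suc) ν m) ⟩
            0# + ((ν ∘ suc ⊛ ν ∘ suc) m + ν (2 ℕ.+ m) * ν 0)
              ≈⟨ trans (+-identityˡ _) (trans (+-congˡ (zero-sq (ν₀ 0<N))) (+-identityʳ _)) ⟩
            (ν ∘ suc ⊛ ν ∘ suc) m ≈⟨ ⊛-cong ν-split ν-split m ⟩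
            ((a ⊕ ψ) ⊛ (a ⊕ ψ)) m
              ≈⟨ solveₚ 2 (λ a p → (a :+ₚ p) :*ₚ (a :+ₚ p) :=ₚ a :*ₚ a :+ₚ (a :*ₚ p :+ₚ a :*ₚ p) :+ₚ p :*ₚ p) (λ _ → refl) a ψ m ⟩
            aa + ((a ⊛ ψ) m + (a ⊛ ψ) m) + (ψ ⊛ ψ) m ∎
            where
            0<N : 0 ℕ.< N
            0<N = ℕ.<-trans (s≤s z≤n) (ℕ.<-trans (s≤s (s≤s (z≤n {m}))) lt)
            open import Algebra.Solver.Ring.NaturalCoefficients.Default (CommutativeRing.commutativeSemiring fullRing)
              using () renaming (solve to solveₚ; _:+_ to _:+ₚ_; _:*_ to _:*ₚ_; _:=_ to _:=ₚ_)

          aφ-split : aφ ≈ ad + aσ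
          aφ-split = trans (⊛-cong {f = a} (λ _ → refl) φ-split m) (CommutativeRing.distribˡ fullRing a d σ m)

          -- Sorted by the exponent of p: 2m + 2, then 2m + 1, then everything below.
          quadratic : (q + q * q) * (ν ⊛ ν) (2 ℕ.+ m) ≈
                      q * (q * aa) + (q * aa + (q * ad + q * ad)) + ((aφ + aφ) + (q * aσ + q * aσ) + (ψφ + φφ))
          quadratic = begin
            (q + q * q) * (ν ⊛ ν) (2 ℕ.+ m) ≈⟨ *-congˡ square ⟩
            (q + q * q) * (aa + ((a ⊛ ψ) m + (a ⊛ ψ) m) + (ψ ⊛ ψ) m)
              ≈⟨ solve 4 (λ q s t u → (q :+ q :* q) :* (s :+ (t :+ t) :+ u) :=
                   q :* (q :* s) :+ (q :* s :+ (q :* (q :* t) :+ q :* (q :* t))) :+ ((q :* t :+ q :* t) :+ (q :* u :+ q :* (q :* u)))) refl q _ _ _ ⟩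
            q * (q * aa) + (q * aa + (q * (q * (a ⊛ ψ) m) + q * (q * (a ⊛ ψ) m))) + ((q * (a ⊛ ψ) m + q * (a ⊛ ψ) m) + (q * (ψ ⊛ ψ) m + q * (q * (ψ ⊛ ψ) m)))
              ≈⟨ +-cong (+-congˡ (+-congˡ (+-cong qaψ qaψ))) (+-cong (+-cong (conv-q a ψ m) (conv-q a ψ m)) (+-cong (conv-q ψ ψ m) qqψψ)) ⟩
            q * (q * aa) + (q * aa + (q * (ad + aσ) + q * (ad + aσ))) + ((aφ + aφ) + (ψφ + φφ))
              ≈⟨ solve 7 (λ q A s t u v w → q :* (q :* A) :+ (q :* A :+ (q :* (s :+ t) :+ q :* (s :+ t))) :+ (u :+ (v :+ w)) :=
                   q :* (q :* A) :+ (q :* A :+ (q :* s :+ q :* s)) :+ (u :+ (q :* t :+ q :* t) :+ (v :+ w))) refl q aa ad aσ (aφ + aφ) ψφ φφ ⟩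
            _ ∎
            where
            qaψ : q * (q * (a ⊛ ψ) m) ≈ q * (ad + aσ)
            qaψ = *-congˡ (trans (conv-q a ψ m) aφ-split)
            qqψψ : q * (q * (ψ ⊛ ψ) m) ≈ φφ
            qqψψ = trans (*-congˡ (conv-q ψ ψ m)) (trans (*-congˡ (⊛-comm ψ φ m)) (conv-q φ ψ m))

          q-lead : ∀ c → q * lead c (2 ℕ.+ m) (2 ℕ.* m) ≈ lead c (2 ℕ.+ m) (suc (2 ℕ.* m))
          q-lead c = lead-q c (2 ℕ.+ m) (2 ℕ.* m)

          aa-lead : aa ≈ lead (Cat (suc m)) (2 ℕ.+ m) (2 ℕ.* m)
          aa-lead = trans (lead-⊛ Cat Cat m) (reflexive (cong (λ c → lead c (2 ℕ.+ m) (2 ℕ.* m)) (≡.sym (SeriesRing.Cat-convolution m))))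

          qqaa : q * (q * aa) ≈ a (suc m)
          qqaa = trans (*-congˡ (trans (*-congˡ aa-lead) (q-lead (Cat (suc m)))))
            (trans (lead-q (Cat (suc m)) (2 ℕ.+ m) (suc (2 ℕ.* m))) (lead-cong {Cat (suc m)} {ξ = 2 ℕ.+ m} ≡.refl ≡.refl (≡.sym (ℕ.*-suc 2 m))))

          Λ : ℚ → Carrier
          Λ c = lead c (2 ℕ.+ m) (suc (2 ℕ.* m))
          Λ-+ : ∀ c d → Λ (c ℚ.+ d) ≈ Λ c + Λ d
          Λ-+ c d = lead-+ c d (2 ℕ.+ m) (suc (2 ℕ.* m))
          qaa : q * aa ≈ Λ (Cat (suc m))
          qaa = trans (*-congˡ aa-lead) (q-lead (Cat (suc m)))
          qad : q * ad ≈ Λ ((Cat *ₛ D) m)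
          qad = trans (*-congˡ (lead-⊛ Cat D m)) (q-lead ((Cat *ₛ D) m))
          xxqa : x * (x * (q * a m)) ≈ Λ (Cat m)
          xxqa = trans (*-congˡ (*-congˡ (lead-q (Cat m) (suc m) (2 ℕ.* m)))) (lead-xx (Cat m) (suc m) (suc (2 ℕ.* m)))

          -- The contributions to the exponent 2m + 1 from the quadratic part and from `R₀` add up
          -- by the recursion for `D`.
          τ-eq : (q * aa + (q * ad + q * ad)) + ((A + A) + (A + A)) ≈ τ (suc m)
          τ-eq = trans (+-cong (+-cong qaa (+-cong qad qad)) (+-cong (+-cong xxqa xxqa) (+-cong xxqa xxqa)))
            (sym (trans (reflexive (cong Λ (≡.sym (D-suc m))))
              (trans (Λ-+ _ _) (+-cong (trans (Λ-+ _ _) (+-congˡ (Λ-+ _ _))) (trans (Λ-+ _ _) (+-cong (Λ-+ _ _) (Λ-+ _ _)))))))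

          remainder : R₀ (2 ℕ.+ m) ≈ ((A + A) + (A + A)) + (lead 1ℚ (2 ℕ.+ m) 0 + (xxφ + (xxφ + xxφ + xxφ + x * (x * R°) + ω (2 ℕ.+ m))))
          remainder = begin
            R₀ (2 ℕ.+ m) ≈⟨ R-eq (suc m) lt ⟩
            x * (x * (0# + (v + v + (v + v) + R₀ (suc m)))) + ω (2 ℕ.+ m)
              ≈⟨ +-congʳ (*-congˡ (*-congˡ (+-congˡ (+-cong (+-cong (+-cong v-eq v-eq) (+-cong v-eq v-eq)) (proj₂ (proj₂ (R-lead m (ℕ.<⇒≤ lt)))))))) ⟩
            x * (x * (0# + (v′ + v′ + (v′ + v′) + (lead 1ℚ (suc m) 0 + R°)))) + ω (2 ℕ.+ m)
              ≈⟨ solve 6 (λ x A f l r o → x :* (x :* (con 0 :+ ((A :+ f) :+ (A :+ f) :+ ((A :+ f) :+ (A :+ f)) :+ (l :+ r)))) :+ o :=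
                   ((x :* (x :* A) :+ x :* (x :* A)) :+ (x :* (x :* A) :+ x :* (x :* A)))
                   :+ (x :* (x :* l) :+ (x :* (x :* f) :+ (x :* (x :* f) :+ x :* (x :* f) :+ x :* (x :* f) :+ x :* (x :* r) :+ o))))
                   refl x (q * a m) (φ m) (lead 1ℚ (suc m) 0) R° (ω (2 ℕ.+ m)) ⟩
            _ ≈⟨ +-congˡ (+-congʳ (lead-xx 1ℚ (suc m) 0)) ⟩
            _ ∎
            where
            v v′ : Carrier
            v  = q * ν (suc m)
            v′ = q * a m + φ m
            v-eq : v ≈ v′
            v-eq = trans (*-congˡ (ν-split m)) (distribˡ _ _ _)

          ν-expansion : ν (2 ℕ.+ m) ≈ (a (suc m) + τ (suc m)) + (lead 1ℚ (2 ℕ.+ m) 0 + (xxφ + Z))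
          ν-expansion = begin
            ν (2 ℕ.+ m) ≈⟨ ν-eq (2 ℕ.+ m) lt ⟩
            (q + q * q) * (ν ⊛ ν) (2 ℕ.+ m) + R₀ (2 ℕ.+ m) ≈⟨ +-cong quadratic remainder ⟩
            q * (q * aa) + T₁ + Z₁ + (T₂ + (l + (xxφ + Z₂)))
              ≈⟨ solve 7 (λ s t z t′ l x z′ → s :+ t :+ z :+ (t′ :+ (l :+ (x :+ z′))) := (s :+ (t :+ t′)) :+ (l :+ (x :+ (z :+ z′)))) refl _ T₁ Z₁ T₂ l xxφ Z₂ ⟩
            (q * (q * aa) + (T₁ + T₂)) + (l + (xxφ + (Z₁ + Z₂))) ≈⟨ +-congʳ (+-cong qqaa τ-eq) ⟩
            _ ∎
            where
            T₁ T₂ Z₁ Z₂ l : Carrier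
            T₁ = q * aa + (q * ad + q * ad)
            T₂ = (A + A) + (A + A)
            Z₁ = (aφ + aφ) + (q * aσ + q * aσ) + (ψφ + φφ)
            Z₂ = xxφ + xxφ + xxφ + x * (x * R°) + ω (2 ℕ.+ m)
            l  = lead 1ℚ (2 ℕ.+ m) 0

          r-eq : r (suc m) ≈ lead 1ℚ (2 ℕ.+ m) 0 + (xxφ + Z)
          r-eq = begin
            ν (2 ℕ.+ m) + - b ≈⟨ +-congʳ ν-expansion ⟩
            (b + t) + - b ≈⟨ +-congʳ (+-comm b t) ⟩
            (t + b) + - b ≈⟨ +-assoc t b (- b) ⟩
            t + (b + - b) ≈⟨ +-congˡ (-‿inverseʳ b) ⟩
            t + 0# ≈⟨ +-identityʳ t ⟩
            t ∎
            where
            b t : Carrier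
            b = a (suc m) + τ (suc m)
            t = lead 1ℚ (2 ℕ.+ m) 0 + (xxφ + Z)

        shapes : ∀ n → suc n ℕ.< N → ∀ i → i ℕ.≤ n → Shape i
        shapes zero    lt zero z≤n = shape-0 lt
        shapes (suc n) lt i    i≤  = split i (ℕ.m≤n⇒m<n∨m≡n i≤)
          where
          split : ∀ i → i ℕ.< suc n ⊎ i ≡ suc n → Shape i
          split i  (inj₁ (s≤s i≤n)) = shapes n (ℕ.<⇒≤ lt) i i≤n
          split ._ (inj₂ ≡.refl)    = shape-suc n lt (shapes n (ℕ.<⇒≤ lt))

      shape : ∀ n → suc n ℕ.< N → Shape n
      shape n lt = shapes n lt n ℕ.≤-refl

-- Tree walks recognised by exploring them step by step.

module WalkGraphs where

  open import Defs using (steps; Acyclic; Loopless; T; Covers; IsTreeWalk; covers⇒connected)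
  open import Level using (0ℓ)
  open import Data.Nat.Base using (ℕ; zero; suc; _≤_; s≤s; z≤n)
  open import Data.Fin.Base using (Fin; zero; suc)
  import Data.Fin.Properties as Fin
  open import Data.List.Base using (List; []; _∷_)
  import Data.List.Membership.Propositional as L
  import Data.List.Membership.DecPropositional as LDec
  open import Data.List.Relation.Unary.Any using (here; there)
  open import Data.Vec.Base as Vec using (Vec; []; _∷_; zip; _∷ʳ_)
  import Data.Vec.Membership.Propositional as V
  import Data.Vec.Membership.DecPropositional as VDec
  import Data.Vec.Relation.Unary.Any as VAny
  open import Data.Vec.Relation.Unary.All as All using (All; []; _∷_)
  open import Data.Vec.Relation.Unary.AllPairs using ([]; _∷_)
  open import Data.Vec.Relation.Unary.Unique.Propositional using (Unique)
  open import Data.Product using (_×_; _,_; uncurry; ∃-syntax; Σ-syntax)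
  open import Data.Product.Properties using (≡-dec)
  open import Data.Sum as Sum using (_⊎_; inj₁; inj₂)
  open import Data.Empty using (⊥-elim)
  open import Function using (_∘_; _⇔_; mk⇔)
  open import Relation.Nullary using (¬_; Dec; yes; no)
  open import Relation.Nullary.Decidable using (_×-dec_; _⊎-dec_; ¬?)
  open import Relation.Binary using (Rel)
  open import Relation.Binary.Construct.Closure.ReflexiveTransitive as Star using (Star; ε; _◅_; _◅◅_)
  open import Relation.Binary.PropositionalEquality using (_≡_; _≢_; refl; sym; trans)

  module Cycles {m : ℕ} where

    private
      Vertex : Set
      Vertex = Fin m

    infix 4 _⊑_
    _⊑_ : Rel Vertex 0ℓ → Rel Vertex 0ℓ → Set
    E ⊑ E′ = ∀ {u v} → E u v → E′ u v

    acyclic-⊑ : ∀ {E E′} → E ⊑ E′ → Acyclic E′ → Acyclic E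
    acyclic-⊑ E⊑ ac k c (uniq , all) = ac k c (uniq , All.map E⊑ all)

    segment : ∀ {n} → Vertex → Vec Vertex n → Vertex → Vec (Vertex × Vertex) (suc n)
    segment x xs y = zip (x ∷ xs) (xs ∷ʳ y)

    segment-src : ∀ {n} x (xs : Vec Vertex n) y {u v} → (u , v) V.∈ segment x xs y → u V.∈ x ∷ xs
    segment-src x []       y (VAny.here refl) = VAny.here refl
    segment-src x (z ∷ xs) y (VAny.here refl) = VAny.here refl
    segment-src x (z ∷ xs) y (VAny.there p)   = VAny.there (segment-src z xs y p)

    segment-tgt : ∀ {n} x (xs : Vec Vertex n) y {u v} → (u , v) V.∈ segment x xs y → v ≡ y ⊎ v V.∈ xs
    segment-tgt x []       y (VAny.here refl) = inj₁ refl
    segment-tgt x (z ∷ xs) y (VAny.here refl) = inj₂ (VAny.here refl)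
    segment-tgt x (z ∷ xs) y (VAny.there p)   = Sum.map₂ VAny.there (segment-tgt z xs y p)

    private
      ∉-≢ : ∀ {n} {xs : Vec Vertex n} {y z} → All (y ≢_) xs → z V.∈ xs → y ≢ z
      ∉-≢ (p ∷ ps) (VAny.here refl) = p
      ∉-≢ (p ∷ ps) (VAny.there q)   = ∉-≢ ps q

      last-pair : ∀ {n} x z (xs : Vec Vertex n) y → ∃[ p ] p V.∈ z ∷ xs × (p , y) V.∈ segment x (z ∷ xs) y
      last-pair x z []       y = z , VAny.here refl , VAny.there (VAny.here refl)
      last-pair x z (w ∷ xs) y with p , p∈ , q ← last-pair z w xs y = p , VAny.there p∈ , VAny.there q

      Neighbours : ∀ {n} → Vec (Vertex × Vertex) n → Vertex → Set
      Neighbours ps v = ∃[ p ] ∃[ s ] (p , v) V.∈ ps × (v , s) V.∈ ps × p ≢ s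

      -- A repetition p ≡ s could only be p ≡ x ≡ y ≡ s with a single vertex between.
      interior : ∀ {n} x (xs : Vec Vertex n) y → Unique (x ∷ xs) → ¬ y V.∈ xs → (n ≡ 1 → x ≢ y) →
                 ∀ {v} → v V.∈ xs → Neighbours (segment x xs y) v
      interior x (z ∷ [])     y uniq y∉ x≢y (VAny.here refl) =
        x , y , VAny.here refl , VAny.there (VAny.here refl) , x≢y refl
      interior x (z ∷ w ∷ xs) y ((_ ∷ x≢w ∷ _) ∷ _) y∉ x≢y (VAny.here refl) =
        x , w , VAny.here refl , VAny.there (VAny.here refl) , x≢w
      interior x (z ∷ xs)     y (_ ∷ uniq) y∉ x≢y (VAny.there v∈)
        with p , s , p∈ , s∈ , p≢s ← interior z xs y uniq (y∉ ∘ VAny.there) (λ _ → y∉ ∘ VAny.here ∘ sym) v∈ =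
        p , s , VAny.there p∈ , VAny.there s∈ , p≢s

    -- Serves to exclude vertices with a single neighbour from cycles.
    cycle-neighbours : ∀ {k} (c : Vec Vertex (suc (suc (suc k)))) → Unique c → ∀ {v} → v V.∈ c →
                       ∃[ p ] ∃[ s ] (p , v) V.∈ steps c × (v , s) V.∈ steps c × p ≢ s
    cycle-neighbours (x ∷ z ∷ w ∷ xs) (_ ∷ (z≢ ∷ _)) (VAny.here refl)
      with p , p∈ , q ← last-pair z w xs x =
      p , z , VAny.there q , VAny.here refl , ∉-≢ z≢ p∈ ∘ sym
    cycle-neighbours (x ∷ z ∷ w ∷ xs) uniq@(x≢ ∷ _) (VAny.there v∈) =
      interior x (z ∷ w ∷ xs) x uniq (λ x∈ → ∉-≢ x≢ x∈ refl) (λ ()) v∈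

    -- A cycle through v would give it two distinct neighbours, but c is the only one; a cycle
    -- avoiding v already lies in `E`.
    pendant : ∀ {E E′ : Rel Vertex 0ℓ} {c v} → Acyclic E → c ≢ v →
              (∀ u → ¬ E u v) → (∀ u → ¬ E v u) →
              (∀ {a b} → E′ a b → E a b ⊎ (a ≡ c × b ≡ v) ⊎ (a ≡ v × b ≡ c)) → Acyclic E′
    pendant {E} {E′} {c} {v} ac c≢v ¬Euv ¬Evu split k cyc (uniq , all)
      with VDec._∈?_ Fin._≟_ v cyc
    ... | yes v∈ with p , s , p∈ , s∈ , p≢s ← cycle-neighbours cyc uniq v∈ =
      p≢s (trans (pred p (All.lookup all p∈)) (sym (succ s (All.lookup all s∈))))
      where
      pred : ∀ p → E′ p v → p ≡ c
      pred p e with split e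
      ... | inj₁ Epv               = ⊥-elim (¬Euv p Epv)
      ... | inj₂ (inj₁ (eq , _))   = eq
      ... | inj₂ (inj₂ (_ , v≡c))  = ⊥-elim (c≢v (sym v≡c))
      succ : ∀ s → E′ v s → s ≡ c
      succ s e with split e
      ... | inj₁ Evs               = ⊥-elim (¬Evu s Evs)
      ... | inj₂ (inj₁ (v≡c , _))  = ⊥-elim (c≢v (sym v≡c))
      ... | inj₂ (inj₂ (_ , eq))   = eq
    ... | no v∉ = ac k cyc (uniq , all-∈ edges)
      where
      all-∈ : ∀ {n} {P : Vertex × Vertex → Set} {ps : Vec (Vertex × Vertex) n} →
              (∀ {e} → e V.∈ ps → P e) → All P ps
      all-∈ {ps = []}     f = []
      all-∈ {ps = p ∷ ps} f = f (VAny.here refl) ∷ all-∈ (f ∘ VAny.there)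
      in-cycle : ∀ {n} (c : Vec Vertex n) {a b} → (a , b) V.∈ steps c → a V.∈ c × b V.∈ c
      in-cycle (x ∷ xs) p = segment-src x xs x p , tgt (segment-tgt x xs x p)
        where
        tgt : ∀ {b} → b ≡ x ⊎ b V.∈ xs → b V.∈ x ∷ xs
        tgt (inj₁ refl) = VAny.here refl
        tgt (inj₂ q)    = VAny.there q
      edges : ∀ {e} → e V.∈ steps cyc → uncurry E e
      edges {a , b} e∈ with in-cycle cyc e∈ | split (All.lookup all e∈)
      ... | a∈ , b∈ | inj₁ Eab                = Eab
      ... | a∈ , b∈ | inj₂ (inj₁ (_ , refl)) = ⊥-elim (v∉ b∈)
      ... | a∈ , b∈ | inj₂ (inj₂ (refl , _)) = ⊥-elim (v∉ a∈)

    module _ (E : Rel Vertex 0ℓ) where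

      data Chain : ∀ {n} → Vertex → Vec Vertex n → Vertex → Set where
        []  : ∀ {x} → Chain x [] x
        _∷_ : ∀ {n x w y} {xs : Vec Vertex n} → E x w → Chain w xs y → Chain x (w ∷ xs) y

      SimplePath : Vertex → Vertex → Set
      SimplePath x y = ∃[ n ] Σ[ xs ∈ Vec Vertex n ] Unique (x ∷ xs) × Chain x xs y

      suffix : ∀ {n x y v} {xs : Vec Vertex n} → v V.∈ x ∷ xs → Unique (x ∷ xs) → Chain x xs y → SimplePath v y
      suffix (VAny.here refl)         uniq       ch       = _ , _ , uniq , ch
      suffix (VAny.there v∈@(VAny.here _))  (_ ∷ uniq) (_ ∷ ch) = suffix v∈ uniq ch
      suffix (VAny.there v∈@(VAny.there _)) (_ ∷ uniq) (_ ∷ ch) = suffix v∈ uniq ch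

      -- Loop erasure: if x recurs on the path, only the part from that recurrence on is kept.
      simplePath : ∀ {x y} → Star E x y → SimplePath x y
      simplePath ε = 0 , [] , [] ∷ [] , []
      simplePath {x} (_◅_ {j = w} e rest) with _ , xs , uniq , ch ← simplePath rest
        with VDec._∈?_ Fin._≟_ x (w ∷ xs)
      ... | yes x∈ = suffix x∈ uniq ch
      ... | no  x∉ = _ , w ∷ xs , fresh x∉ ∷ uniq , e ∷ ch
        where
        fresh : ∀ {n} {xs : Vec Vertex n} → ¬ x V.∈ xs → All (x ≢_) xs
        fresh {xs = []}     x∉ = []
        fresh {xs = z ∷ xs} x∉ = (x∉ ∘ VAny.here) ∷ fresh (x∉ ∘ VAny.there)

      close : ∀ {E′ : Rel Vertex 0ℓ} → E ⊑ E′ → ∀ {n x y t} {xs : Vec Vertex n} → Chain x xs y → E′ y t →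
              All (uncurry E′) (segment x xs t)
      close E⊑ []       e = e ∷ []
      close E⊑ (d ∷ ch) e = E⊑ d ∷ close E⊑ ch e

    -- A simple path from v to u of length at least two would be closed by the edge to a cycle, and
    -- one of length zero would make it a loop.
    chord : ∀ {E E′ : Rel Vertex 0ℓ} → E ⊑ E′ → Acyclic E′ → Loopless E′ → ∀ {u v} → Star E v u → E′ u v → E v u
    chord {E} E⊑ ac loopless path e with simplePath E path
    ... | zero          , []         , _    , []      = ⊥-elim (loopless _ e)
    ... | suc zero      , _ ∷ []     , _    , d ∷ []  = d
    ... | suc (suc k)   , xs         , uniq , ch      = ⊥-elim (ac k _ (uniq , close E E⊑ ch e))

  module Exploration {m : ℕ} (root : Fin m) where

    open Cycles {m}

    private
      Vertex : Set
      Vertex = Fin m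

    Adj : List (Vertex × Vertex) → Rel Vertex 0ℓ
    Adj es u v = (u , v) L.∈ es ⊎ (v , u) L.∈ es

    adj? : ∀ es u v → Dec (Adj es u v)
    adj? es u v = ((u , v) ∈? es) ⊎-dec ((v , u) ∈? es)
      where open LDec (≡-dec Fin._≟_ Fin._≟_) using (_∈?_)

    -- The walk has visited vis, discovered the edges es and is at cur.
    Accepts : ∀ {n} → List Vertex → List (Vertex × Vertex) → Vertex → Vec Vertex n → Set
    Accepts vis es cur []       = Adj es cur root × (∀ v → v L.∈ vis)
    Accepts vis es cur (v ∷ vs) = (v L.∈ vis × Adj es cur v × Accepts vis es v vs)
                                ⊎ (¬ v L.∈ vis × Accepts (v ∷ vis) ((cur , v) ∷ es) v vs)

    accepts? : ∀ {n} vis es cur (vs : Vec Vertex n) → Dec (Accepts vis es cur vs)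
    accepts? vis es cur []       = adj? es cur root ×-dec Fin.all? (λ v → LDec._∈?_ Fin._≟_ v vis)
    accepts? vis es cur (v ∷ vs) =
      (v∈? ×-dec adj? es cur v ×-dec accepts? vis es v vs)
      ⊎-dec (¬? v∈? ×-dec accepts? (v ∷ vis) ((cur , v) ∷ es) v vs)
      where
      v∈? : Dec (v L.∈ vis)
      v∈? = LDec._∈?_ Fin._≟_ v vis

    AdjV : ∀ {n} → Vec (Vertex × Vertex) n → Rel Vertex 0ℓ
    AdjV ps u v = (u , v) V.∈ ps ⊎ (v , u) V.∈ ps

    -- A step of the exploration moves an edge from the walk still ahead to the discovered ones and
    -- leaves this graph unchanged.
    Whole : ∀ {n} → List (Vertex × Vertex) → Vertex → Vec Vertex n → Rel Vertex 0ℓ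
    Whole es cur vs u v = Adj es u v ⊎ AdjV (segment cur vs root) u v

    -- The discovered edges form a tree on the visited vertices. Connectivity is directed at the
    -- current vertex, where the next edge starts.
    record Explored (vis : List Vertex) (es : List (Vertex × Vertex)) (cur : Vertex) : Set where
      field
        closed    : ∀ {u v} → Adj es u v → u L.∈ vis
        connected : ∀ {v} → v L.∈ vis → Star (Adj es) v cur
        acyclic   : Acyclic (Adj es)
        loopless  : Loopless (Adj es)
        cur∈      : cur L.∈ vis
        root∈     : root L.∈ vis

    private
      whole-old : ∀ {n} {es cur v} {vs : Vec Vertex n} → Adj es cur v → Whole es cur (v ∷ vs) ⊑ Whole es v vs
      whole-old adj (inj₁ e)                             = inj₁ e
      whole-old adj (inj₂ (inj₁ (VAny.here refl))) = inj₁ adj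
      whole-old adj (inj₂ (inj₁ (VAny.there p)))   = inj₂ (inj₁ p)
      whole-old adj (inj₂ (inj₂ (VAny.here refl))) = inj₁ (Sum.swap adj)
      whole-old adj (inj₂ (inj₂ (VAny.there p)))   = inj₂ (inj₂ p)

      whole-old⁻ : ∀ {n} {es cur v} {vs : Vec Vertex n} → Whole es v vs ⊑ Whole es cur (v ∷ vs)
      whole-old⁻ (inj₁ e)        = inj₁ e
      whole-old⁻ (inj₂ (inj₁ p)) = inj₂ (inj₁ (VAny.there p))
      whole-old⁻ (inj₂ (inj₂ p)) = inj₂ (inj₂ (VAny.there p))

      whole-new : ∀ {n} {es cur v} {vs : Vec Vertex n} → Whole es cur (v ∷ vs) ⊑ Whole ((cur , v) ∷ es) v vs
      whole-new (inj₁ (inj₁ p))                    = inj₁ (inj₁ (there p))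
      whole-new (inj₁ (inj₂ p))                    = inj₁ (inj₂ (there p))
      whole-new (inj₂ (inj₁ (VAny.here refl))) = inj₁ (inj₁ (here refl))
      whole-new (inj₂ (inj₁ (VAny.there p)))   = inj₂ (inj₁ p)
      whole-new (inj₂ (inj₂ (VAny.here refl))) = inj₁ (inj₂ (here refl))
      whole-new (inj₂ (inj₂ (VAny.there p)))   = inj₂ (inj₂ p)

      whole-new⁻ : ∀ {n} {es cur v} {vs : Vec Vertex n} → Whole ((cur , v) ∷ es) v vs ⊑ Whole es cur (v ∷ vs)
      whole-new⁻ (inj₁ (inj₁ (here refl))) = inj₂ (inj₁ (VAny.here refl))
      whole-new⁻ (inj₁ (inj₁ (there p)))   = inj₁ (inj₁ p)
      whole-new⁻ (inj₁ (inj₂ (here refl))) = inj₂ (inj₂ (VAny.here refl))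
      whole-new⁻ (inj₁ (inj₂ (there p)))   = inj₁ (inj₂ p)
      whole-new⁻ (inj₂ (inj₁ p))           = inj₂ (inj₁ (VAny.there p))
      whole-new⁻ (inj₂ (inj₂ p))           = inj₂ (inj₂ (VAny.there p))

      move : ∀ {vis es cur v} → Explored vis es cur → v L.∈ vis → Adj es cur v → Explored vis es v
      move ex v∈ adj = record
        { closed = closed ; connected = λ u∈ → connected u∈ ◅◅ (adj ◅ ε) ; acyclic = acyclic
        ; loopless = loopless ; cur∈ = v∈ ; root∈ = root∈ }
        where open Explored ex

      discover : ∀ {vis es cur v} → Explored vis es cur → ¬ v L.∈ vis → Explored (v ∷ vis) ((cur , v) ∷ es) v
      discover {vis} {es} {cur} {v} ex v∉ = record
        { closed    = λ { (inj₁ (here refl)) → there cur∈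
                        ; (inj₂ (here refl)) → here refl
                        ; (inj₁ (there p))   → there (closed (inj₁ p))
                        ; (inj₂ (there p))   → there (closed (inj₂ p)) }
        ; connected = λ { (here refl) → ε
                        ; (there u∈)  → Star.map (Sum.map there there) (connected u∈) ◅◅ (inj₁ (here refl) ◅ ε) }
        ; acyclic   = pendant acyclic cur≢v (λ u e → v∉ (closed (Sum.swap e))) (λ u e → v∉ (closed e))
                        λ { (inj₁ (here refl)) → inj₂ (inj₁ (refl , refl))
                          ; (inj₂ (here refl)) → inj₂ (inj₂ (refl , refl))
                          ; (inj₁ (there p))   → inj₁ (inj₁ p)
                          ; (inj₂ (there p))   → inj₁ (inj₂ p) }
        ; loopless  = λ { u (inj₁ (here refl)) → v∉ cur∈
                        ; u (inj₂ (here refl)) → v∉ cur∈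
                        ; u (inj₁ (there p))   → loopless u (inj₁ p)
                        ; u (inj₂ (there p))   → loopless u (inj₂ p) }
        ; cur∈ = here refl ; root∈ = there root∈ }
        where
        open Explored ex
        cur≢v : cur ≢ v
        cur≢v refl = v∉ cur∈

    Good : ∀ {n} → List Vertex → List (Vertex × Vertex) → Vertex → Vec Vertex n → Set
    Good vis es cur vs = Loopless (Whole es cur vs) × Acyclic (Whole es cur vs) × (∀ v → v L.∈ vis ⊎ v V.∈ vs)

    accepts⇒good : ∀ {n} {vis es cur} (vs : Vec Vertex n) → Explored vis es cur → Accepts vis es cur vs → Good vis es cur vs
    accepts⇒good {es = es} {cur} [] ex (adj , cov) =
      (λ u w → loopless u (absorb w)) , acyclic-⊑ absorb acyclic , inj₁ ∘ cov
      where
      open Explored ex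
      absorb : Whole es cur [] ⊑ Adj es
      absorb (inj₁ e)                             = e
      absorb (inj₂ (inj₁ (VAny.here refl))) = adj
      absorb (inj₂ (inj₂ (VAny.here refl))) = Sum.swap adj
    accepts⇒good (v ∷ vs) ex (inj₁ (v∈ , adj , acc)) with ll , ac , cov ← accepts⇒good vs (move ex v∈ adj) acc =
      (λ u → ll u ∘ whole-old adj) , acyclic-⊑ (whole-old adj) ac , Sum.map₂ VAny.there ∘ cov
    accepts⇒good {vis = vis} (v ∷ vs) ex (inj₂ (v∉ , acc)) with ll , ac , cov ← accepts⇒good vs (discover ex v∉) acc =
      (λ u → ll u ∘ whole-new) , acyclic-⊑ whole-new ac , λ u → shift (cov u)
      where
      shift : ∀ {u} → u L.∈ v ∷ vis ⊎ u V.∈ vs → u L.∈ vis ⊎ u V.∈ v ∷ vs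
      shift (inj₁ (here refl)) = inj₂ (VAny.here refl)
      shift (inj₁ (there p))   = inj₁ p
      shift (inj₂ q)           = inj₂ (VAny.there q)

    -- A step to a visited vertex joins two vertices connected in the explored tree, so by `chord`
    -- it is a discovered edge. The same argument settles the closing step to the root.
    good⇒accepts : ∀ {n} {vis es cur} (vs : Vec Vertex n) → Explored vis es cur → Good vis es cur vs → Accepts vis es cur vs
    good⇒accepts {vis = vis} [] ex (ll , ac , cov) =
      Sum.swap (chord inj₁ ac ll (connected root∈) (inj₂ (inj₁ (VAny.here refl)))) , λ v → all (cov v)
      where
      open Explored ex
      all : ∀ {v} → v L.∈ vis ⊎ v V.∈ [] → v L.∈ vis
      all (inj₁ p) = p
    good⇒accepts {vis = vis} {es} {cur} (v ∷ vs) ex (ll , ac , cov) with LDec._∈?_ Fin._≟_ v vis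
    ... | yes v∈ = inj₁ (v∈ , adj , good⇒accepts vs (move ex v∈ adj)
            ((λ u → ll u ∘ whole-old⁻) , acyclic-⊑ whole-old⁻ ac , λ u → shift (cov u)))
      where
      open Explored ex
      adj : Adj es cur v
      adj = Sum.swap (chord inj₁ ac ll (connected v∈) (inj₂ (inj₁ (first vs))))
        where
        first : ∀ {n} (vs : Vec Vertex n) → (cur , v) V.∈ segment cur (v ∷ vs) root
        first vs = VAny.here refl
      shift : ∀ {u} → u L.∈ vis ⊎ u V.∈ v ∷ vs → u L.∈ vis ⊎ u V.∈ vs
      shift (inj₁ p)                  = inj₁ p
      shift (inj₂ (VAny.here refl)) = inj₁ v∈
      shift (inj₂ (VAny.there q))   = inj₂ q
    ... | no  v∉ = inj₂ (v∉ , good⇒accepts vs (discover ex v∉)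
            ((λ u → ll u ∘ whole-new⁻) , acyclic-⊑ whole-new⁻ ac , λ u → shift (cov u)))
      where
      shift : ∀ {u} → u L.∈ vis ⊎ u V.∈ v ∷ vs → u L.∈ v ∷ vis ⊎ u V.∈ vs
      shift (inj₁ p)                  = inj₁ (there p)
      shift (inj₂ (VAny.here refl)) = inj₁ (here refl)
      shift (inj₂ (VAny.there q))   = inj₂ q

    start : Explored (root ∷ []) [] root
    start = record
      { closed = λ { (inj₁ ()) ; (inj₂ ()) } ; connected = λ { (here refl) → ε }
      ; acyclic = λ { k (x ∷ y ∷ c) (_ , inj₁ () ∷ _) ; k (x ∷ y ∷ c) (_ , inj₂ () ∷ _) }
      ; loopless = λ { v (inj₁ ()) ; v (inj₂ ()) } ; cur∈ = here refl ; root∈ = here refl }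

    treeWalk⇔accepts : ∀ {n} (vs : Vec Vertex n) → IsTreeWalk (root ∷ vs) ⇔ Accepts (root ∷ []) [] root vs
    treeWalk⇔accepts vs = mk⇔ to from
      where
      to : IsTreeWalk (root ∷ vs) → Accepts (root ∷ []) [] root vs
      to (inj₂ (cov , _ , ll , _ , ac)) = good⇒accepts vs start
        ((λ u → ll u ∘ only) , acyclic-⊑ only ac , λ u → split (cov u))
        where
        only : Whole [] root vs ⊑ T (root ∷ vs)
        only (inj₁ (inj₁ ()))
        only (inj₁ (inj₂ ()))
        only (inj₂ t) = t
        split : ∀ {u} → u V.∈ root ∷ vs → u L.∈ root ∷ [] ⊎ u V.∈ vs
        split (VAny.here refl) = inj₁ (here refl)
        split (VAny.there q)   = inj₂ q
      from : Accepts (root ∷ []) [] root vs → IsTreeWalk (root ∷ vs)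
      from acc with ll , ac , cov ← accepts⇒good vs start acc =
        inj₂ (covers , 1≤ root , (λ u → ll u ∘ inj₂) , covers⇒connected (root ∷ vs) covers , acyclic-⊑ inj₂ ac)
        where
        1≤ : ∀ {m} → Fin m → 1 ≤ m
        1≤ zero    = s≤s z≤n
        1≤ (suc i) = s≤s z≤n
        covers : Covers (root ∷ vs)
        covers u with cov u
        ... | inj₁ (here refl) = VAny.here refl
        ... | inj₂ q           = VAny.there q

-- Counting with sums over lists; labels and edges of a zipper.

module LabelledForests where

  open ForestWalks using (Tree; node; Frame; selections)
  open CatalanSeries using (module Rationals)
  open import Defs using (fromℕ; allVecs)
  open import Data.Nat.Base as ℕ using (ℕ; zero; suc)
  import Data.Nat.Properties as ℕ
  open import Data.Rational.Base as ℚ using (ℚ; 0ℚ; 1ℚ)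
  import Data.Rational.Properties as ℚ
  import Data.Rational.Solver as ℚSolver
  open import Data.Fin.Base using (Fin; zero; suc)
  open import Data.List.Base as List using (List; []; _∷_; _++_; map; length; filter)
  open import Data.Nat.ListAction using (sum)
  import Data.List.Properties as List
  open import Data.List.Membership.Propositional using (_∈_; _∉_)
  open import Data.List.Membership.Propositional.Properties
    using (∈-++⁺ˡ; ∈-++⁺ʳ; ∈-++⁻; ∈-map⁻)
  open import Data.List.Relation.Binary.Permutation.Propositional as Perm
    using (_↭_; refl; prep; swap; trans; ↭-refl; ↭-sym; ↭-trans)
  open import Data.List.Relation.Binary.Permutation.Propositional.Properties as Perm
    using (++⁺ˡ; ++⁺ʳ; shifts; ++-commutativeMonoid)
  open import Data.List.Relation.Unary.All as All using (All; []; _∷_)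
  import Data.List.Relation.Unary.All.Properties as All
  open import Data.List.Relation.Unary.AllPairs using ([]; _∷_)
  open import Data.List.Relation.Unary.Any using (here; there)
  open import Data.List.Relation.Unary.Unique.Propositional using (Unique)
  open import Data.Vec.Base using (Vec; []; _∷_)
  open import Data.Product using (_×_; _,_; proj₁; ∃-syntax)
  open import Data.Sum using (_⊎_; inj₁; inj₂)
  open import Data.Empty using (⊥-elim)
  open import Function using (_∘_)
  open import Relation.Nullary using (¬_; yes; no)
  open import Relation.Unary using (Decidable)
  open import Relation.Binary.PropositionalEquality as ≡ using (_≡_; cong; cong₂; module ≡-Reasoning)
  import Algebra.Solver.CommutativeMonoid

  unique-↭ : ∀ {A : Set} {xs ys : List A} → xs ↭ ys → Unique xs → Unique ys
  unique-↭ refl         u                        = u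
  unique-↭ (prep x p)   (x∉ ∷ u)                 = Perm.All-resp-↭ p x∉ ∷ unique-↭ p u
  unique-↭ (swap x y p) ((x≢y ∷ x∉) ∷ y∉ ∷ u) =
    ((x≢y ∘ ≡.sym) ∷ Perm.All-resp-↭ p y∉) ∷ Perm.All-resp-↭ p x∉ ∷ unique-↭ p u
  unique-↭ (trans p q)  u                        = unique-↭ q (unique-↭ p u)

  unique-disjoint : ∀ {A : Set} (xs : List A) {ys v} → Unique (xs ++ ys) → v ∈ xs → v ∉ ys
  unique-disjoint (x ∷ xs) (x∉ ∷ u) (here ≡.refl) v∈ = All.lookup x∉ (∈-++⁺ʳ xs v∈) ≡.refl
  unique-disjoint (x ∷ xs) (x∉ ∷ u) (there p)     v∈ = unique-disjoint xs u p v∈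

  module Counts where

    length-filter-⇔ : ∀ {A : Set} {P Q : A → Set} (P? : Decidable P) (Q? : Decidable Q) →
                      (∀ x → P x → Q x) → (∀ x → Q x → P x) → ∀ xs → length (filter P? xs) ≡ length (filter Q? xs)
    length-filter-⇔ P? Q? to from []       = ≡.refl
    length-filter-⇔ P? Q? to from (x ∷ xs) with P? x | Q? x
    ... | yes p | yes q = cong suc (length-filter-⇔ P? Q? to from xs)
    ... | yes p | no ¬q = ⊥-elim (¬q (to x p))
    ... | no ¬p | yes q = ⊥-elim (¬p (from x q))
    ... | no ¬p | no ¬q = length-filter-⇔ P? Q? to from xs

    length-filter-none : ∀ {A : Set} {P : A → Set} (P? : Decidable P) → (∀ x → ¬ P x) → ∀ xs → length (filter P? xs) ≡ 0
    length-filter-none P? none []       = ≡.refl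
    length-filter-none P? none (x ∷ xs) with P? x
    ... | yes p = ⊥-elim (none x p)
    ... | no ¬p = length-filter-none P? none xs

    length-filter-map : ∀ {A B : Set} {P : B → Set} (P? : Decidable P) (f : A → B) xs →
                        length (filter P? (map f xs)) ≡ length (filter (P? ∘ f) xs)
    length-filter-map P? f []       = ≡.refl
    length-filter-map P? f (x ∷ xs) with P? (f x)
    ... | yes p = cong suc (length-filter-map P? f xs)
    ... | no ¬p = length-filter-map P? f xs

    length-filter-allVecs : ∀ {A : Set} n {P : Vec A (suc n) → Set} (P? : Decidable P) (xs : List A) →
      length (filter P? (allVecs xs (suc n))) ≡ sum (map (λ x → length (filter (P? ∘ (x ∷_)) (allVecs xs n))) xs)
    length-filter-allVecs n P? xs = go xs
      where
      vs = allVecs xs n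
      go : ∀ ys → length (filter P? (List.cartesianProductWith _∷_ ys vs)) ≡ sum (map (λ x → length (filter (P? ∘ (x ∷_)) vs)) ys)
      go []       = ≡.refl
      go (y ∷ ys) = begin
        length (filter P? (map (y ∷_) vs ++ zs)) ≡⟨ cong length (List.filter-++ P? (map (y ∷_) vs) zs) ⟩
        length (filter P? (map (y ∷_) vs) ++ filter P? zs) ≡⟨ List.length-++ (filter P? (map (y ∷_) vs)) ⟩
        length (filter P? (map (y ∷_) vs)) ℕ.+ length (filter P? zs)
          ≡⟨ cong₂ ℕ._+_ (length-filter-map P? (y ∷_) vs) (go ys) ⟩
        _ ∎
        where
        open ≡-Reasoning
        zs = List.cartesianProductWith _∷_ ys vs

    Σℚ : ∀ {A : Set} → (A → ℚ) → List A → ℚ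
    Σℚ F []       = 0ℚ
    Σℚ F (x ∷ xs) = F x ℚ.+ Σℚ F xs

    fromℕ-sum : ∀ {A : Set} (F : A → ℕ) xs → fromℕ (sum (map F xs)) ≡ Σℚ (fromℕ ∘ F) xs
    fromℕ-sum F []       = ≡.refl
    fromℕ-sum F (x ∷ xs) = ≡.trans (Rationals.fromℕ-+ (F x) _) (cong (fromℕ (F x) ℚ.+_) (fromℕ-sum F xs))

    Σℚ-++ : ∀ {A : Set} (F : A → ℚ) xs ys → Σℚ F (xs ++ ys) ≡ Σℚ F xs ℚ.+ Σℚ F ys
    Σℚ-++ F []       ys = ≡.sym (ℚ.+-identityˡ _)
    Σℚ-++ F (x ∷ xs) ys = ≡.trans (cong (F x ℚ.+_) (Σℚ-++ F xs ys)) (≡.sym (ℚ.+-assoc (F x) _ _))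

    Σℚ-↭ : ∀ {A : Set} (F : A → ℚ) {xs ys} → xs ↭ ys → Σℚ F xs ≡ Σℚ F ys
    Σℚ-↭ F refl         = ≡.refl
    Σℚ-↭ F (prep x p)   = cong (F x ℚ.+_) (Σℚ-↭ F p)
    Σℚ-↭ F (swap {xs} {ys} x y p) = begin
      F x ℚ.+ (F y ℚ.+ Σℚ F xs) ≡⟨ ℚ.+-assoc (F x) (F y) _ ⟨
      F x ℚ.+ F y ℚ.+ Σℚ F xs   ≡⟨ cong₂ ℚ._+_ (ℚ.+-comm (F x) (F y)) (Σℚ-↭ F p) ⟩
      F y ℚ.+ F x ℚ.+ Σℚ F ys   ≡⟨ ℚ.+-assoc (F y) (F x) _ ⟩
      F y ℚ.+ (F x ℚ.+ Σℚ F ys) ∎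
      where open ≡-Reasoning
    Σℚ-↭ F (trans p q)  = ≡.trans (Σℚ-↭ F p) (Σℚ-↭ F q)

    Σℚ-const : ∀ {A : Set} (F : A → ℚ) c xs → (∀ x → x ∈ xs → F x ≡ c) → Σℚ F xs ≡ fromℕ (length xs) ℚ.* c
    Σℚ-const F c []       h = ≡.sym (ℚ.*-zeroˡ c)
    Σℚ-const F c (x ∷ xs) h = begin
      F x ℚ.+ Σℚ F xs ≡⟨ cong₂ ℚ._+_ (h x (here ≡.refl)) (Σℚ-const F c xs (λ y y∈ → h y (there y∈))) ⟩
      c ℚ.+ fromℕ (length xs) ℚ.* c
        ≡⟨ solve 2 (λ c k → c :+ k :* c := (con 1ℚ :+ k) :* c) ≡.refl c (fromℕ (length xs)) ⟩
      (1ℚ ℚ.+ fromℕ (length xs)) ℚ.* c ≡⟨ cong (ℚ._* c) (Rationals.fromℕ-suc (length xs)) ⟨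
      fromℕ (suc (length xs)) ℚ.* c ∎
      where
      open ≡-Reasoning
      open ℚSolver.+-*-Solver

    Σℚ-zero : ∀ {A : Set} (F : A → ℚ) xs → (∀ x → x ∈ xs → F x ≡ 0ℚ) → Σℚ F xs ≡ 0ℚ
    Σℚ-zero F xs h = ≡.trans (Σℚ-const F 0ℚ xs h) (ℚ.*-zeroʳ (fromℕ (length xs)))

  module Zippers {X : Set} where

    rootLabel : Tree X → X
    rootLabel (node v _) = v

    mutual
      labelsT : Tree X → List X
      labelsT (node v cs) = v ∷ labelsF cs

      labelsF : List (Tree X) → List X
      labelsF []       = []
      labelsF (t ∷ ts) = labelsT t ++ labelsF ts

    mutual
      edgesT : X → Tree X → List (X × X)
      edgesT p (node v cs) = (p , v) ∷ edgesF v cs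

      edgesF : X → List (Tree X) → List (X × X)
      edgesF p []       = []
      edgesF p (t ∷ ts) = edgesT p t ++ edgesF p ts

    labelsR : List (Frame X) → List X
    labelsR []             = []
    labelsR ((l , f) ∷ fs) = l ∷ labelsF f ++ labelsR fs

    edgesR : X → List (Frame X) → List (X × X)
    edgesR l []               = []
    edgesR l ((l₁ , f₁) ∷ fs) = (l₁ , l) ∷ edgesF l₁ f₁ ++ edgesR l₁ fs

    labels : Frame X → List (Frame X) → List X
    labels x fs = labelsR (x ∷ fs)

    edges : Frame X → List (Frame X) → List (X × X)
    edges (l , f) fs = edgesF l f ++ edgesR l fs

    rootOf : Frame X → List (Frame X) → X
    rootOf (l , _) []       = l
    rootOf _       (x ∷ fs) = rootOf x fs

    labelsF-↭ : ∀ {f g} → f ↭ g → labelsF f ↭ labelsF g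
    labelsF-↭ refl         = ↭-refl
    labelsF-↭ (prep t p)   = ++⁺ˡ (labelsT t) (labelsF-↭ p)
    labelsF-↭ (swap s t p) = ↭-trans (++⁺ˡ (labelsT s) (++⁺ˡ (labelsT t) (labelsF-↭ p))) (shifts (labelsT s) (labelsT t))
    labelsF-↭ (trans p q)  = ↭-trans (labelsF-↭ p) (labelsF-↭ q)

    edgesF-↭ : ∀ l {f g} → f ↭ g → edgesF l f ↭ edgesF l g
    edgesF-↭ l refl         = ↭-refl
    edgesF-↭ l (prep t p)   = ++⁺ˡ (edgesT l t) (edgesF-↭ l p)
    edgesF-↭ l (swap s t p) = ↭-trans (++⁺ˡ (edgesT l s) (++⁺ˡ (edgesT l t) (edgesF-↭ l p))) (shifts (edgesT l s) (edgesT l t))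
    edgesF-↭ l (trans p q)  = ↭-trans (edgesF-↭ l p) (edgesF-↭ l q)

    private
      module SolverX  = Algebra.Solver.CommutativeMonoid (++-commutativeMonoid {A = X})
      module SolverXX = Algebra.Solver.CommutativeMonoid (++-commutativeMonoid {A = X × X})

    labels-up : ∀ l f l₁ f₁ fs → labels (l , f) ((l₁ , f₁) ∷ fs) ↭ labels (l₁ , node l f ∷ f₁) fs
    labels-up l f l₁ f₁ fs =
      solve 5 (λ l a l₁ b c → l ⊕ (a ⊕ (l₁ ⊕ (b ⊕ c))) ⊜ l₁ ⊕ (((l ⊕ a) ⊕ b) ⊕ c)) ↭-refl
        (l ∷ []) (labelsF f) (l₁ ∷ []) (labelsF f₁) (labelsR fs)
      where open SolverX

    edges-up : ∀ l f l₁ f₁ fs → edges (l , f) ((l₁ , f₁) ∷ fs) ↭ edges (l₁ , node l f ∷ f₁) fs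
    edges-up l f l₁ f₁ fs =
      solve 4 (λ e a b c → a ⊕ (e ⊕ (b ⊕ c)) ⊜ ((e ⊕ a) ⊕ b) ⊕ c) ↭-refl
        ((l₁ , l) ∷ []) (edgesF l f) (edgesF l₁ f₁) (edgesR l₁ fs)
      where open SolverXX

    selections-↭ : ∀ {A : Set} (xs : List A) {y ys} → (y , ys) ∈ selections xs → xs ↭ y ∷ ys
    selections-↭ (x ∷ xs) (here ≡.refl) = ↭-refl
    selections-↭ (x ∷ xs) (there p) with (y , ys) , q , ≡.refl ← ∈-map⁻ _ p =
      ↭-trans (prep x (selections-↭ xs q)) (swap x y ↭-refl)

    labels-down : ∀ l f fs {v cs ts} → (node v cs , ts) ∈ selections f → labels (l , f) fs ↭ labels (v , cs) ((l , ts) ∷ fs)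
    labels-down l f fs {v} {cs} {ts} p = ↭-trans
      (prep l (++⁺ʳ (labelsR fs) (labelsF-↭ (selections-↭ f p)))) (↭-sym (labels-up v cs l ts fs))

    edges-down : ∀ l f fs {v cs ts} → (node v cs , ts) ∈ selections f → edges (l , f) fs ↭ edges (v , cs) ((l , ts) ∷ fs)
    edges-down l f fs {v} {cs} {ts} p = ↭-trans
      (++⁺ʳ (edgesR l fs) (edgesF-↭ l (selections-↭ f p))) (↭-sym (edges-up v cs l ts fs))

    roots : List (Tree X) → List X
    roots = map rootLabel

    parent : List (Frame X) → List X
    parent []             = []
    parent ((l , _) ∷ _) = l ∷ []

    roots-selections : ∀ f → map (rootLabel ∘ proj₁) (selections f) ≡ roots f
    roots-selections []       = ≡.refl
    roots-selections (t ∷ ts) = cong (rootLabel t ∷_) (≡.trans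
      (≡.sym (List.map-∘ {g = rootLabel ∘ proj₁} {f = λ (y , ys) → y , t ∷ ys} (selections ts))) (roots-selections ts))

    nonRoots : List (Tree X) → List X
    nonRoots []               = []
    nonRoots (node _ cs ∷ ts) = labelsF cs ++ nonRoots ts

    -- The visited vertices that are not adjacent to the current one, itself included.
    distant : Frame X → List (Frame X) → List X
    distant (l , f) []             = l ∷ nonRoots f
    distant (l , f) ((_ , f₁) ∷ fs) = l ∷ nonRoots f ++ labelsF f₁ ++ labelsR fs

    labels-neighbours : ∀ l f fs → labels (l , f) fs ↭ (roots f ++ parent fs) ++ distant (l , f) fs
    labels-neighbours l f fs = ↭-trans (prep l (++⁺ʳ (labelsR fs) (split f))) (go fs)
      where
      open SolverX
      split : ∀ f → labelsF f ↭ roots f ++ nonRoots f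
      split []               = ↭-refl
      split (node v cs ∷ ts) = ↭-trans (prep v (++⁺ˡ (labelsF cs) (split ts))) (prep v (shifts (labelsF cs) (roots ts)))
      go : ∀ fs → l ∷ (roots f ++ nonRoots f) ++ labelsR fs ↭ (roots f ++ parent fs) ++ distant (l , f) fs
      go [] = solve 3 (λ l r n → l ⊕ ((r ⊕ n) ⊕ id) ⊜ (r ⊕ id) ⊕ (l ⊕ n)) ↭-refl (l ∷ []) (roots f) (nonRoots f)
      go ((l₁ , f₁) ∷ fs) = solve 6 (λ l r n l₁ a b → l ⊕ ((r ⊕ n) ⊕ (l₁ ⊕ (a ⊕ b))) ⊜ (r ⊕ l₁) ⊕ (l ⊕ (n ⊕ (a ⊕ b)))) ↭-refl
        (l ∷ []) (roots f) (nonRoots f) (l₁ ∷ []) (labelsF f₁) (labelsR fs)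

    edgesF-src : ∀ p f {u v} → (u , v) ∈ edgesF p f → (u ≡ p × v ∈ roots f) ⊎ u ∈ labelsF f
    edgesF-src p (node r cs ∷ ts) e with ∈-++⁻ (edgesT p (node r cs)) e
    ... | inj₁ (here ≡.refl) = inj₁ (≡.refl , here ≡.refl)
    ... | inj₁ (there e′) with edgesF-src r cs e′
    ...   | inj₁ (≡.refl , _) = inj₂ (here ≡.refl)
    ...   | inj₂ q            = inj₂ (there (∈-++⁺ˡ q))
    edgesF-src p (node r cs ∷ ts) e | inj₂ e′ with edgesF-src p ts e′
    ... | inj₁ (u≡ , q) = inj₁ (u≡ , there q)
    ... | inj₂ q        = inj₂ (there (∈-++⁺ʳ (labelsF cs) q))

    edgesF-tgt : ∀ p f {u v} → (u , v) ∈ edgesF p f → v ∈ labelsF f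
    edgesF-tgt p (node r cs ∷ ts) e with ∈-++⁻ (edgesT p (node r cs)) e
    ... | inj₁ (here ≡.refl) = here ≡.refl
    ... | inj₁ (there e′)    = there (∈-++⁺ˡ (edgesF-tgt r cs e′))
    ... | inj₂ e′            = there (∈-++⁺ʳ (labelsF cs) (edgesF-tgt p ts e′))

    edgesR-src : ∀ l fs {u v} → (u , v) ∈ edgesR l fs → u ∈ labelsR fs
    edgesR-src l ((l₁ , f₁) ∷ fs) (here ≡.refl) = here ≡.refl
    edgesR-src l ((l₁ , f₁) ∷ fs) (there e) with ∈-++⁻ (edgesF l₁ f₁) e
    ... | inj₂ e′ = there (∈-++⁺ʳ (labelsF f₁) (edgesR-src l₁ fs e′))
    ... | inj₁ e′ with edgesF-src l₁ f₁ e′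
    ...   | inj₁ (≡.refl , _) = here ≡.refl
    ...   | inj₂ q            = there (∈-++⁺ˡ q)

    edgesR-tgt : ∀ l fs {u v} → (u , v) ∈ edgesR l fs → (v ≡ l × u ∈ parent fs) ⊎ v ∈ labelsR fs
    edgesR-tgt l ((l₁ , f₁) ∷ fs) (here ≡.refl) = inj₁ (≡.refl , here ≡.refl)
    edgesR-tgt l ((l₁ , f₁) ∷ fs) (there e) with ∈-++⁻ (edgesF l₁ f₁) e
    ... | inj₁ e′ = inj₂ (there (∈-++⁺ˡ (edgesF-tgt l₁ f₁ e′)))
    ... | inj₂ e′ with edgesR-tgt l₁ fs e′
    ...   | inj₁ (≡.refl , _) = inj₂ (here ≡.refl)
    ...   | inj₂ q            = inj₂ (there (∈-++⁺ʳ (labelsF f₁) q))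

    Incident : List (X × X) → X → X → Set
    Incident es u v = (u , v) ∈ es ⊎ (v , u) ∈ es

    -- Labels are distinct, so l occurs only in the edges to its children and to its parent.
    incident⇒neighbour : ∀ l f fs → Unique (labels (l , f) fs) → ∀ {v} →
                         Incident (edges (l , f) fs) l v → v ∈ roots f ⊎ v ∈ parent fs
    incident⇒neighbour l f fs (l∉ ∷ _) {v} = go
      where
      l∉F : l ∉ labelsF f
      l∉F p = All.lookup l∉ (∈-++⁺ˡ p) ≡.refl
      l∉R : l ∉ labelsR fs
      l∉R p = All.lookup l∉ (∈-++⁺ʳ (labelsF f) p) ≡.refl
      go : Incident (edges (l , f) fs) l v → v ∈ roots f ⊎ v ∈ parent fs
      go (inj₁ e) with ∈-++⁻ (edgesF l f) e
      ... | inj₂ e′ = ⊥-elim (l∉R (edgesR-src l fs e′))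
      ... | inj₁ e′ with edgesF-src l f e′
      ...   | inj₁ (_ , q) = inj₁ q
      ...   | inj₂ q       = ⊥-elim (l∉F q)
      go (inj₂ e) with ∈-++⁻ (edgesF l f) e
      ... | inj₁ e′ = ⊥-elim (l∉F (edgesF-tgt l f e′))
      ... | inj₂ e′ with edgesR-tgt l fs e′
      ...   | inj₁ (_ , q) = inj₂ q
      ...   | inj₂ q       = ⊥-elim (l∉R q)

    root⇒incident : ∀ l f fs {v} → v ∈ roots f → Incident (edges (l , f) fs) l v
    root⇒incident l f fs v∈ = inj₁ (∈-++⁺ˡ (go f v∈))
      where
      go : ∀ f {v} → v ∈ roots f → (l , v) ∈ edgesF l f
      go (node r cs ∷ ts) (here ≡.refl) = here ≡.refl
      go (node r cs ∷ ts) (there q)     = there (∈-++⁺ʳ (edgesF r cs) (go ts q))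

    parent⇒incident : ∀ l f fs {v} → v ∈ parent fs → Incident (edges (l , f) fs) l v
    parent⇒incident l f ((l₁ , f₁) ∷ fs) (here ≡.refl) = inj₂ (∈-++⁺ʳ (edgesF l f) (here ≡.refl))

    rootOf∈ : ∀ x fs → rootOf x fs ∈ labels x fs
    rootOf∈ (l , f) []       = here ≡.refl
    rootOf∈ (l , f) (x ∷ fs) = there (∈-++⁺ʳ (labelsF f) (rootOf∈ x fs))

-- The numbers of continuations and their recurrence.

module WalkCounting where

  open ForestWalks using (Tree; node; Frame; selections)
  open CatalanSeries using (module Rationals)
  open WalkGraphs using (module Exploration)
  open LabelledForests
  open import Defs using (fromℕ; allVecs; isTreeWalk?)
  open import Data.Nat.Base as ℕ using (ℕ; zero; suc; s≤s; _!)
  import Data.Nat.Properties as ℕ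
  import Data.Nat.Solver as ℕSolver
  open import Data.Nat.ListAction using (sum)
  open import Data.Rational.Base as ℚ using (ℚ; 0ℚ; 1ℚ)
  import Data.Rational.Properties as ℚ
  import Data.Rational.Solver as ℚSolver
  open import Data.Fin.Base using (Fin; zero; suc)
  import Data.Fin.Properties as Fin
  open import Data.List.Base as List using (List; []; _∷_; _++_; map; length; filter; allFin)
  import Data.List.Properties as List
  import Data.List.Membership.DecPropositional as DecMem
  open import Data.List.Membership.Propositional using (_∈_; _∉_)
  open import Data.List.Membership.Propositional.Properties
    using (∈-++⁺ˡ; ∈-++⁺ʳ; ∈-++⁻; ∈-filter⁺; ∈-filter⁻; ∈-allFin; ∈-map⁺; ∈-map⁻)
  open import Data.List.Membership.Propositional.Properties.WithK using (unique∧set⇒bag)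
  open import Data.List.Relation.Binary.BagAndSetEquality using (∼bag⇒↭)
  open import Data.List.Relation.Binary.Permutation.Propositional
    using (_↭_; ↭-refl; ↭-sym; ↭-trans; ↭-prep)
  open import Data.List.Relation.Binary.Permutation.Propositional.Properties
    using (++⁺ʳ; ∈-resp-↭; ↭-length)
  open import Data.List.Relation.Unary.All as All using (All; []; _∷_)
  open import Data.List.Relation.Unary.AllPairs using ([]; _∷_)
  open import Data.List.Relation.Unary.Any using (here; there)
  open import Data.List.Relation.Unary.Unique.Propositional using (Unique)
  import Data.List.Relation.Unary.Unique.Propositional.Properties as Unique
  open import Data.Vec.Base using (Vec; []; _∷_)
  open import Data.Product using (_×_; _,_; proj₁; proj₂; ∃-syntax)
  open import Data.Sum as Sum using (_⊎_; inj₁; inj₂)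
  open import Data.Empty using (⊥-elim)
  open import Function using (_∘_; mk⇔; Equivalence)
  open import Relation.Nullary using (¬_; yes; no)
  open import Relation.Nullary.Decidable using (¬?)
  open import Relation.Binary.PropositionalEquality using (_≡_; refl; sym; trans; cong; cong₂; subst; module ≡-Reasoning)

  module Unvisited {m : ℕ} where

    open DecMem (Fin._≟_ {m}) using (_∈?_)

    unvisited : List (Fin m) → List (Fin m)
    unvisited vis = filter (λ v → ¬? (v ∈? vis)) (allFin m)

    unvisited∉ : ∀ vis {v} → v ∈ unvisited vis → v ∉ vis
    unvisited∉ vis v∈ = proj₂ (∈-filter⁻ (λ v → ¬? (v ∈? vis)) {xs = allFin m} v∈)

    allFin-split : ∀ {vis} → Unique vis → allFin m ↭ vis ++ unvisited vis
    allFin-split {vis} uniq = ∼bag⇒↭ (unique∧set⇒bag (Unique.allFin⁺ m)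
      (Unique.++⁺ uniq (Unique.filter⁺ (λ v → ¬? (v ∈? vis)) (Unique.allFin⁺ m)) (λ (p , q) → unvisited∉ vis q p))
      (mk⇔ (λ _ → to _) (λ _ → ∈-allFin _)))
      where
      to : ∀ v → v ∈ vis ++ unvisited vis
      to v with v ∈? vis
      ... | yes p = ∈-++⁺ˡ p
      ... | no ¬p = ∈-++⁺ʳ vis (∈-filter⁺ (λ v → ¬? (v ∈? vis)) (∈-allFin v) ¬p)

    length-unvisited : ∀ {vis b} → Unique vis → length vis ℕ.+ b ≡ m → length (unvisited vis) ≡ b
    length-unvisited {vis} {b} uniq eq = ℕ.+-cancelˡ-≡ (length vis) _ _ (begin
      length vis ℕ.+ length (unvisited vis) ≡⟨ List.length-++ vis ⟨
      length (vis ++ unvisited vis)         ≡⟨ ↭-length (allFin-split uniq) ⟨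
      length (allFin m)                     ≡⟨ List.length-tabulate (λ (i : Fin m) → i) ⟩
      m                                     ≡⟨ eq ⟨
      length vis ℕ.+ b                      ∎)
      where open ≡-Reasoning

    all-visited : ∀ {vis} → Unique vis → length vis ℕ.+ 0 ≡ m → ∀ v → v ∈ vis
    all-visited {vis} uniq eq v with ∈-++⁻ vis (∈-resp-↭ (allFin-split uniq) (∈-allFin v))
    ... | inj₁ p = p
    ... | inj₂ q with unvisited vis | length-unvisited uniq eq
    ...   | [] | _ with () ← q

    all-visited⁻ : ∀ {vis b} → Unique vis → length vis ℕ.+ b ≡ m → (∀ v → v ∈ vis) → b ≡ 0
    all-visited⁻ {vis} {b} uniq eq all with unvisited vis | length-unvisited {vis} {b} uniq eq | unvisited∉ vis
    ... | []    | b≡ | _  = sym b≡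
    ... | v ∷ _ | _  | ∉ = ⊥-elim (∉ (here refl) (all v))

  module Counting {m : ℕ} (root : Fin m) where

    open Exploration root
    open Zippers {Fin m}
    open Counts
    open Unvisited {m}

    private
      Vertex : Set
      Vertex = Fin m

    -- Only up to permutation: the exploration lists vertices and edges in order of discovery, the
    -- zipper in tree order.
    record Represents (vis : List Vertex) (es : List (Vertex × Vertex)) (x : Frame Vertex) (fs : List (Frame Vertex)) : Set where
      field
        uniq  : Unique vis
        vis↭  : vis ↭ labels x fs
        es↭   : es ↭ edges x fs
        root≡ : rootOf x fs ≡ root

    open Represents

    represents-up : ∀ {vis es l f l₁ f₁ fs} → Represents vis es (l , f) ((l₁ , f₁) ∷ fs) →
                    Represents vis es (l₁ , node l f ∷ f₁) fs
    represents-up {l = l} {f} {l₁} {f₁} {fs} r = record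
      { uniq = uniq r ; vis↭ = ↭-trans (vis↭ r) (labels-up l f l₁ f₁ fs)
      ; es↭ = ↭-trans (es↭ r) (edges-up l f l₁ f₁ fs) ; root≡ = trans (same fs) (root≡ r) }
      where
      same : ∀ fs → rootOf (l₁ , node l f ∷ f₁) fs ≡ rootOf (l₁ , f₁) fs
      same []      = refl
      same (_ ∷ _) = refl

    represents-down : ∀ {vis es l f fs v cs ts} → Represents vis es (l , f) fs → (node v cs , ts) ∈ selections f →
                      Represents vis es (v , cs) ((l , ts) ∷ fs)
    represents-down {l = l} {f} {fs} {ts = ts} r s = record
      { uniq = uniq r ; vis↭ = ↭-trans (vis↭ r) (labels-down l f fs s)
      ; es↭ = ↭-trans (es↭ r) (edges-down l f fs s) ; root≡ = trans (same fs) (root≡ r) }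
      where
      same : ∀ fs → rootOf (l , ts) fs ≡ rootOf (l , f) fs
      same []      = refl
      same (_ ∷ _) = refl

    represents-new : ∀ {vis es l f fs v} → Represents vis es (l , f) fs → v ∉ vis →
                     Represents (v ∷ vis) ((l , v) ∷ es) (v , []) ((l , f) ∷ fs)
    represents-new r v∉ = record
      { uniq = All.tabulate (λ { u∈ refl → v∉ u∈ }) ∷ uniq r ; vis↭ = ↭-prep _ (vis↭ r)
      ; es↭ = ↭-prep _ (es↭ r) ; root≡ = root≡ r }

    neighbour : ∀ {vis es l f fs} → Represents vis es (l , f) fs → ∀ {v} → Adj es l v → v ∈ roots f ⊎ v ∈ parent fs
    neighbour {l = l} {f} {fs} r = incident⇒neighbour l f fs (unique-↭ (vis↭ r) (uniq r))
      ∘ Sum.map (∈-resp-↭ (es↭ r)) (∈-resp-↭ (es↭ r))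

    neighbour⁻ : ∀ {vis es l f fs} → Represents vis es (l , f) fs → ∀ {v} → v ∈ roots f ⊎ v ∈ parent fs → Adj es l v
    neighbour⁻ {l = l} {f} {fs} r = Sum.map (∈-resp-↭ (↭-sym (es↭ r))) (∈-resp-↭ (↭-sym (es↭ r)))
      ∘ Sum.[ root⇒incident l f fs , parent⇒incident l f fs ]

    child : ∀ f {v} → v ∈ roots f → ∃[ cs ] ∃[ ts ] (node v cs , ts) ∈ selections f
    child f v∈ with ∈-map⁻ (rootLabel ∘ proj₁) (subst (_ ∈_) (sym (roots-selections f)) v∈)
    ... | (node _ cs , ts) , s , refl = cs , ts , s

    private
      child-visited : ∀ f {v cs ts} → (node v cs , ts) ∈ selections f → v ∈ roots f
      child-visited f s = subst (_ ∈_) (roots-selections f) (∈-map⁺ (rootLabel ∘ proj₁) s)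

      ∈-vis : ∀ {vis es l f fs} → Represents vis es (l , f) fs → ∀ {v} → v ∈ roots f ++ parent fs → v ∈ vis
      ∈-vis {l = l} {f} {fs} r v∈ = ∈-resp-↭ (↭-sym (↭-trans (vis↭ r) (labels-neighbours l f fs))) (∈-++⁺ˡ v∈)

    -- Returning takes as many steps as the current depth, and each unvisited vertex costs two more.
    -- `suc L` includes the closing step.
    too-short : ∀ L {vis es l f fs b} → Represents vis es (l , f) fs → length vis ℕ.+ b ≡ m →
                suc L ℕ.< length fs ℕ.+ 2 ℕ.* b → (vs : Vec Vertex L) → ¬ Accepts vis es l vs
    too-short zero {fs = fs} {b} r len lt [] (adj , all) with all-visited⁻ (uniq r) len all
    ... | refl = contra fs r adj lt
      where
      contra : ∀ {l f} fs → Represents _ _ (l , f) fs → Adj _ l root → ¬ 1 ℕ.< length fs ℕ.+ 0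
      contra (_ ∷ [])               r adj (s≤s ())
      -- At depth two or more the root is neither a child nor the parent of the current vertex, as
      -- the labels are distinct.
      contra {l} {f} ((l₁ , f₁) ∷ x ∷ fs) r adj lt with unique-↭ (vis↭ r) (uniq r)
      ... | u with neighbour r adj
      ...   | inj₂ (here refl) = unique-disjoint (l₁ ∷ []) (tail₁ u) (here refl) (∈-++⁺ʳ (labelsF f₁) root∈)
        where
        root∈ : l₁ ∈ labels x fs
        root∈ = subst (_∈ labels x fs) (root≡ r) (rootOf∈ x fs)
        tail₁ : Unique (l ∷ labelsF f ++ l₁ ∷ labelsF f₁ ++ labels x fs) → Unique (l₁ ∷ labelsF f₁ ++ labels x fs)
        tail₁ (_ ∷ u) = go (labelsF f) u
          where
          go : ∀ xs {ys : List Vertex} → Unique (xs ++ ys) → Unique ys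
          go []       u       = u
          go (x ∷ xs) (_ ∷ u) = go xs u
      ...   | inj₁ v∈ = unique-disjoint (l ∷ labelsF f) u (there (roots⊆ f v∈))
                          (there (∈-++⁺ʳ (labelsF f₁) (subst (_∈ labels x fs) (root≡ r) (rootOf∈ x fs))))
        where
        roots⊆ : ∀ f {v} → v ∈ roots f → v ∈ labelsF f
        roots⊆ (node v cs ∷ ts) (here refl) = here refl
        roots⊆ (node v cs ∷ ts) (there q)   = there (∈-++⁺ʳ (labelsF cs) (roots⊆ ts q))
    too-short (suc L) {fs = fs} {b} r len lt (v ∷ vs) (inj₁ (_ , adj , acc)) with neighbour r adj
    ... | inj₁ v∈ with cs , ts , s ← child _ v∈ =
      too-short L (represents-down r s) len (ℕ.m≤n⇒m≤1+n (ℕ.<⇒≤ lt)) vs acc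
    too-short (suc L) {fs = (_ , _) ∷ fs} {b} r len lt (v ∷ vs) (inj₁ (_ , adj , acc)) | inj₂ (here refl) =
      too-short L (represents-up r) len (ℕ.≤-pred lt) vs acc
    too-short (suc L) {fs = fs} {zero} r len lt (v ∷ vs) (inj₂ (v∉ , acc)) = v∉ (all-visited (uniq r) len v)
    too-short (suc L) {vis} {fs = fs} {suc b} r len lt (v ∷ vs) (inj₂ (v∉ , acc)) =
      too-short L (represents-new r v∉) (trans (sym (ℕ.+-suc (length vis) b)) len)
        (ℕ.≤-pred (subst (suc (suc L) ℕ.<_) (solve 2 (λ d b → d :+ con 2 :* (con 1 :+ b) := con 1 :+ (con 1 :+ d :+ con 2 :* b)) refl (length fs) b) lt)) vs acc
      where open ℕSolver.+-*-Solver

    #accepted : ℕ → List Vertex → List (Vertex × Vertex) → Vertex → ℕ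
    #accepted n vis es cur = length (filter (accepts? vis es cur) (allVecs (allFin m) n))

    #next : ℕ → List Vertex → List (Vertex × Vertex) → Vertex → Vertex → ℕ
    #next n vis es cur v = length (filter (accepts? vis es cur ∘ (v ∷_)) (allVecs (allFin m) n))

    #next-old : ∀ n {vis es cur v} → v ∈ vis → Adj es cur v → #next n vis es cur v ≡ #accepted n vis es v
    #next-old n {vis} {es} {cur} {v} v∈ adj = length-filter-⇔ (accepts? vis es cur ∘ (v ∷_)) (accepts? vis es v)
      (λ { vs (inj₁ (_ , _ , acc)) → acc ; vs (inj₂ (v∉ , _)) → ⊥-elim (v∉ v∈) })
      (λ vs acc → inj₁ (v∈ , adj , acc)) (allVecs (allFin m) n)

    #next-nonadjacent : ∀ n {vis es cur v} → v ∈ vis → ¬ Adj es cur v → #next n vis es cur v ≡ 0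
    #next-nonadjacent n {vis} {es} {cur} {v} v∈ ¬adj = length-filter-none (accepts? vis es cur ∘ (v ∷_))
      (λ { vs (inj₁ (_ , adj , _)) → ¬adj adj ; vs (inj₂ (v∉ , _)) → v∉ v∈ }) (allVecs (allFin m) n)

    #next-new : ∀ n {vis es cur v} → v ∉ vis → #next n vis es cur v ≡ #accepted n (v ∷ vis) ((cur , v) ∷ es) v
    #next-new n {vis} {es} {cur} {v} v∉ = length-filter-⇔ (accepts? vis es cur ∘ (v ∷_)) (accepts? (v ∷ vis) ((cur , v) ∷ es) v)
      (λ { vs (inj₁ (v∈ , _)) → ⊥-elim (v∉ v∈) ; vs (inj₂ (_ , acc)) → acc })
      (λ vs acc → inj₂ (v∉ , acc)) (allVecs (allFin m) n)

    -- The next vertex is a child, the parent or unvisited; any other visited vertex is not adjacent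
    -- and admits no continuation.
    #accepted-suc : ∀ n {vis es l f fs} → Represents vis es (l , f) fs →
      fromℕ (#accepted (suc n) vis es l) ≡
        Σℚ (λ (t , _) → fromℕ (#accepted n vis es (rootLabel t))) (selections f)
        ℚ.+ Σℚ (λ v → fromℕ (#accepted n vis es v)) (parent fs)
        ℚ.+ Σℚ (λ v → fromℕ (#accepted n (v ∷ vis) ((l , v) ∷ es) v)) (unvisited vis)
    #accepted-suc n {vis} {es} {l} {f} {fs} r = begin
      fromℕ (#accepted (suc n) vis es l)
        ≡⟨ cong fromℕ (length-filter-allVecs n (accepts? vis es l) (allFin m)) ⟩
      fromℕ (sum (map (#next n vis es l) (allFin m))) ≡⟨ fromℕ-sum (#next n vis es l) (allFin m) ⟩
      Σℚ F (allFin m) ≡⟨ Σℚ-↭ F (↭-trans (allFin-split (uniq r)) (++⁺ʳ (unvisited vis) vis↭′)) ⟩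
      Σℚ F (((roots f ++ parent fs) ++ distant (l , f) fs) ++ unvisited vis)
        ≡⟨ Σℚ-++ F ((roots f ++ parent fs) ++ distant (l , f) fs) (unvisited vis) ⟩
      Σℚ F ((roots f ++ parent fs) ++ distant (l , f) fs) ℚ.+ Σℚ F (unvisited vis)
        ≡⟨ cong (ℚ._+ Σℚ F (unvisited vis)) (trans (Σℚ-++ F (roots f ++ parent fs) (distant (l , f) fs))
             (trans (cong₂ ℚ._+_ (Σℚ-++ F (roots f) (parent fs)) far) (ℚ.+-identityʳ (Σℚ F (roots f) ℚ.+ Σℚ F (parent fs))))) ⟩
      Σℚ F (roots f) ℚ.+ Σℚ F (parent fs) ℚ.+ Σℚ F (unvisited vis)
        ≡⟨ cong₂ ℚ._+_ (cong₂ ℚ._+_ children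
             (Σℚ-cong (parent fs) λ v v∈ → cong fromℕ (#next-old n (∈-vis r (∈-++⁺ʳ (roots f) v∈)) (neighbour⁻ r (inj₂ v∈)))))
             (Σℚ-cong (unvisited vis) λ v v∈ → cong fromℕ (#next-new n (unvisited∉ vis v∈))) ⟩
      _ ∎
      where
      open ≡-Reasoning
      F : Vertex → ℚ
      F v = fromℕ (#next n vis es l v)
      Σℚ-cong : ∀ {A : Set} {G H : A → ℚ} xs → (∀ x → x ∈ xs → G x ≡ H x) → Σℚ G xs ≡ Σℚ H xs
      Σℚ-cong []       h = refl
      Σℚ-cong (x ∷ xs) h = cong₂ ℚ._+_ (h x (here refl)) (Σℚ-cong xs (λ y y∈ → h y (there y∈)))
      Σℚ-map : ∀ {A B : Set} (G : B → ℚ) (g : A → B) xs → Σℚ G (map g xs) ≡ Σℚ (G ∘ g) xs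
      Σℚ-map G g []       = refl
      Σℚ-map G g (x ∷ xs) = cong (G (g x) ℚ.+_) (Σℚ-map G g xs)
      vis↭′ : vis ↭ (roots f ++ parent fs) ++ distant (l , f) fs
      vis↭′ = ↭-trans (vis↭ r) (labels-neighbours l f fs)
      far : Σℚ F (distant (l , f) fs) ≡ 0ℚ
      far = Σℚ-zero F (distant (l , f) fs) λ v v∈ → cong fromℕ (#next-nonadjacent n
        (∈-resp-↭ (↭-sym vis↭′) (∈-++⁺ʳ (roots f ++ parent fs) v∈))
        (λ adj → unique-disjoint (roots f ++ parent fs) (unique-↭ vis↭′ (uniq r))
          (Sum.[ ∈-++⁺ˡ , ∈-++⁺ʳ (roots f) ] (neighbour r adj)) v∈))
      children : Σℚ F (roots f) ≡ Σℚ (λ (t , _) → fromℕ (#accepted n vis es (rootLabel t))) (selections f)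
      children = trans (cong (Σℚ F) (sym (roots-selections f))) (trans (Σℚ-map F (rootLabel ∘ proj₁) (selections f))
        (Σℚ-cong (selections f) λ { (node v cs , ts) s → cong fromℕ (#next-old n
          (∈-vis r (∈-++⁺ˡ (child-visited f s))) (neighbour⁻ r (inj₁ (child-visited f s)))) }))

    -- Φ x fs a n is the weight of the continuations with n remaining steps away
    -- from the root, a of which lead to vertices already visited.
    record Recurrence (N : ℕ) : Set where
      field
        Φ   : Frame Vertex → List (Frame Vertex) → ℕ → ℕ → ℚ
        ΣΦ  : Vertex → List (Frame Vertex) → List (Tree Vertex × List (Tree Vertex)) → ℕ → ℕ → ℚ
        down up new : ℕ → ℕ → Frame Vertex → List (Frame Vertex) → ℚ
        ΣΦ-[]   : ∀ l fs a n → ΣΦ l fs [] a n ≡ 0ℚ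
        ΣΦ-∷    : ∀ l fs v cs ts ss a n → ΣΦ l fs ((node v cs , ts) ∷ ss) a n ≡
                  Φ (v , cs) ((l , ts) ∷ fs) a n ℚ.+ ΣΦ l fs ss a n
        down-00 : ∀ n x fs → down 0 n x fs ≡ 0ℚ
        down-0  : ∀ a x fs → down a 0 x fs ≡ 0ℚ
        down-ss : ∀ a n l f fs → down (suc a) (suc n) (l , f) fs ≡ ΣΦ l fs (selections f) a n
        new-0   : ∀ a x fs → new a 0 x fs ≡ 0ℚ
        new-s   : ∀ a n x fs v → new a (suc n) x fs ≡ Φ (v , []) (x ∷ fs) a n
        up-0    : ∀ x → up 0 0 x [] ≡ 1ℚ
        up-sa   : ∀ a n x → up (suc a) n x [] ≡ 0ℚ
        up-sn   : ∀ a n x → up a (suc n) x [] ≡ 0ℚ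
        up-∷    : ∀ a n l f l₁ f₁ fs → up a n (l , f) ((l₁ , f₁) ∷ fs) ≡ Φ (l₁ , node l f ∷ f₁) fs a n
        Φ-rec   : ∀ {a} n x fs → a ℕ.< N → Φ x fs a n ≡ up a n x fs ℚ.+ (down a n x fs ℚ.+ new a n x fs)

    module Closed {N : ℕ} (recurrence : Recurrence N) where

      open Recurrence recurrence

      private
        ΣΦ-zero : ∀ l fs ss a n → (∀ x fs → Φ x fs a n ≡ 0ℚ) → ΣΦ l fs ss a n ≡ 0ℚ
        ΣΦ-zero l fs []                    a n h = ΣΦ-[] l fs a n
        ΣΦ-zero l fs ((node v cs , ts) ∷ ss) a n h =
          trans (ΣΦ-∷ l fs v cs ts ss a n) (cong₂ ℚ._+_ (h (v , cs) ((l , ts) ∷ fs)) (ΣΦ-zero l fs ss a n h))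

      -- Among n steps away from the root there cannot be more than n leading to visited vertices. A
      -- step up keeps a and n, so there the induction is on the depth.
      Φ-vanish : ∀ n {a} x fs → a ℕ.< N → n ℕ.< a → Φ x fs a n ≡ 0ℚ
      Φ-vanish n {suc a} x fs a<N n<a = go n n<a x fs
        where
        go-down : ∀ n → n ℕ.< suc a → ∀ x fs → down (suc a) n x fs ≡ 0ℚ
        go-down zero    _         x       fs = down-0 (suc a) x fs
        go-down (suc n) (s≤s n<a) (l , f) fs = trans (down-ss a n l f fs)
          (ΣΦ-zero l fs (selections f) a n (λ x fs → Φ-vanish n x fs (ℕ.<⇒≤ a<N) n<a))
        go-new : ∀ n → n ℕ.< suc a → ∀ x fs → new (suc a) n x fs ≡ 0ℚ
        go-new zero    _   x       fs = new-0 (suc a) x fs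
        go-new (suc n) n<a x@(v , _) fs = trans (new-s (suc a) n x fs v) (Φ-vanish n (v , []) (x ∷ fs) a<N (ℕ.<⇒≤ n<a))
        go : ∀ n → n ℕ.< suc a → ∀ x fs → Φ x fs (suc a) n ≡ 0ℚ
        go n n<a x []                       = trans (Φ-rec n x [] a<N)
          (cong₂ ℚ._+_ (up-sa a n x) (cong₂ ℚ._+_ (go-down n n<a x []) (go-new n n<a x [])))
        go n n<a (l , f) ((l₁ , f₁) ∷ fs) = trans (Φ-rec n (l , f) ((l₁ , f₁) ∷ fs) a<N)
          (cong₂ ℚ._+_ (trans (up-∷ (suc a) n l f l₁ f₁ fs) (go n n<a (l₁ , node l f ∷ f₁) fs))
            (cong₂ ℚ._+_ (go-down n n<a (l , f) ((l₁ , f₁) ∷ fs)) (go-new n n<a (l , f) ((l₁ , f₁) ∷ fs))))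

      -- The factor `b !` counts the orders in which the unvisited labels are handed out. The
      -- remaining steps, with the closing one, are one up for each level of depth and a pair, out
      -- and back, for each of the a + b steps away from the root.
      Claim : ℕ → Set
      Claim L = ∀ {vis es l f fs} a b → Represents vis es (l , f) fs → a ℕ.< N →
                length vis ℕ.+ b ≡ m → suc L ≡ length fs ℕ.+ 2 ℕ.* (a ℕ.+ b) →
                fromℕ (#accepted L vis es l) ≡ fromℕ (b !) ℚ.* Φ (l , f) fs a (a ℕ.+ b)

      private
        base : ∀ {vis es l f x} → Represents vis es (l , f) (x ∷ []) → 0 ℕ.< N → length vis ℕ.+ 0 ≡ m →
               fromℕ (#accepted 0 vis es l) ≡ fromℕ (0 !) ℚ.* Φ (l , f) (x ∷ []) 0 0
        base {vis} {es} {l} {f} {l₁ , f₁} r 0<N len = trans (cong fromℕ accepted) (sym (trans (ℚ.*-identityˡ _) Φ≡1))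
          where
          root-acc : Accepts vis es l []
          root-acc = subst (Adj es l) (root≡ r) (neighbour⁻ r (inj₂ (here refl))) , all-visited (uniq r) len
          accepted : #accepted 0 vis es l ≡ 1
          accepted = cong length (List.filter-accept (accepts? vis es l) {x = []} {xs = []} root-acc)
          Φ≡1 : Φ (l , f) ((l₁ , f₁) ∷ []) 0 0 ≡ 1ℚ
          Φ≡1 = trans (Φ-rec 0 (l , f) ((l₁ , f₁) ∷ []) 0<N) (cong₂ ℚ._+_
            (trans (up-∷ 0 0 l f l₁ f₁ []) (trans (Φ-rec 0 (l₁ , node l f ∷ f₁) [] 0<N)
              (cong₂ ℚ._+_ (up-0 _) (cong₂ ℚ._+_ (down-0 0 _ _) (new-0 0 _ _)))))
            (cong₂ ℚ._+_ (down-0 0 _ _) (new-0 0 _ _)))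

        one-step : ∀ (fs : List (Frame Vertex)) k → 1 ≡ length fs ℕ.+ 2 ℕ.* k → ∃[ x ] fs ≡ x ∷ [] × k ≡ 0
        one-step (x ∷ [])     zero    eq = x , refl , refl
        one-step []           (suc k) eq with () ← trans eq (ℕ.*-suc 2 k)
        one-step (_ ∷ [])     (suc k) eq with () ← trans eq (cong suc (ℕ.*-suc 2 k))

      count-0 : Claim 0
      count-0 {vis} {es} {l} {f} {fs} a b r a<N len eq = go a b r a<N len (one-step fs (a ℕ.+ b) eq)
        where
        go : ∀ {fs} a b → Represents vis es (l , f) fs → a ℕ.< N → length vis ℕ.+ b ≡ m → ∃[ x ] fs ≡ x ∷ [] × a ℕ.+ b ≡ 0 →
             fromℕ (#accepted 0 vis es l) ≡ fromℕ (b !) ℚ.* Φ (l , f) fs a (a ℕ.+ b)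
        go zero zero r 0<N len (x , refl , _) = base r 0<N len

      private
        lengthen : ∀ {L d} n → suc (suc L) ≡ d ℕ.+ 2 ℕ.* suc n → suc L ≡ suc d ℕ.+ 2 ℕ.* n
        lengthen {d = d} n eq = ℕ.suc-injective (trans eq
          (solve 2 (λ d n → d :+ con 2 :* (con 1 :+ n) := con 1 :+ (con 1 :+ d :+ con 2 :* n)) refl d n))
          where open ℕSolver.+-*-Solver

      downs-eq : ∀ L → Claim L → ∀ {vis es l f fs} a b → Represents vis es (l , f) fs → a ℕ.< N →
                 length vis ℕ.+ b ≡ m → suc (suc L) ≡ length fs ℕ.+ 2 ℕ.* (a ℕ.+ b) →
                 Σℚ (λ (t , _) → fromℕ (#accepted L vis es (rootLabel t))) (selections f)
                   ≡ fromℕ (b !) ℚ.* down a (a ℕ.+ b) (l , f) fs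
      downs-eq L ih {vis} {es} {l} {f} {fs} zero b r a<N len eq = trans
        -- For a = 0 the return and the unvisited vertices use up all steps, so none is left for
        -- entering an explored subtree.
        (Σℚ-zero (λ (t , _) → fromℕ (#accepted L vis es (rootLabel t))) (selections f) λ { (node v cs , ts) s → cong fromℕ
          (length-filter-none (accepts? vis es v) (too-short L (represents-down r s) len
            (s≤s (subst (suc L ℕ.≤_) eq (ℕ.n≤1+n (suc L))))) (allVecs (allFin m) L)) })
        (sym (trans (cong (fromℕ (b !) ℚ.*_) (down-00 b (l , f) fs)) (ℚ.*-zeroʳ (fromℕ (b !)))))
      downs-eq L ih {vis} {es} {l} {f} {fs} (suc a) b r a<N len eq = trans (go (selections f) (λ s → s))
        (cong (fromℕ (b !) ℚ.*_) (sym (down-ss a (a ℕ.+ b) l f fs)))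
        where
        go : ∀ ss → (∀ {s} → s ∈ ss → s ∈ selections f) →
             Σℚ (λ (t , _) → fromℕ (#accepted L vis es (rootLabel t))) ss ≡ fromℕ (b !) ℚ.* ΣΦ l fs ss a (a ℕ.+ b)
        go []                    _   = sym (trans (cong (fromℕ (b !) ℚ.*_) (ΣΦ-[] l fs a (a ℕ.+ b))) (ℚ.*-zeroʳ (fromℕ (b !))))
        go ((node v cs , ts) ∷ ss) ss⊆ = trans
          (cong₂ ℚ._+_ (ih a b (represents-down r (ss⊆ (here refl))) (ℕ.<⇒≤ a<N) len (lengthen (a ℕ.+ b) eq)) (go ss (ss⊆ ∘ there)))
          (trans (sym (ℚ.*-distribˡ-+ (fromℕ (b !)) _ _)) (cong (fromℕ (b !) ℚ.*_) (sym (ΣΦ-∷ l fs v cs ts ss a (a ℕ.+ b)))))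

      ups-eq : ∀ L → Claim L → ∀ {vis es l f} fs a b → Represents vis es (l , f) fs → a ℕ.< N →
               length vis ℕ.+ b ≡ m → suc (suc L) ≡ length fs ℕ.+ 2 ℕ.* (a ℕ.+ b) →
               Σℚ (λ v → fromℕ (#accepted L vis es v)) (parent fs) ≡ fromℕ (b !) ℚ.* up a (a ℕ.+ b) (l , f) fs
      ups-eq L ih {l = l} {f} [] a b r a<N len eq =
        sym (trans (cong (fromℕ (b !) ℚ.*_) (vanish (a ℕ.+ b) eq)) (ℚ.*-zeroʳ (fromℕ (b !))))
        where
        vanish : ∀ n → suc (suc L) ≡ 2 ℕ.* n → up a n (l , f) [] ≡ 0ℚ
        vanish (suc n) _ = up-sn a n (l , f)
      ups-eq L ih {l = l} {f} ((l₁ , f₁) ∷ fs) a b r a<N len eq = trans (ℚ.+-identityʳ _)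
        (trans (ih a b (represents-up r) a<N len (ℕ.suc-injective eq))
          (cong (fromℕ (b !) ℚ.*_) (sym (up-∷ a (a ℕ.+ b) l f l₁ f₁ fs))))

      news-eq : ∀ L → Claim L → ∀ {vis es l f fs} a b → Represents vis es (l , f) fs → a ℕ.< N →
                length vis ℕ.+ b ≡ m → suc (suc L) ≡ length fs ℕ.+ 2 ℕ.* (a ℕ.+ b) →
                Σℚ (λ v → fromℕ (#accepted L (v ∷ vis) ((l , v) ∷ es) v)) (unvisited vis)
                  ≡ fromℕ (b !) ℚ.* new a (a ℕ.+ b) (l , f) fs
      news-eq L ih {vis} {es} {l} {f} {fs} a zero r a<N len eq =
        -- No vertex is left to discover. On the other side n = a, and a new vertex would leave n -
        -- 1 steps for a visits, where `Φ` vanishes.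
        trans none (sym (trans (cong (1ℚ ℚ.*_) (vanish a (a ℕ.+ 0) a<N (ℕ.+-identityʳ a))) (ℚ.*-zeroʳ 1ℚ)))
        where
        F : Vertex → ℚ
        F v = fromℕ (#accepted L (v ∷ vis) ((l , v) ∷ es) v)
        none : Σℚ F (unvisited vis) ≡ 0ℚ
        none = Σℚ-zero F (unvisited vis) (λ v v∈ → ⊥-elim (unvisited∉ vis v∈ (all-visited (uniq r) len v)))
        vanish : ∀ a n → a ℕ.< N → n ≡ a → new a n (l , f) fs ≡ 0ℚ
        vanish a zero    _   _    = new-0 a (l , f) fs
        vanish a (suc n) a<N refl = trans (new-s a n (l , f) fs l) (Φ-vanish n (l , []) ((l , f) ∷ fs) a<N ℕ.≤-refl)
      news-eq L ih {vis} {es} {l} {f} {fs} a (suc b) r a<N len eq = begin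
        Σℚ F (unvisited vis) ≡⟨ Σℚ-const F (fromℕ (b !) ℚ.* c) (unvisited vis) (λ v v∈ →
                  trans (ih a b (represents-new r (unvisited∉ vis v∈)) a<N
                    (trans (sym (ℕ.+-suc (length vis) b)) len) (lengthen (a ℕ.+ b) (trans eq (cong (λ n → length fs ℕ.+ 2 ℕ.* n) (ℕ.+-suc a b)))))
                  (cong (fromℕ (b !) ℚ.*_) (trans (sym (new-s a (a ℕ.+ b) (l , f) fs v)) (new-s a (a ℕ.+ b) (l , f) fs l)))) ⟩
        fromℕ (length (unvisited vis)) ℚ.* (fromℕ (b !) ℚ.* c)
          ≡⟨ cong (λ k → fromℕ k ℚ.* (fromℕ (b !) ℚ.* c)) (length-unvisited (uniq r) len) ⟩
        fromℕ (suc b) ℚ.* (fromℕ (b !) ℚ.* c) ≡⟨ ℚ.*-assoc (fromℕ (suc b)) (fromℕ (b !)) c ⟨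
        fromℕ (suc b) ℚ.* fromℕ (b !) ℚ.* c
          ≡⟨ cong₂ ℚ._*_ (sym (Rationals.fromℕ-* (suc b) (b !))) (sym (trans (cong (λ n → new a n (l , f) fs) (ℕ.+-suc a b)) (new-s a (a ℕ.+ b) (l , f) fs l))) ⟩
        fromℕ (suc b !) ℚ.* new a (a ℕ.+ suc b) (l , f) fs ∎
        where
        open ≡-Reasoning
        F : Vertex → ℚ
        F v = fromℕ (#accepted L (v ∷ vis) ((l , v) ∷ es) v)
        c : ℚ
        c = Φ (l , []) ((l , f) ∷ fs) a (a ℕ.+ b)

      count-suc : ∀ L → Claim L → Claim (suc L)
      count-suc L ih {vis} {es} {l} {f} {fs} a b r a<N len eq = begin
        fromℕ (#accepted (suc L) vis es l) ≡⟨ #accepted-suc L r ⟩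
        _ ≡⟨ cong₂ ℚ._+_ (cong₂ ℚ._+_ (downs-eq L ih a b r a<N len eq) (ups-eq L ih fs a b r a<N len eq)) (news-eq L ih a b r a<N len eq) ⟩
        c ℚ.* down a (a ℕ.+ b) (l , f) fs ℚ.+ c ℚ.* up a (a ℕ.+ b) (l , f) fs ℚ.+ c ℚ.* new a (a ℕ.+ b) (l , f) fs
          ≡⟨ solve 4 (λ c d u n → c :* d :+ c :* u :+ c :* n := c :* (u :+ (d :+ n))) refl c
               (down a (a ℕ.+ b) (l , f) fs) (up a (a ℕ.+ b) (l , f) fs) (new a (a ℕ.+ b) (l , f) fs) ⟩
        c ℚ.* (up a (a ℕ.+ b) (l , f) fs ℚ.+ (down a (a ℕ.+ b) (l , f) fs ℚ.+ new a (a ℕ.+ b) (l , f) fs))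
          ≡⟨ cong (c ℚ.*_) (Φ-rec (a ℕ.+ b) (l , f) fs a<N) ⟨
        c ℚ.* Φ (l , f) fs a (a ℕ.+ b) ∎
        where
        open ≡-Reasoning
        open ℚSolver.+-*-Solver
        c : ℚ
        c = fromℕ (b !)

      count : ∀ L → Claim L
      count zero    = count-0
      count (suc L) = count-suc L (count L)

      count-from-root : ∀ L a b → suc L ≡ 2 ℕ.* (a ℕ.+ b) → suc b ≡ m → a ℕ.< N →
        fromℕ (length (filter (λ vs → isTreeWalk? (root ∷ vs)) (allVecs (allFin m) L)))
          ≡ fromℕ (b !) ℚ.* Φ (root , []) [] a (a ℕ.+ b)
      count-from-root L a b eq len a<N = trans
        (cong fromℕ (length-filter-⇔ (λ vs → isTreeWalk? (root ∷ vs)) (accepts? (root ∷ []) [] root)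
          (λ vs → Equivalence.to (treeWalk⇔accepts vs)) (λ vs → Equivalence.from (treeWalk⇔accepts vs)) (allVecs (allFin m) L)))
        (count L a b (record { uniq = [] ∷ [] ; vis↭ = ↭-refl ; es↭ = ↭-refl ; root≡ = refl }) a<N len eq)

-- Solving the system over series in z and expanding the coefficients of y.

module ExcessExpansion where

  open PowerSeriesRings
  open ForestWalks
  open ExcessSystem
  open CatalanSeries using (module Catalan)
  open LeadingCones
  open PolynomialTerms
  open import Defs
  open import Level using (0ℓ)
  open import Algebra.Bundles using (CommutativeRing)
  open import Data.Nat.Base as ℕ using (ℕ; zero; suc; z≤n; s≤s)
  import Data.Nat.Properties as ℕ
  open import Data.Integer.Base using (+_)
  open import Data.Rational.Base as ℚ using (ℚ; 0ℚ; 1ℚ)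
  import Data.Rational.Properties as ℚ
  open import Data.Fin.Base using (zero; suc)
  open import Data.List.Base using (List; []; _∷_)
  open import Data.Vec.Base using ([]; _∷_)
  open import Data.Product using (_×_; _,_; proj₁; proj₂; Σ-syntax)
  open import Data.Empty using (⊥-elim)
  import Data.Nat.Solver as ℕSolver
  open import Data.List.Relation.Unary.All using (All; []; _∷_)
  open import Data.List.Relation.Unary.Any as Any using (Any; here)
  import Data.List.Relation.Unary.Any.Properties as Any
  open import Relation.Binary.PropositionalEquality as ≡ using (_≡_; subst)

  module ExcessSeries (𝕊 : CommutativeRing 0ℓ 0ℓ)
    (x p z C : CommutativeRing.Carrier 𝕊) (scalar : ℚ → CommutativeRing.Carrier 𝕊)
    (scalar-+ : ∀ c d → CommutativeRing._≈_ 𝕊 (scalar (c ℚ.+ d)) (CommutativeRing._+_ 𝕊 (scalar c) (scalar d)))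
    (scalar-* : ∀ c d → CommutativeRing._≈_ 𝕊 (scalar (c ℚ.* d)) (CommutativeRing._*_ 𝕊 (scalar c) (scalar d)))
    (scalar-0 : CommutativeRing._≈_ 𝕊 (scalar 0ℚ) (CommutativeRing.0# 𝕊))
    (scalar-1 : CommutativeRing._≈_ 𝕊 (scalar 1ℚ) (CommutativeRing.1# 𝕊))
    (C-x : CommutativeRing._≈_ 𝕊 C (CommutativeRing._+_ 𝕊 (CommutativeRing.1# 𝕊) x))
    (x-z : CommutativeRing._≈_ 𝕊 x (CommutativeRing._*_ 𝕊 z (CommutativeRing._*_ 𝕊 C C)))
    (p-x : CommutativeRing._≈_ 𝕊 p (CommutativeRing._+_ 𝕊 (CommutativeRing.1# 𝕊) (CommutativeRing._*_ 𝕊 x p))) where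

    private module 𝕊 = CommutativeRing 𝕊

    open Cones 𝕊 x p scalar scalar-+ scalar-* scalar-0 scalar-1 public

    open PowerSeries 𝕊 public
      using (PS; _⊕_; _⊛_; 0ₚ; 1ₚ; var; truncated; _≋[_]_; _≋_; var-⊛-0; var-⊛-suc; ⊛-assoc; ⊛-distribʳ; ⊛-cong)
      renaming (ι to ιₚ; ι-⊛ to ιₚ-⊛)

    x̂ q̂ ẑ Ĉ p̂ : PS
    x̂ = ιₚ x
    q̂ = ιₚ q
    ẑ = ιₚ z
    Ĉ = ιₚ C
    p̂ = ιₚ p

    module Truncation (N : ℕ) where

      open CommutativeRing (truncated N) public using (_≈_; refl; sym; trans; +-cong; +-congˡ; *-cong; *-congˡ)
      open Shuffle (truncated N) public using (Filtration)

      ιₚ-≈ : ∀ {f g} → f 𝕊.≈ g → ιₚ f ≈ ιₚ g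
      ιₚ-≈ e zero    _ = e
      ιₚ-≈ e (suc n) _ = 𝕊.refl

      ιₚ-+ : ∀ f g → ιₚ (f 𝕊.+ g) ≈ ιₚ f ⊕ ιₚ g
      ιₚ-+ f g zero    _ = 𝕊.refl
      ιₚ-+ f g (suc n) _ = 𝕊.sym (𝕊.+-identityˡ 𝕊.0#)

      ιₚ-* : ∀ f g → ιₚ (f 𝕊.* g) ≈ ιₚ f ⊛ ιₚ g
      ιₚ-* f g n _ = 𝕊.sym (𝕊.trans (ιₚ-⊛ f (ιₚ g) n) (scale n))
        where
        scale : ∀ n → f 𝕊.* ιₚ g n 𝕊.≈ ιₚ (f 𝕊.* g) n
        scale zero    = 𝕊.refl
        scale (suc n) = 𝕊.zeroʳ f

      -- The representative g makes the condition invariant under equality modulo y^N, while all its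
      -- coefficients can be required to lie in cones.
      InCone : ℕ → PS → Set
      InCone n f = Σ[ g ∈ PS ] (f ≈ g) × (∀ ξ → Cone n ξ (g ξ))

      conic : Filtration
      conic = record
        { F      = InCone
        ; F-0    = λ n → 0ₚ , refl , λ ξ → cone-0
        ; F-1    = 1ₚ , refl , λ { zero → cone-1 ; (suc ξ) → cone-0 }
        ; F-+    = λ { {n} (f , e , c) (g , e′ , c′) → f ⊕ g , +-cong e e′ , λ ξ → cone-+ (c ξ) (c′ ξ) }
        ; F-*    = λ { {m} {n} (f , e , c) (g , e′ , c′) → f ⊛ g , *-cong e e′ ,
                   λ ξ → subst (λ ζ → Cone (m ℕ.+ n) ζ ((f ⊛ g) ξ)) (ℕ.+-identityʳ ξ)
                     (cone-⊛ m n 0 0 ξ (λ i _ → subst (λ ζ → Cone m ζ (f i)) (≡.sym (ℕ.+-identityʳ i)) (c i))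
                                       (λ i _ → subst (λ ζ → Cone n ζ (g i)) (≡.sym (ℕ.+-identityʳ i)) (c′ i))) }
        ; F-mono = λ { m≤n (f , e , c) → f , e , λ ξ → cone-weaken m≤n (c ξ) }
        ; F-resp = λ { e (f , e′ , c) → f , trans (sym e) e′ , c }
        }

      inCone-q : ∀ {n f} → InCone (suc n) f → InCone n (q̂ ⊛ f)
      inCone-q {n} {f} (g , e , c) = (λ ξ → q 𝕊.* g ξ) ,
        (λ ξ ξ< → 𝕊.trans (ιₚ-⊛ q f ξ) (𝕊.*-congˡ {x = q} (e ξ ξ<))) , λ ξ → cone-q (c ξ)

      private
        shift : PS → PS
        shift f zero    = 𝕊.0#
        shift f (suc n) = f n

        var-shift : ∀ {f g} → f ≈ g → (var ⊛ f) ≈ shift g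
        var-shift {f} e zero    _  = var-⊛-0 f
        var-shift {f} e (suc n) n< = 𝕊.trans (var-⊛-suc f n) (e n (ℕ.<⇒≤ n<))

      inCone-yx : ∀ {n f} → InCone n f → InCone (2 ℕ.+ n) (var ⊛ (x̂ ⊛ f))
      inCone-yx {n} {f} (g , e , c) = shift (λ ξ → x 𝕊.* g ξ) ,
        var-shift (λ ξ ξ< → 𝕊.trans (ιₚ-⊛ x f ξ) (𝕊.*-congˡ {x = x} (e ξ ξ<))) ,
        λ { zero → cone-0 ; (suc ξ) → cone-x (c ξ) }

      inCone-yxx : ∀ {n f} → InCone n f → InCone (2 ℕ.+ n) (var ⊛ (x̂ ⊛ (x̂ ⊛ f)))
      inCone-yxx {n} {f} (g , e , c) = shift (λ ξ → x 𝕊.* (x 𝕊.* g ξ)) ,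
        var-shift (λ ξ ξ< → 𝕊.trans (ιₚ-⊛ x (x̂ ⊛ f) ξ) (𝕊.*-congˡ {x = x} (𝕊.trans (ιₚ-⊛ x f ξ) (𝕊.*-congˡ {x = x} (e ξ ξ<))))) ,
        λ { zero → cone-0 ; (suc ξ) → cone-xx (c ξ) }

      inCone⇒cone : ∀ {n f} → InCone n f → ∀ ξ → ξ ℕ.< N → Cone n ξ (f ξ)
      inCone⇒cone (g , e , c) ξ ξ< = cone-resp (𝕊.sym (e ξ ξ<)) (c ξ)

      inCone-vanish : ∀ {n f} → 2 ℕ.* N ℕ.≤ n → InCone n f → f ≈ 0ₚ
      inCone-vanish 2N≤n ic ξ ξ< =
        cone-vanish (ℕ.<-≤-trans (ℕ.*-monoʳ-< 2 ξ<) 2N≤n) (inCone⇒cone ic ξ ξ<)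

    module Fixpoint (M′ : ℕ) where

      open System _⊕_ _⊛_ 0ₚ 1ₚ var x̂ q̂ M′ using (Approx; approx; next; iterate; next-h)

      private
        Agree : ℕ → Approx → Approx → Set
        Agree n (approx μ G h) (approx μ′ G′ h′) = (μ ≋[ n ] μ′) × (G ≋[ n ] G′) × (∀ e → h e ≋[ n ] h′ e)

        var-contract : ∀ {n f g} → f ≋[ n ] g → (var ⊛ f) ≋[ suc n ] (var ⊛ g)
        var-contract {f = f} {g} e zero    _         = 𝕊.trans (var-⊛-0 f) (𝕊.sym (var-⊛-0 g))
        var-contract {f = f} {g} e (suc i) (s≤s i<) = 𝕊.trans (var-⊛-suc f i) (𝕊.trans (e i i<) (𝕊.sym (var-⊛-suc g i)))

        -- The old components enter `G` and `h` only behind a factor y, which gains one coefficient;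
        -- `μ` then uses the gained agreement of these two.
        next-agree : ∀ n s t → Agree n s t → Agree (suc n) (next s) (next t)
        next-agree n (approx μ G h) (approx μ′ G′ h′) (eμ , eG , eh) = eμ⁺ , eG⁺ , eh⁺
          where
          module A = CommutativeRing (truncated n)
          module A⁺ = CommutativeRing (truncated (suc n))
          module S = SystemProperties (truncated n) var x̂ q̂ M′
          module S⁺ = SystemProperties (truncated (suc n)) var x̂ q̂ M′
          open Shuffle (truncated (suc n)) using (γ-cong)
          eG⁺ = A⁺.+-congˡ {x = 1ₚ} (var-contract (A.*-cong (A.*-congˡ {x = q̂} eμ) eG))
          eh⁺ : ∀ e → next-h G h e ≋[ suc n ] next-h G′ h′ e
          eh⁺ zero    = A⁺.refl
          eh⁺ (suc e) = var-contract (S.T-cong eG eh e)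
          eμ⁺ = A⁺.+-cong (A⁺.*-congˡ {x = q̂ ⊕ (q̂ ⊛ q̂)} (var-contract (A.*-cong eμ eμ))) (γ-cong M′ 1 (S⁺.T-cong eG⁺ eh⁺))

      -- In other words, `iterate n` solves the system modulo y^n.
      iterate-agree : ∀ n → Agree n (iterate n) (iterate (suc n))
      iterate-agree zero    = (λ _ ()) , (λ _ ()) , λ _ _ ()
      iterate-agree (suc n) = next-agree n (iterate n) (iterate (suc n)) (iterate-agree n)

    -- The first bound on the cut-off gives room to split off h 1, h 2 and h 3; the second makes
    -- every entry beyond the cut-off vanish modulo y^N.
    module Excess (N M′ : ℕ) (3≤M′ : 3 ℕ.≤ M′) (2N≤M : 2 ℕ.* N ℕ.≤ suc M′) where

      private module 𝔸 = CommutativeRing (truncated N)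
      open Truncation N using (ιₚ-≈; ιₚ-+; ιₚ-*; conic; inCone-q; inCone-yx; inCone-yxx; inCone⇒cone; inCone-vanish; InCone)
      open SystemProperties (truncated N) var x̂ q̂ M′
      open Shuffle (truncated N) using (γ-cong)

      μ G : PS
      μ = Approx.μ (iterate N)
      G = Approx.G (iterate N)

      h : ℕ → PS
      h = Approx.h (iterate N)

      private
        agree = Fixpoint.iterate-agree M′ N

        G-eq : G 𝔸.≈ next-G μ G
        G-eq = proj₁ (proj₂ agree)

        h-eq : ∀ e → h e 𝔸.≈ next-h G h e
        h-eq = proj₂ (proj₂ agree)

        μ-eq : μ 𝔸.≈ next-μ μ G h
        -- The iteration evaluates the last summand at the updated `G` and `h`, which agree with the
        -- old ones modulo y^N.
        μ-eq = 𝔸.trans (proj₁ agree) (𝔸.+-congˡ {x = (q̂ ⊕ (q̂ ⊛ q̂)) ⊛ (var ⊛ (μ ⊛ μ))}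
          (γ-cong M′ 1 (T-cong (𝔸.sym G-eq) (λ e → 𝔸.sym (h-eq e)))))

      module B = Bounds conic inCone-q inCone-yx inCone-yxx

      bounded : B.Bounded (iterate N)
      bounded = B.bounded-iterate N

      open Solution μ G h μ-eq G-eq h-eq public using (ν; v; R₀)
      open Solution μ G h μ-eq G-eq h-eq using (ν-eq; module WalkParameters)

      private
        C-eq : Ĉ 𝔸.≈ 1ₚ ⊕ x̂
        C-eq = 𝔸.trans (ιₚ-≈ C-x) (ιₚ-+ 𝕊.1# x)

        x-eq : x̂ 𝔸.≈ ẑ ⊛ (Ĉ ⊛ Ĉ)
        x-eq = 𝔸.trans (ιₚ-≈ x-z) (𝔸.trans (ιₚ-* z (C 𝕊.* C)) (𝔸.*-congˡ {x = ẑ} (ιₚ-* C C)))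

        p-eq : p̂ 𝔸.≈ 1ₚ ⊕ (x̂ ⊛ p̂)
        p-eq = 𝔸.trans (ιₚ-≈ p-x) (𝔸.trans (ιₚ-+ 𝕊.1# (x 𝕊.* p)) (𝔸.+-congˡ {x = 1ₚ} (ιₚ-* x p)))

        q-eq : q̂ 𝔸.≈ x̂ ⊛ p̂
        q-eq = ιₚ-* x p

      open WalkParameters ẑ Ĉ p̂ C-eq x-eq p-eq q-eq public using (B; o)
      open WalkParameters ẑ Ĉ p̂ C-eq x-eq p-eq q-eq using (W-eq; B-eq; yκ-eq; h-suc)

      module Walk (X : Set) where

        open Walks (truncated N)
        module Fut = Future {X} M B (var ⊛ κ G) h
        open Fut using (P; Ψ; ΣΨ; W) public

        P-vanish : ∀ f e → M ℕ.≤ e → P f e 𝔸.≈ 0ₚ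
        P-vanish f e M≤e = inCone-vanish (ℕ.≤-trans 2N≤M M≤e) (B.F-P {B = B} bounded f e)

        open Fut.Recursion o ẑ B-eq yκ-eq (h-eq 0) (h-suc {X}) P-vanish (s≤s z≤n) public using (Ψ-root; Ψ-step)

      o-⊛-0 : ∀ S → (o ⊛ S) 0 𝕊.≈ 𝕊.0#
      o-⊛-0 S = 𝕊.trans (⊛-assoc var ẑ S 0) (var-⊛-0 (ẑ ⊛ S))

      o-⊛-suc : ∀ S a → (o ⊛ S) (suc a) 𝕊.≈ z 𝕊.* S a
      o-⊛-suc S a = 𝕊.trans (⊛-assoc var ẑ S (suc a)) (𝕊.trans (var-⊛-suc (ẑ ⊛ S) a) (ιₚ-⊛ z S a))

      -- `Ψ` at the initial state, a root without explored children or ancestors. Written out, it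
      -- visibly does not depend on the type of labels.
      𝓥 : PS
      𝓥 = B ⊛ (1ₚ ⊛ Shuffle.γ (truncated N) M 1 h)

      𝓥-Ψ : ∀ X v → Walk.Ψ X (v , []) [] ≡ 𝓥
      𝓥-Ψ X v = ≡.refl


      𝓥-eq : ∀ ξ → ξ ℕ.< N → 𝓥 ξ 𝕊.≈ C 𝕊.* (1ₚ ξ 𝕊.+ p 𝕊.* ν ξ)
      𝓥-eq ξ ξ< = 𝕊.trans (W-eq ξ ξ<) (𝕊.trans (ιₚ-⊛ C (1ₚ ⊕ (p̂ ⊛ ν)) ξ) (𝕊.*-congˡ (𝕊.+-congˡ (ιₚ-⊛ p ν ξ))))

      ν-cone : ∀ ξ → ξ ℕ.< N → Cone 2 ξ (ν ξ)
      ν-cone = inCone⇒cone (B.Bounded.F-ν bounded)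

      private
        module Lead = SystemProperties.Leading (truncated N) var x̂ q̂ M′ conic inCone-q inCone-yx inCone-yxx μ G h μ-eq G-eq h-eq
          (B.Bounded.F-ν bounded) (B.Bounded.F-G bounded) (B.Bounded.F-h bounded) 3≤M′

        ω : PS
        ω = proj₁ Lead.R₀-leading

        R-cone : ∀ ξ → ξ ℕ.< N → Cone 2 ξ (R₀ ξ)
        R-cone = inCone⇒cone Lead.F-R₀

        ω-cone : ∀ ξ → ξ ℕ.< N → Cone 4 ξ (ω ξ)
        ω-cone = inCone⇒cone (proj₁ (proj₂ Lead.R₀-leading))

        ν-coeff : ∀ ξ → ξ ℕ.< N → ν ξ 𝕊.≈ (q 𝕊.+ q 𝕊.* q) 𝕊.* (ν ⊛ ν) ξ 𝕊.+ R₀ ξ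
        ν-coeff ξ ξ< = 𝕊.trans (ν-eq ξ ξ<) (𝕊.+-congʳ (begin
          ((q̂ ⊕ (q̂ ⊛ q̂)) ⊛ (ν ⊛ ν)) ξ ≈⟨ ⊛-distribʳ (ν ⊛ ν) q̂ (q̂ ⊛ q̂) ξ ⟩
          (q̂ ⊛ (ν ⊛ ν)) ξ 𝕊.+ ((q̂ ⊛ q̂) ⊛ (ν ⊛ ν)) ξ ≈⟨ 𝕊.+-congˡ (⊛-assoc q̂ q̂ (ν ⊛ ν) ξ) ⟩
          (q̂ ⊛ (ν ⊛ ν)) ξ 𝕊.+ (q̂ ⊛ (q̂ ⊛ (ν ⊛ ν))) ξ
            ≈⟨ 𝕊.+-cong (ιₚ-⊛ q (ν ⊛ ν) ξ) (𝕊.trans (ιₚ-⊛ q (q̂ ⊛ (ν ⊛ ν)) ξ) (𝕊.*-congˡ (ιₚ-⊛ q (ν ⊛ ν) ξ))) ⟩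
          q 𝕊.* (ν ⊛ ν) ξ 𝕊.+ q 𝕊.* (q 𝕊.* (ν ⊛ ν) ξ) ≈⟨ 𝕊.+-congˡ (𝕊.*-assoc q q _) ⟨
          q 𝕊.* (ν ⊛ ν) ξ 𝕊.+ q 𝕊.* q 𝕊.* (ν ⊛ ν) ξ ≈⟨ 𝕊.distribʳ _ _ _ ⟨
          (q 𝕊.+ q 𝕊.* q) 𝕊.* (ν ⊛ ν) ξ ∎))
          where open import Relation.Binary.Reasoning.Setoid 𝕊.setoid

        R-coeff : ∀ ξ → suc ξ ℕ.< N → R₀ (suc ξ) 𝕊.≈
                  x 𝕊.* (x 𝕊.* (1ₚ ξ 𝕊.+ (q 𝕊.* ν ξ 𝕊.+ q 𝕊.* ν ξ 𝕊.+ (q 𝕊.* ν ξ 𝕊.+ q 𝕊.* ν ξ) 𝕊.+ R₀ ξ))) 𝕊.+ ω (suc ξ)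
        R-coeff ξ ξ< = 𝕊.trans (proj₂ (proj₂ Lead.R₀-leading) (suc ξ) ξ<) (𝕊.+-congʳ (begin
          (var ⊛ (x̂ ⊛ (x̂ ⊛ S))) (suc ξ) ≈⟨ var-⊛-suc (x̂ ⊛ (x̂ ⊛ S)) ξ ⟩
          (x̂ ⊛ (x̂ ⊛ S)) ξ ≈⟨ 𝕊.trans (ιₚ-⊛ x (x̂ ⊛ S) ξ) (𝕊.*-congˡ (ιₚ-⊛ x S ξ)) ⟩
          x 𝕊.* (x 𝕊.* S ξ) ≈⟨ 𝕊.*-congˡ (𝕊.*-congˡ (𝕊.+-congˡ (𝕊.+-congʳ (𝕊.+-cong (𝕊.+-cong v-ν v-ν) (𝕊.+-cong v-ν v-ν))))) ⟩
          _ ∎))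
          where
          open import Relation.Binary.Reasoning.Setoid 𝕊.setoid
          S : PS
          S = 1ₚ ⊕ (((v ⊕ v) ⊕ (v ⊕ v)) ⊕ R₀)
          v-ν : v ξ 𝕊.≈ q 𝕊.* ν ξ
          v-ν = ιₚ-⊛ q ν ξ

      open LeadingTerms N ν R₀ ω ν-cone R-cone ω-cone ν-coeff R-coeff public using (a; τ; ψ; shape; Shape; r; ν-split)

      private
        ν₀ : 0 ℕ.< N → ν 0 𝕊.≈ 𝕊.0#
        ν₀ 0<N = cone-vanish (s≤s z≤n) (ν-cone 0 0<N)

      𝓥-zero : 0 ℕ.< N → 𝓥 0 𝕊.≈ C
      𝓥-zero 0<N = 𝕊.trans (𝓥-eq 0 0<N) (𝕊.trans
        (𝕊.*-congˡ (𝕊.trans (𝕊.+-congˡ (𝕊.trans (𝕊.*-congˡ (ν₀ 0<N)) (𝕊.zeroʳ p))) (𝕊.+-identityʳ 𝕊.1#))) (𝕊.*-identityʳ C))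

      𝓥-suc : ∀ n → suc n ℕ.< N → 𝓥 (suc n) 𝕊.≈ C 𝕊.* (p 𝕊.* ν (suc n))
      𝓥-suc n n<N = 𝕊.trans (𝓥-eq (suc n) n<N) (𝕊.*-congˡ (𝕊.+-identityˡ (p 𝕊.* ν (suc n))))

      open Polynomials
      open SecondCoefficient using (D; D-pos)

      -- The excess is ξ = n + 1. The factor p in front of the terms accounts for the exponent s + 1
      -- of 1/(1 - x) in the theorem.
      Expansion : ℕ → Set
      Expansion n = Σ[ ts ∈ List Term ]
          (𝓥 (suc n) 𝕊.≈ C 𝕊.* (p 𝕊.* value ts))
        × All (Admissible (suc n)) ts
        × (∀ s → s ℕ.≤ 2 ℕ.* n → Any (Leads (suc n) s) ts)
        × (coefficient ts (2 ℕ.* n) ≈ₚ monomial (Cat n) (2 ℕ.* suc n ℕ.+ 2 ℕ.* n))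
        × (∀ m → n ≡ suc m → coefficient ts (suc (2 ℕ.* m)) ≈ₚ monomial (D n) (2 ℕ.* suc n ℕ.+ suc (2 ℕ.* m)))

      private
        below : ∀ n {s} → s ℕ.+ 4 ℕ.≤ 2 ℕ.* suc n → 2 ℕ.+ s ℕ.≤ 2 ℕ.* n
        below n {s} le = ℕ.≤-pred (ℕ.≤-pred (≡.subst₂ ℕ._≤_ (ℕ.+-comm s 4) (ℕ.*-suc 2 n) le))

        remainder-adm : ∀ n (ms : List (Monomial 4 (suc n))) → All (Admissible (suc n)) (terms ms)
        remainder-adm n []       = []
        remainder-adm n (m ∷ ms) = (Monomial.coef≥0 m , Monomial.xdeg≤ m ,
          ℕ.≤-trans (ℕ.+-monoʳ-≤ (pdeg m) (ℕ.m≤n+m 2 2)) (Monomial.pdeg≤ m)) ∷ remainder-adm n ms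

        remainder-< : ∀ m (ms : List (Monomial 4 (2 ℕ.+ m))) → All (λ (_ , _ , s) → s ℕ.< suc (2 ℕ.* m)) (terms ms)
        remainder-< m []        = []
        remainder-< m (mo ∷ ms) = s≤s (ℕ.≤-pred (ℕ.≤-pred (subst (2 ℕ.+ pdeg mo ℕ.≤_) (ℕ.*-suc 2 m)
          (below (suc m) (Monomial.pdeg≤ mo))))) ∷ remainder-< m ms

        remainder-0 : (ms : List (Monomial 4 1)) → ⟦ ms ⟧ 𝕊.≈ 𝕊.0#
        remainder-0 []       = 𝕊.refl
        remainder-0 (m ∷ ms) = ⊥-elim (ℕ.<⇒≱ (s≤s (s≤s (s≤s (z≤n {1})))) (ℕ.≤-trans (ℕ.m≤n+m 4 (pdeg m)) (Monomial.pdeg≤ m)))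

        remainder-leads : ∀ m (ms : List (Monomial 4 (2 ℕ.+ m))) → (∀ s → 2 ℕ.+ s ℕ.≤ 2 ℕ.* suc m → HasLead s ms) →
                          ∀ s → s ℕ.< suc (2 ℕ.* m) → Any (Leads (2 ℕ.+ m) s) (terms ms)
        remainder-leads m ms leads s s< = Any.map⁺ (leads s (subst (2 ℕ.+ s ℕ.≤_) (≡.sym (ℕ.*-suc 2 m)) (s≤s s<)))

        -- Only the first two terms have the two top exponents of p, so the corresponding
        -- polynomials are single monomials.
        Expansion-suc : ∀ m → List (Monomial 4 (2 ℕ.+ m)) → List Term
        Expansion-suc m ms =
            (Cat (suc m) , 2 ℕ.* (2 ℕ.+ m) ℕ.+ 2 ℕ.* suc m , 2 ℕ.* suc m)
          ∷ (D (suc m) , 2 ℕ.* (2 ℕ.+ m) ℕ.+ suc (2 ℕ.* m) , suc (2 ℕ.* m))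
          ∷ terms ms

        admissible : ∀ m ms → All (Admissible (2 ℕ.+ m)) (Expansion-suc m ms)
        admissible m ms =
            (ℚ.<⇒≤ (Cat>0 m) , ℕ.≤-refl , ℕ.≤-reflexive (≡.trans (ℕ.+-comm (2 ℕ.* suc m) 2) (≡.sym (ℕ.*-suc 2 (suc m)))))
          ∷ (ℚ.<⇒≤ (D-pos m) , ℕ.≤-refl , ℕ.≤-trans (ℕ.≤-reflexive (≡.sym (ℕ.+-suc (2 ℕ.* m) 2))) (order m))
          ∷ remainder-adm (suc m) ms
          where
          open ℕSolver.+-*-Solver
          Cat>0 : ∀ m → 0ℚ ℚ.< Cat (suc m)
          Cat>0 m = ℚ.positive⁻¹ (Cat (suc m)) {{Catalan.Cat-pos (suc m)}}
          order : ∀ m → 2 ℕ.* m ℕ.+ 3 ℕ.≤ 2 ℕ.* suc (suc m)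
          order m = subst (2 ℕ.* m ℕ.+ 3 ℕ.≤_) (solve 1 (λ m → con 2 :* m :+ con 4 := con 2 :* (con 2 :+ m)) ≡.refl m)
            (ℕ.+-monoʳ-≤ (2 ℕ.* m) (ℕ.n≤1+n 3))

        value-suc : ∀ m ms → r (suc m) 𝕊.≈ ⟦ ms ⟧ → ν (2 ℕ.+ m) 𝕊.≈ value (Expansion-suc m ms)
        value-suc m ms eq = 𝕊.trans (ν-split (suc m)) (𝕊.+-congˡ (𝕊.+-congˡ (𝕊.trans eq (𝕊.reflexive (≡.sym (value-terms ms))))))

        value-0 : ∀ ms → r 0 𝕊.≈ ⟦ ms ⟧ → ν 1 𝕊.≈ value ((1ℚ , 2 , 0) ∷ [])
        value-0 ms eq = 𝕊.trans (ν-split 0) (𝕊.+-congˡ (𝕊.trans (𝕊.+-identityˡ (r 0)) (𝕊.trans eq (remainder-0 ms))))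

      expansion : ∀ n → suc n ℕ.< N → Expansion n
      expansion zero lt =
        (1ℚ , 2 , 0) ∷ [] ,
        𝕊.trans (𝓥-suc 0 lt) (𝕊.*-congˡ (𝕊.*-congˡ (value-0 (proj₁ (shape 0 lt)) (proj₁ (proj₂ (shape 0 lt)))))) ,
        (ℚ.nonNegative⁻¹ 1ℚ , ℕ.≤-refl , ℕ.≤-refl) ∷ [] ,
        (λ { .0 z≤n → here (≡.refl , ≡.refl , ℚ.positive⁻¹ 1ℚ) }) ,
        coefficient-only {1ℚ} {2} {0} [] [] ,
        λ m ()
      expansion (suc m) lt = build (shape (suc m) lt)
        where
        build : Shape (suc m) → Expansion (suc m)
        build (ms , eq , leads) =
          Expansion-suc m ms ,
          𝕊.trans (𝓥-suc (suc m) lt) (𝕊.*-congˡ (𝕊.*-congˡ (value-suc m ms eq))) ,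
          admissible m ms ,
          leads-∷∷ (2 ℕ.+ m) (terms ms) (ℚ.positive⁻¹ (Cat (suc m)) {{Catalan.Cat-pos (suc m)}}) (D-pos m) (ℕ.*-suc 2 m)
            (remainder-leads m ms leads) ,
          coefficient-first (terms ms) t₂<t₁ (remainder-< m ms) ,
          second
          where
          t₂<t₁ : suc (2 ℕ.* m) ℕ.< 2 ℕ.* suc m
          t₂<t₁ = ℕ.≤-reflexive (≡.sym (ℕ.*-suc 2 m))
          second : ∀ k → suc m ≡ suc k → coefficient (Expansion-suc m ms) (suc (2 ℕ.* k))
                   ≈ₚ monomial (D (suc m)) (2 ℕ.* (2 ℕ.+ m) ℕ.+ suc (2 ℕ.* k))
          second .m ≡.refl = coefficient-second (terms ms) t₂<t₁ (remainder-< m ms)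

-- Identifying the excess series with the generating functions of tree walks.

module WalkSeries where

  open PowerSeriesRings
  open ForestWalks
  open CatalanSeries using (module Rationals; module SeriesRing)
  open LabelledForests using (module Counts)
  open WalkCounting using (module Counting)
  open ExcessExpansion using (module ExcessSeries)
  open import Defs
  open import Data.Nat.Base as ℕ using (ℕ; zero; suc; s≤s; _!)
  import Data.Nat.Properties as ℕ
  open import Data.Nat.ListAction using (sum)
  open import Data.Integer.Base as ℤ using (+_; -[1+_]; _⊖_)
  import Data.Integer.Properties as ℤ
  open import Data.Rational.Base as ℚ using (ℚ; 0ℚ; 1ℚ; _/_)
  import Data.Rational.Properties as ℚ
  open import Data.Fin.Base using (Fin; zero; suc)
  open import Data.List.Base as List using (List; []; _∷_; length; filter; allFin; map)
  import Data.List.Properties as List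
  open import Data.Vec.Base using ([]; _∷_)
  open import Data.Product using (_×_; _,_; proj₁)
  open import Relation.Binary.PropositionalEquality as ≡ using (_≡_; refl; sym; trans; cong)
  open import Relation.Binary.Definitions using (Tri; tri<; tri≈; tri>)

  module Scalars where

    open SeriesRing using (ι; ι-⊛)

    ι-+ : ∀ c d n → ι (c ℚ.+ d) n ≡ ι c n ℚ.+ ι d n
    ι-+ c d zero    = refl
    ι-+ c d (suc n) = refl

    ι-* : ∀ c d n → ι (c ℚ.* d) n ≡ (ι c *ₛ ι d) n
    ι-* c d n = sym (trans (ι-⊛ c (ι d) n) (scale n))
      where
      scale : ∀ n → c ℚ.* ι d n ≡ ι (c ℚ.* d) n
      scale zero    = refl
      scale (suc n) = ℚ.*-zeroʳ c

    ι-0 : ∀ n → ι 0ℚ n ≡ 0ℚ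
    ι-0 zero    = refl
    ι-0 (suc n) = refl

    ι-1 : ∀ n → ι 1ℚ n ≡ ι 1ℚ n
    ι-1 n = refl

  module E = ExcessSeries SeriesRing.𝕊 zC² 1/[1-zC²] z C SeriesRing.ι
    Scalars.ι-+ Scalars.ι-* Scalars.ι-0 Scalars.ι-1 SeriesRing.C-x SeriesRing.zC²-eq SeriesRing.p-eq

  module Enumeration (N M′ : ℕ) (3≤M′ : 3 ℕ.≤ M′) (2N≤M : 2 ℕ.* N ℕ.≤ suc M′) where

    open E using (_⊛_; ẑ; 1ₚ; ιₚ-⊛)
    open E.Excess N M′ 3≤M′ 2N≤M using (o; o-⊛-0; o-⊛-suc; 𝓥; 𝓥-Ψ; module Walk)

    module _ {X : Set} where

      open Walk X using (Ψ; ΣΨ; Ψ-root; Ψ-step)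

      Φ : Frame X → List (Frame X) → ℕ → ℕ → ℚ
      Φ = Ψ

      ΣΦ : X → List (Frame X) → List (Tree X × List (Tree X)) → ℕ → ℕ → ℚ
      ΣΦ = ΣΨ

      down up new : ℕ → ℕ → Frame X → List (Frame X) → ℚ
      down a n (l , f) fs = (o ⊛ ΣΨ l fs (selections f)) a n
      up a n x []                    = 1ₚ a n
      up a n (l , f) ((l₁ , f₁) ∷ fs) = Ψ (l₁ , node l f ∷ f₁) fs a n
      new a n x fs = (ẑ ⊛ Ψ (proj₁ x , []) (x ∷ fs)) a n

      down-00 : ∀ n x fs → down 0 n x fs ≡ 0ℚ
      down-00 n (l , f) fs = o-⊛-0 (ΣΨ l fs (selections f)) n

      down-0 : ∀ a x fs → down a 0 x fs ≡ 0ℚ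
      down-0 zero    x       fs = down-00 0 x fs
      down-0 (suc a) (l , f) fs =
        trans (o-⊛-suc (ΣΨ l fs (selections f)) a 0) (SeriesRing.z*-0 (ΣΨ l fs (selections f) a))

      down-ss : ∀ a n l f fs → down (suc a) (suc n) (l , f) fs ≡ ΣΦ l fs (selections f) a n
      down-ss a n l f fs =
        trans (o-⊛-suc (ΣΨ l fs (selections f)) a (suc n)) (SeriesRing.z*-suc (ΣΨ l fs (selections f) a) n)

      new-0 : ∀ a x fs → new a 0 x fs ≡ 0ℚ
      new-0 a x fs = trans (ιₚ-⊛ z (Ψ (proj₁ x , []) (x ∷ fs)) a 0) (SeriesRing.z*-0 (Ψ (proj₁ x , []) (x ∷ fs) a))

      new-s : ∀ a n x fs v → new a (suc n) x fs ≡ Φ (v , []) (x ∷ fs) a n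
      new-s a n x fs v = trans (ιₚ-⊛ z (Ψ (proj₁ x , []) (x ∷ fs)) a (suc n)) (SeriesRing.z*-suc (Ψ (proj₁ x , []) (x ∷ fs) a) n)

      up-sn : ∀ a n x → up a (suc n) x [] ≡ 0ℚ
      up-sn zero    n x = refl
      up-sn (suc a) n x = refl

      Φ-rec : ∀ {a} n x fs → a ℕ.< N → Φ x fs a n ≡ up a n x fs ℚ.+ (down a n x fs ℚ.+ new a n x fs)
      Φ-rec {a} n (l , f) []                a<N = Ψ-root l f l a a<N n
      Φ-rec {a} n (l , f) ((l₁ , f₁) ∷ fs) a<N = Ψ-step l f l₁ f₁ fs l a a<N n

    recurrence : ∀ {m} (root : Fin m) → Counting.Recurrence root N
    recurrence root = record
      { Φ = Φ ; ΣΦ = ΣΦ ; down = down ; up = up ; new = new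
      ; ΣΦ-[] = λ _ _ _ _ → refl ; ΣΦ-∷ = λ _ _ _ _ _ _ _ _ → refl
      ; down-00 = down-00 ; down-0 = down-0 ; down-ss = down-ss ; new-0 = new-0 ; new-s = new-s
      ; up-0 = λ _ → refl ; up-sa = λ _ _ _ → refl ; up-sn = up-sn ; up-∷ = λ _ _ _ _ _ _ _ → refl
      ; Φ-rec = Φ-rec }

    private
      Φ-𝓥 : ∀ {X : Set} (v : X) a n → Φ (v , []) [] a n ≡ 𝓥 a n
      Φ-𝓥 {X} v a n = cong (λ S → S a n) (𝓥-Ψ X v)

    -- Any label set with a root gives access to the recurrence; one vertex is enough.
    𝓥-vanish : ∀ ξ ℓ → ξ ℕ.< N → ℓ ℕ.< ξ → 𝓥 ξ ℓ ≡ 0ℚ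
    𝓥-vanish ξ ℓ ξ<N ℓ<ξ = trans (sym (Φ-𝓥 {Fin 1} zero ξ ℓ)) (Counting.Closed.Φ-vanish {1} zero (recurrence zero) ℓ (zero , []) [] ξ<N ℓ<ξ)

    -- There are b + 1 choices of the root, and `b !` orders of the other labels for each.
    w-count : ∀ L a b → suc L ≡ 2 ℕ.* (a ℕ.+ b) → a ℕ.< N →
              fromℕ (w (suc b) (suc L)) ≡ fromℕ (suc b !) ℚ.* 𝓥 a (a ℕ.+ b)
    w-count L a b eq a<N = begin
      fromℕ (w (suc b) (suc L))
        ≡⟨ cong fromℕ (Counts.length-filter-allVecs L isTreeWalk? (allFin (suc b))) ⟩
      fromℕ (sum (map F (allFin (suc b)))) ≡⟨ Counts.fromℕ-sum F (allFin (suc b)) ⟩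
      Counts.Σℚ (λ v → fromℕ (F v)) (allFin (suc b))
        ≡⟨ Counts.Σℚ-const (λ v → fromℕ (F v)) (fromℕ (b !) ℚ.* 𝓥 a (a ℕ.+ b)) (allFin (suc b))
             (λ v _ → trans (Counting.Closed.count-from-root v (recurrence v) L a b eq refl a<N) (cong (fromℕ (b !) ℚ.*_) (Φ-𝓥 v a (a ℕ.+ b)))) ⟩
      fromℕ (length (allFin (suc b))) ℚ.* (fromℕ (b !) ℚ.* 𝓥 a (a ℕ.+ b))
        ≡⟨ cong (λ k → fromℕ k ℚ.* (fromℕ (b !) ℚ.* 𝓥 a (a ℕ.+ b))) (List.length-tabulate {n = suc b} (λ i → i)) ⟩
      fromℕ (suc b) ℚ.* (fromℕ (b !) ℚ.* 𝓥 a (a ℕ.+ b)) ≡⟨ ℚ.*-assoc (fromℕ (suc b)) (fromℕ (b !)) (𝓥 a (a ℕ.+ b)) ⟨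
      fromℕ (suc b) ℚ.* fromℕ (b !) ℚ.* 𝓥 a (a ℕ.+ b) ≡⟨ cong (ℚ._* 𝓥 a (a ℕ.+ b)) (Rationals.fromℕ-* (suc b) (b !)) ⟨
      fromℕ (suc b !) ℚ.* 𝓥 a (a ℕ.+ b) ∎
      where
      open ≡.≡-Reasoning
      F : Fin (suc b) → ℕ
      F v = length (filter (λ vs → isTreeWalk? (v ∷ vs)) (allVecs (allFin (suc b)) L))

  module Normalised (N : ℕ) (V : ℕ → ℕ → ℚ) (V₀ : V 0 0 ≡ 1ℚ)
    (V-vanish : ∀ ξ ℓ → ξ ℕ.< N → ℓ ℕ.< ξ → V ξ ℓ ≡ 0ℚ)
    (w-count : ∀ L a b → suc L ≡ 2 ℕ.* (a ℕ.+ b) → a ℕ.< N →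
               fromℕ (w (suc b) (suc L)) ≡ fromℕ (suc b !) ℚ.* V a (a ℕ.+ b)) where

    private
      divide : ∀ a k .{{_ : ℕ.NonZero k}} c → fromℕ a ≡ fromℕ k ℚ.* c → (+ a / k) ≡ c
      divide a (suc k) c eq = Rationals.fromℕ-cancelˡ k (trans (Rationals.fromℕ-*-/ a k) eq)

      negative : ∀ ξ ℓ → suc ℓ ℕ.< ξ → suc ℓ ⊖ ξ ≡ -[1+ ℕ.pred (ξ ℕ.∸ suc ℓ) ]
      negative ξ ℓ lt = trans (ℤ.⊖-< lt) (neg (ξ ℕ.∸ suc ℓ) (ℕ.m<n⇒0<n∸m lt))
        where
        neg : ∀ k → 0 ℕ.< k → ℤ.- (+ k) ≡ -[1+ ℕ.pred k ]
        neg (suc k) _ = refl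

      no-walks : ∀ ℓ → w/! (+ 0) (2 ℕ.* ℓ) ≡ 0ℚ
      no-walks zero    = refl
      no-walks (suc ℓ) = refl

      -- The walk of length 0 is treated apart, because the count splits off the first vertex.
      walks : ∀ ξ ℓ b → ξ ℕ.< N → ξ ℕ.+ b ≡ ℓ → w/! (+ suc b) (2 ℕ.* ℓ) ≡ V ξ ℓ
      walks zero zero    zero ξ<N eq = sym V₀
      walks ξ    (suc ℓ) b    ξ<N eq = divide (w (suc b) (2 ℕ.* suc ℓ)) (suc b !) {{suc b ℕ.!≢0}} (V ξ (suc ℓ))
        (trans (w-count (ℓ ℕ.+ suc (ℓ ℕ.+ 0)) ξ b (cong (2 ℕ.*_) (sym eq)) ξ<N) (cong (λ k → fromℕ (suc b !) ℚ.* V ξ k) eq))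

    𝓦-V : ∀ ξ ℓ → ξ ℕ.< N → 𝓦 ξ ℓ ≡ V ξ ℓ
    𝓦-V ξ ℓ ξ<N = go (ℕ.<-cmp (suc ℓ) ξ)
      where
      go : Tri (suc ℓ ℕ.< ξ) (suc ℓ ≡ ξ) (ξ ℕ.< suc ℓ) → 𝓦 ξ ℓ ≡ V ξ ℓ
      go (tri< lt _ _) = trans (cong (λ k → w/! k (2 ℕ.* ℓ)) (negative ξ ℓ lt)) (sym (V-vanish ξ ℓ ξ<N (ℕ.<⇒≤ lt)))
      go (tri≈ _ refl _) = trans (cong (λ k → w/! k (2 ℕ.* ℓ)) (ℤ.n⊖n≡0 (suc ℓ)))
        (trans (no-walks ℓ) (sym (V-vanish (suc ℓ) ℓ ξ<N ℕ.≤-refl)))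
      go (tri> _ _ (s≤s ξ≤ℓ)) = trans (cong (λ k → w/! k (2 ℕ.* ℓ)) (trans (ℤ.⊖-≥ (ℕ.m≤n⇒m≤1+n ξ≤ℓ)) (cong +_ (ℕ.+-∸-assoc 1 ξ≤ℓ))))
        (walks ξ ℓ (ℓ ℕ.∸ ξ) ξ<N (ℕ.m+[n∸m]≡n ξ≤ℓ))

-- Evaluating the collected polynomials at zC².

module Evaluations where

  open CatalanSeries using (module SeriesRing)
  open WalkSeries
  open PolynomialTerms
  open import Defs
  open import Algebra.Bundles using (CommutativeRing)
  open import Data.Nat.Base as ℕ using (ℕ; zero; suc; s≤s)
  import Data.Nat.Properties as ℕ
  open import Data.Rational.Base as ℚ using (ℚ; 0ℚ; 1ℚ)
  import Data.Rational.Properties as ℚ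
  open import Data.Fin.Base using (zero; suc; toℕ)
  open import Data.List.Base using (List; []; _∷_)
  open import Data.List.Relation.Unary.All using (All; []; _∷_)
  open import Data.List.Relation.Unary.Any using (Any)
  open import Data.Product using (_,_; Σ-syntax; ∃-syntax)
  open import Data.Empty using (⊥-elim)
  open import Function using (_∘_)
  open import Relation.Nullary using (yes; no)
  open import Relation.Binary.PropositionalEquality as ≡ using (_≡_; _≢_; refl; sym; trans; cong; cong₂)
  open import Algebra.Properties.Monoid.Sum ℚ.+-0-monoid using (sum-syntax; sum-cong-≗)

  module Evaluation where

    open Polynomials

    open CommutativeRing SeriesRing.𝕊 using (+-cong; +-congʳ; *-congˡ; *-congʳ)
      renaming (_≈_ to _≈ᵣ_; _*_ to _*ᵣ_; _+_ to _+ᵣ_; 0# to 0ᵣ; refl to ≈-refl; trans to ≈-trans)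
    open import Algebra.Solver.Ring.NaturalCoefficients.Default (CommutativeRing.commutativeSemiring SeriesRing.𝕊)
      using (solve; _:+_; _:*_; _:=_; con)

    private
      const0 : const 0ℚ ≈ᵣ 0ᵣ
      const0 zero    = refl
      const0 (suc n) = refl

    eval-+ : ∀ f g X → eval (f +ₚ g) X ≈ᵣ eval f X +ᵣ eval g X
    eval-+ []      g       X n = sym (trans (cong (ℚ._+ eval g X n) (const0 n)) (ℚ.+-identityˡ _))
    eval-+ (a ∷ f) []      X n = sym (trans (cong (eval (a ∷ f) X n ℚ.+_) (const0 n)) (ℚ.+-identityʳ _))
    eval-+ (a ∷ f) (b ∷ g) X = ≈-trans
      (+-cong (const-+ a b) (*-congˡ {x = X} (eval-+ f g X)))
      (solve 5 (λ a b X f g → (a :+ b) :+ X :* (f :+ g) := (a :+ X :* f) :+ (b :+ X :* g)) ≈-refl (const a) (const b) X (eval f X) (eval g X))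
      where
      const-+ : ∀ a b → const (a ℚ.+ b) ≈ᵣ const a +ᵣ const b
      const-+ a b zero    = refl
      const-+ a b (suc n) = refl

    open E using (_^_; term; value)

    eval-monomial : ∀ c d X → eval (monomial c d) X ≈ᵣ SeriesRing.ι c *ᵣ X ^ d
    eval-monomial c zero    X = ≈-trans (+-cong (SeriesRing.const≈ι c) (*-congˡ {x = X} const0))
      (solve 2 (λ c X → c :+ X :* con 0 := c :* con 1) ≈-refl (SeriesRing.ι c) X)
    eval-monomial c (suc d) X = ≈-trans (+-cong const0 (*-congˡ {x = X} (eval-monomial c d X)))
      (solve 3 (λ c X Y → con 0 :+ X :* (c :* Y) := c :* (X :* Y)) ≈-refl (SeriesRing.ι c) X (X ^ d))

    private
      -- One further term of the list changes `coefficient` at a single exponent, hence a single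
      -- summand.
      ∑-update : ∀ n (F F′ : ℕ → ℚ) t s → s ℕ.≤ n → F′ s ≡ t ℚ.+ F s → (∀ r → r ≢ s → F′ r ≡ F r) →
                 ∑[ r < suc n ] F′ (toℕ r) ≡ t ℚ.+ ∑[ r < suc n ] F (toℕ r)
      ∑-update n F F′ t zero _ e eq = trans
        (cong₂ ℚ._+_ e (sum-cong-≗ {n} (λ r → eq (suc (toℕ r)) (λ ())))) (ℚ.+-assoc t (F 0) _)
      ∑-update (suc n) F F′ t (suc s) (s≤s s≤n) e eq = begin
        F′ 0 ℚ.+ ∑[ r < suc n ] F′ (suc (toℕ r))
          ≡⟨ cong₂ ℚ._+_ (eq 0 (λ ())) (∑-update n (F ∘ suc) (F′ ∘ suc) t s s≤n e (λ r r≢ → eq (suc r) (r≢ ∘ ℕ.suc-injective))) ⟩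
        F 0 ℚ.+ (t ℚ.+ ∑[ r < suc n ] F (suc (toℕ r))) ≡⟨ ℚ.+-assoc (F 0) t _ ⟨
        F 0 ℚ.+ t ℚ.+ ∑[ r < suc n ] F (suc (toℕ r)) ≡⟨ cong (ℚ._+ ∑[ r < suc n ] F (suc (toℕ r))) (ℚ.+-comm (F 0) t) ⟩
        t ℚ.+ F 0 ℚ.+ ∑[ r < suc n ] F (suc (toℕ r)) ≡⟨ ℚ.+-assoc t (F 0) _ ⟩
        t ℚ.+ (F 0 ℚ.+ ∑[ r < suc n ] F (suc (toℕ r))) ∎
        where open ≡.≡-Reasoning

      ^-^ₛ : ∀ f n → f ^ₛ n ≈ᵣ f ^ n
      ^-^ₛ f zero    = SeriesRing.const≈ι 1ℚ
      ^-^ₛ f (suc n) = *-congˡ {x = f} (^-^ₛ f n)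

    x p : Series
    x = zC²
    p = 1/[1-zC²]

    -- Sorting by the exponent of p; the factor p in front turns p^s into p^(s+1).
    collect : ∀ n ts → All (λ (_ , _ , s) → s ℕ.≤ n) ts →
              p *ᵣ value ts ≈ᵣ ∑ₛ n (λ s → eval (coefficient ts s) x *ₛ p ^ₛ suc s)
    collect n []                 []         k = trans (CommutativeRing.zeroʳ SeriesRing.𝕊 p k) (sym (zeros n k))
      where
      zeros : ∀ n k → ∑[ s < suc n ] (eval [] x *ₛ p ^ₛ suc (toℕ s)) k ≡ 0ℚ
      zeros n k = trans (sum-cong-≗ {suc n} (λ s → trans (SeriesRing.const-* 0ℚ (p ^ₛ suc (toℕ s)) k) (ℚ.*-zeroˡ ((p ^ₛ suc (toℕ s)) k)))) (sum-0 (suc n))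
        where
        sum-0 : ∀ n → ∑[ s < n ] 0ℚ ≡ 0ℚ
        sum-0 zero    = refl
        sum-0 (suc n) = trans (ℚ.+-identityˡ _) (sum-0 n)
    collect n ((c , a , t) ∷ ts) (t≤ ∷ ts≤) k = begin
      (p *ᵣ (term c a t +ᵣ value ts)) k ≡⟨ CommutativeRing.distribˡ SeriesRing.𝕊 p (term c a t) (value ts) k ⟩
      (p *ᵣ term c a t) k ℚ.+ (p *ᵣ value ts) k ≡⟨ cong ((p *ᵣ term c a t) k ℚ.+_) (collect n ts ts≤ k) ⟩
      (p *ᵣ term c a t) k ℚ.+ ∑[ s < suc n ] (eval (coefficient ts (toℕ s)) x *ₛ p ^ₛ suc (toℕ s)) k
        ≡⟨ ∑-update n F F′ ((p *ᵣ term c a t) k) t t≤ here-eq there-eq ⟨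
      ∑[ s < suc n ] (eval (coefficient ((c , a , t) ∷ ts) (toℕ s)) x *ₛ p ^ₛ suc (toℕ s)) k ∎
      where
      open ≡.≡-Reasoning
      F F′ : ℕ → ℚ
      F  s = (eval (coefficient ts s) x *ₛ p ^ₛ suc s) k
      F′ s = (eval (coefficient ((c , a , t) ∷ ts) s) x *ₛ p ^ₛ suc s) k
      there-eq : ∀ s → s ≢ t → F′ s ≡ F s
      there-eq s s≢t = cong (λ f → (eval f x *ₛ p ^ₛ suc s) k) (coefficient-skip ts (s≢t ∘ sym))
      hit : coefficient ((c , a , t) ∷ ts) t ≡ monomial c a +ₚ coefficient ts t
      hit with t ℕ.≟ t
      ... | yes _   = refl
      ... | no  t≢t = ⊥-elim (t≢t refl)
      here-eq : F′ t ≡ (p *ᵣ term c a t) k ℚ.+ F t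
      here-eq = begin
        (eval (coefficient ((c , a , t) ∷ ts) t) x *ₛ p ^ₛ suc t) k ≡⟨ cong (λ f → (eval f x *ₛ p ^ₛ suc t) k) hit ⟩
        (eval (monomial c a +ₚ coefficient ts t) x *ₛ p ^ₛ suc t) k
          ≡⟨ *-congʳ {x = p ^ₛ suc t} (≈-trans (eval-+ (monomial c a) (coefficient ts t) x) (+-congʳ {x = eval (coefficient ts t) x} (eval-monomial c a x))) k ⟩
        ((SeriesRing.ι c *ᵣ x ^ a +ᵣ eval (coefficient ts t) x) *ₛ p ^ₛ suc t) k
          ≡⟨ CommutativeRing.distribʳ SeriesRing.𝕊 (p ^ₛ suc t) (SeriesRing.ι c *ᵣ x ^ a) (eval (coefficient ts t) x) k ⟩
        (SeriesRing.ι c *ᵣ x ^ a *ᵣ (p *ᵣ p ^ₛ t)) k ℚ.+ F t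
          ≡⟨ cong (ℚ._+ F t) (*-congˡ {x = SeriesRing.ι c *ᵣ x ^ a} (*-congˡ {x = p} (^-^ₛ p t)) k) ⟩
        (SeriesRing.ι c *ᵣ x ^ a *ᵣ (p *ᵣ p ^ t)) k ℚ.+ F t
          ≡⟨ cong (ℚ._+ F t) (solve 4 (λ c x p q → c :* x :* (p :* q) := p :* (c :* (x :* q))) ≈-refl (SeriesRing.ι c) (x ^ a) p (p ^ t) k) ⟩
        (p *ᵣ term c a t) k ℚ.+ F t ∎

open import Defs
open import Data.Nat using (ℕ; suc; _+_; _*_; _∸_; _≤_)
open import Data.Product using (_×_; ∃-syntax; Σ-syntax)
import Data.Rational as ℚ
open CatalanSeries using (module SeriesRing)
open LeadingCones using (module SecondCoefficient)
open WalkSeries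
open PolynomialTerms
open Evaluations
open import Algebra.Bundles using (CommutativeRing)
open import Data.Nat using (zero; z≤n; s≤s)
import Data.Nat as ℕ
import Data.Nat.Properties as ℕ
import Data.Nat.Solver as ℕSolver
import Data.Rational.Properties as ℚ
open import Data.List.Base using (List)
open import Data.List.Relation.Unary.All as All using (All)
open import Data.List.Relation.Unary.Any using (Any)
open import Data.Product using (_,_; proj₂)
open import Relation.Binary.PropositionalEquality as ≡ using (_≡_; refl; sym; trans; cong; cong₂; subst)

-- The expansion of each generating function from a sufficiently long truncation.

module Extraction where

  open Polynomials
  open Evaluation using (x; p; collect)
  open SecondCoefficient using (D)

  private
    module 𝕊 = CommutativeRing SeriesRing.𝕊

  Coefficients : ℕ → List Term → Set
  Coefficients n ts =
      All (Admissible (suc n)) ts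
    × (∀ s → s ≤ 2 * n → Any (Leads (suc n) s) ts)
    × (coefficient ts (2 * n) ≈ₚ monomial (Cat n) (2 * suc n + 2 * n))
    × (∀ m → n ≡ suc m → coefficient ts (suc (2 * m)) ≈ₚ monomial (D n) (2 * suc n + suc (2 * m)))

  Represents : ℕ → List Term → Set
  Represents n ts = 𝓦 (suc n) ≈ₛ C *ₛ ∑ₛ (2 * n) (λ s → eval (coefficient ts s) x *ₛ p ^ₛ suc s)

  module _ (N M′ : ℕ) (3≤M′ : 3 ≤ M′) (2N≤M : 2 * N ≤ suc M′) where

    open E.Excess N M′ 3≤M′ 2N≤M using (𝓥; 𝓥-zero; expansion)
    open Enumeration N M′ 3≤M′ 2N≤M using (𝓥-vanish; w-count)

    𝓦-𝓥 : ∀ ξ → ξ ℕ.< N → ∀ ℓ → 𝓦 ξ ℓ ≡ 𝓥 ξ ℓ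
    𝓦-𝓥 ξ ξ<N ℓ = Normalised.𝓦-V N 𝓥 (𝓥-zero (ℕ.≤-<-trans z≤n ξ<N) 0) 𝓥-vanish w-count ξ ℓ ξ<N

    𝓦-zero : 0 ℕ.< N → 𝓦 0 ≈ₛ C
    𝓦-zero 0<N ℓ = trans (𝓦-𝓥 0 0<N ℓ) (𝓥-zero 0<N ℓ)

    𝓦-suc : ∀ n → suc n ℕ.< N → Σ[ ts ∈ List Term ] Represents n ts × Coefficients n ts
    𝓦-suc n n<N = build (expansion n n<N)
      where
      build : E.Excess.Expansion N M′ 3≤M′ 2N≤M n → _
      build (ts , eq , adm , rest) = ts ,
        (λ ℓ → trans (𝓦-𝓥 (suc n) n<N ℓ) (trans (eq ℓ) (𝕊.*-congˡ {x = C} (collect (2 * n) ts (All.map bound adm)) ℓ))) ,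
        adm , rest
        where
        bound : ∀ {t} → Admissible (suc n) t → proj₂ (proj₂ t) ≤ 2 * n
        bound {_ , _ , s} (_ , _ , s+2≤) = ℕ.≤-pred (ℕ.≤-pred (≡.subst₂ _≤_ (ℕ.+-comm s 2) (ℕ.*-suc 2 n) s+2≤))

open Polynomials
open SecondCoefficient using (D)

theorem1 : (∃[ r ] IsSqrt r (1ₛ -ₛ const (fromℕ 4) *ₛ z)
    × const (fromℕ 2) *ₛ z *ₛ C ≈ₛ 1ₛ -ₛ r)
    × 𝓦 0 ≈ₛ C
    × (∀ (ξ : ℕ) → 1 ≤ ξ →
    Σ[ K ∈ (ℕ → Poly) ]
    (∀ s → s ≤ 2 * ξ ∸ 2 →
    NonNegCoeffs (K s) × HasDegree (K s) (2 * ξ + s))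
    × 𝓦 ξ ≈ₛ C *ₛ ∑ₛ (2 * ξ ∸ 2) (λ s → eval (K s) zC² *ₛ 1/[1-zC²] ^ₛ suc s)
    × K (2 * ξ ∸ 2) ≈ₚ monomial (Cat (ξ ∸ 1)) (4 * ξ ∸ 2)
    × (2 ≤ ξ →
    K (2 * ξ ∸ 3)
    ≈ₚ monomial (fromℕ (3 * ξ ∸ 1) ℚ.* Cat (ξ ∸ 1)) (4 * ξ ∸ 3)))
theorem1 = SeriesRing.sqrt-1-4z
         , Extraction.𝓦-zero 1 3 ℕ.≤-refl (s≤s (s≤s z≤n)) (s≤s z≤n)
         -- N must exceed ξ = n + 1, and M′ = 3 + 2N satisfies both requirements on the cut-off.
         , λ { (suc n) _ → build n (Extraction.𝓦-suc (2 + n) (3 + 2 * (2 + n)) (s≤s (s≤s (s≤s z≤n)))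
                                     (ℕ.m≤n+m (2 * (2 + n)) 4) n ℕ.≤-refl) }
  where
  open ℕSolver.+-*-Solver

  even : ∀ n → 2 * suc n ∸ 2 ≡ 2 * n
  even n = cong (_∸ 2) (ℕ.*-suc 2 n)

  odd : ∀ m → 2 * (2 + m) ∸ 3 ≡ suc (2 * m)
  odd m = cong (_∸ 3) (solve 1 (λ m → con 2 :* (con 2 :+ m) := con 4 :+ con 2 :* m) refl m)

  top-degree : ∀ n → 2 * suc n + 2 * n ≡ 4 * suc n ∸ 2
  top-degree n = cong (_∸ 2) (solve 1 (λ n → con 2 :+ (con 2 :* (con 1 :+ n) :+ con 2 :* n) := con 4 :* (con 1 :+ n)) refl n)

  second-degree : ∀ m → 2 * (2 + m) + suc (2 * m) ≡ 4 * (2 + m) ∸ 3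
  second-degree m = cong (_∸ 3) (solve 1 (λ m → con 3 :+ (con 2 :* (con 2 :+ m) :+ (con 1 :+ con 2 :* m)) := con 4 :* (con 2 :+ m)) refl m)

  second-factor : ∀ m → 2 + 3 * suc m ≡ 3 * (2 + m) ∸ 1
  second-factor m = cong (_∸ 1) (solve 1 (λ m → con 3 :+ con 3 :* (con 1 :+ m) := con 3 :* (con 2 :+ m)) refl m)

  second : ∀ n ts → (∀ m → n ≡ suc m → coefficient ts (suc (2 * m)) ≈ₚ monomial (D n) (2 * suc n + suc (2 * m))) →
           2 ≤ suc n → coefficient ts (2 * suc n ∸ 3) ≈ₚ monomial (fromℕ (3 * suc n ∸ 1) ℚ.* Cat n) (4 * suc n ∸ 3)
  second (suc m) ts h _ k = trans (cong (λ s → coeff (coefficient ts s) k) (odd m))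
    (trans (h m refl k) (cong₂ (λ f d → coeff (monomial (fromℕ f ℚ.* Cat (suc m)) d) k) (second-factor m) (second-degree m)))
  second zero ts h (s≤s ())

  build : ∀ n → Σ[ ts ∈ List Term ] Extraction.Represents n ts × Extraction.Coefficients n ts →
          Σ[ K ∈ (ℕ → Poly) ]
          (∀ s → s ≤ 2 * suc n ∸ 2 → NonNegCoeffs (K s) × HasDegree (K s) (2 * suc n + s))
          × 𝓦 (suc n) ≈ₛ C *ₛ ∑ₛ (2 * suc n ∸ 2) (λ s → eval (K s) zC² *ₛ 1/[1-zC²] ^ₛ suc s)
          × K (2 * suc n ∸ 2) ≈ₚ monomial (Cat n) (4 * suc n ∸ 2)
          × (2 ≤ suc n → K (2 * suc n ∸ 3) ≈ₚ monomial (fromℕ (3 * suc n ∸ 1) ℚ.* Cat n) (4 * suc n ∸ 3))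
  build n (ts , eq , adm , leads , top , next) =
    coefficient ts ,
    (λ s s≤ → coefficient≥0 (suc n) adm s ,
      (λ ≡0 → ℚ.<-irrefl (sym ≡0) (coefficient-lead (suc n) adm (leads s (subst (s ≤_) (even n) s≤)))) ,
      λ k lt → coefficient-degree (suc n) adm s k lt) ,
    subst (λ b → 𝓦 (suc n) ≈ₛ C *ₛ ∑ₛ b (λ s → eval (coefficient ts s) zC² *ₛ 1/[1-zC²] ^ₛ suc s)) (sym (even n)) eq ,
    (λ k → trans (cong (λ s → coeff (coefficient ts s) k) (even n))
      (trans (top k) (cong (λ d → coeff (monomial (Cat n) d) k) (top-degree n)))) ,
    second n ts next
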